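{- Let $k\ge2$, $m\ge1$ and $0<\alpha<1$. Among all $k$-uniform hypertrees with $m$ hyperedges, the last hypertree in $S_\alpha$-order is the hyperstar $S_m^{(k)}$.
   Context: Hypergraphs are finite; $k$-uniform means every hyperedge has exactly $k$ vertices; a hypertree is a connected hypergraph without cycles. The hyperstar $S_m^{(k)}$ consists of $m$ hyperedges of size $k$ which all share one common vertex and are otherwise pairwise disjoint. For a $k$-uniform hypergraph $\mathcal{H}$ on $[n]$, $\mathcal{A}(\mathcal{H})$ is the $k$-order $n$-dimensional tensor with entry $\frac1{(k-1)!}$ at $(i_1,\dots,i_k)$ if $\{i_1,\dots,i_k\}\in E(\mathcal{H})$ and $0$ otherwise; $\mathcal{D}(\mathcal{H})$ is the diagonal tensor of vertex degrees; $\mathcal{A}_\alpha(\mathcal{H})=\alpha\mathcal{D}(\mathcal{H})+(1-\alpha)\mathcal{A}(\mathcal{H})$. For a tensor $\mathcal{T}$, $\mathrm{Tr}_d(\mathcal{T})$ is the sum of the $d$-th powers of all $n(k-1)^{n-1}$ eigenvalues of $\mathcal{T}$ (roots of its characteristic polynomial, with multiplicity); in particular $\mathrm{Tr}_0(\mathcal{T})=n(k-1)^{n-1}$, and for $d\ge1$ $$\mathrm{Tr}_{d}(\mathcal{T})=(k-1)^{n-1}\sum_{d_1+\cdots+d_n=d}\ \prod_{i=1}^{n}\frac{1}{(d_i(k-1))!}\Big(\sum_{\gamma\in[n]^{k-1}}(\mathcal{T})_{i\gamma}\frac{\partial}{\partial a_{i\gamma}}\Big)^{d_i}\mathrm{tr}\big(A^{d(k-1)}\big),$$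 with $A=(a_{ij})$ an $n\times n$ matrix of indeterminates, $d_i\ge0$ integers, $\frac{\partial}{\partial a_{i\gamma}}=\frac{\partial}{\partial a_{i i_2}}\cdots\frac{\partial}{\partial a_{i i_k}}$ for $\gamma=i_2\cdots i_k$. $S_\alpha$-order: for $k$-uniform hypergraphs $\mathcal{H}_1,\mathcal{H}_2$ with $n$ vertices, $\mathcal{H}_1\prec_\alpha\mathcal{H}_2$ if there is $d\in\{1,\dots,n(k-1)^{n-1}-1\}$ with $\mathrm{Tr}_t(\mathcal{A}_\alpha(\mathcal{H}_1))=\mathrm{Tr}_t(\mathcal{A}_\alpha(\mathcal{H}_2))$ for $t=0,\dots,d-1$ and $\mathrm{Tr}_d(\mathcal{A}_\alpha(\mathcal{H}_1))<\mathrm{Tr}_d(\mathcal{A}_\alpha(\mathcal{H}_2))$. "$X$ is the last hypertree in a class" means $X$ is in the class and $\mathcal{H}\prec_\alpha X$ for every $\mathcal{H}$ in the class not isomorphic to $X$. -}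

module Defs where

open import Algebra.Bundles.Raw using (RawRing)
import Algebra.Definitions.RawMonoid as RawMonoidDefs
import Data.Bool.Properties as Bool
open import Data.Bool.Base using (if_then_else_)
open import Data.Fin.Base using (Fin; toℕ; quotient; combine) renaming (zero to fzero; suc to fsuc)
import Data.Fin.Properties as Fin
open import Data.Fin.Subset using (Subset; inside; outside; ⁅_⁆; _∪_; ∣_∣) renaming (_∈_ to _∈ᵛ_; ⊥ to ∅)
open import Data.Fin.Subset.Properties using () renaming (_∈?_ to _∈ᵛ?_)
open import Data.Integer.Base using (1ℤ)
open import Data.List.Base using (List; []; _∷_; map; foldr; length; filter; allFin; upTo; concatMap; cartesianProductWith)
open import Data.List.Membership.Propositional using (_∈_)
import Data.List.Membership.DecPropositional as DecMembership
open import Data.List.Relation.Unary.All using (All)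
open import Data.List.Relation.Unary.Unique.Propositional using (Unique)
import Data.List.Relation.Unary.Unique.Propositional.Properties as Unique
open import Data.Nat.Base as ℕ using (ℕ; zero; suc; _!; _∸_; _^_; _≤_; _<_; s≤s; _⊔_)
open import Data.Nat.DivMod using (_mod_)
open import Data.Nat.GeneralisedArithmetic using (fold)
import Data.Nat.Properties as ℕ
open import Data.Product.Base using (Σ; ∃; Σ-syntax; ∃-syntax; _×_; _,_; proj₁; proj₂)
open import Data.Product.Properties using (≡-dec)
open import Data.Rational.Base as ℚ using (ℚ; 0ℚ; 1ℚ; ½)
import Data.Rational.Properties as ℚ
open import Data.Rational.Solver using (module +-*-Solver)
open import Data.Vec.Base as Vec using (Vec)
import Data.Vec.Properties as Vec
open import Function.Base using (_∘_)
open import Function.Bundles using (_↔_; _⇔_; module Inverse)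
open import Function.Definitions using (Injective)
open import Level using (0ℓ)
open import Relation.Binary.Construct.Closure.ReflexiveTransitive using (Star)
open import Relation.Binary.Definitions using (DecidableEquality)
open import Relation.Binary.PropositionalEquality using (_≡_; _≢_; refl; sym; trans; cong; cong₂; subst; subst₂)
open import Relation.Nullary.Decidable.Core using (Dec; yes; no; does)
open import Relation.Nullary.Negation using (¬_; contradiction)

-- Real numbers: Cauchy sequences of rationals with the usual equality
-- and strict order. All operations are pointwise.

IsCauchy : (ℕ → ℚ) → Set
IsCauchy x = ∀ ε → 0ℚ ℚ.< ε → ∃[ N ] (∀ m n → N ≤ m → N ≤ n → ℚ.∣ x m ℚ.- x n ∣ ℚ.< ε)

record ℝ : Set where
  constructor mkℝ
  field
    seq    : ℕ → ℚ
    cauchy : IsCauchy seq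

open ℝ public

infix 4 _≈ℝ_ _<ℝ_

_≈ℝ_ : ℝ → ℝ → Set
x ≈ℝ y = ∀ ε → 0ℚ ℚ.< ε → ∃[ N ] (∀ n → N ≤ n → ℚ.∣ seq x n ℚ.- seq y n ∣ ℚ.< ε)

_<ℝ_ : ℝ → ℝ → Set
x <ℝ y = ∃[ ε ] (0ℚ ℚ.< ε × ∃[ N ] (∀ n → N ≤ n → seq x n ℚ.+ ε ℚ.< seq y n))

private
  half-pos : ∀ {ε} → 0ℚ ℚ.< ε → 0ℚ ℚ.< ½ ℚ.* ε
  half-pos {ε} 0<ε = subst (ℚ._< ½ ℚ.* ε) (ℚ.*-zeroʳ ½) (ℚ.*-monoʳ-<-pos ½ 0<ε)

  halves : ∀ ε → ½ ℚ.* ε ℚ.+ ½ ℚ.* ε ≡ ε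
  halves ε = trans (sym (ℚ.*-distribʳ-+ ε ½ ½)) (ℚ.*-identityˡ ε)

  +-regroup : ∀ a b c d → (a ℚ.+ b) ℚ.- (c ℚ.+ d) ≡ (a ℚ.- c) ℚ.+ (b ℚ.- d)
  +-regroup = solve 4 (λ a b c d → (a :+ b) :- (c :+ d) := (a :- c) :+ (b :- d)) refl
    where open +-*-Solver

  *-regroup : ∀ a b c d → (a ℚ.* b) ℚ.- (c ℚ.* d) ≡ a ℚ.* (b ℚ.- d) ℚ.+ (a ℚ.- c) ℚ.* d
  *-regroup = solve 4 (λ a b c d → (a :* b) :- (c :* d) := a :* (b :- d) :+ (a :- c) :* d) refl
    where open +-*-Solver

  neg-regroup : ∀ a b → ℚ.- (a ℚ.- b) ≡ (ℚ.- a) ℚ.- (ℚ.- b)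
  neg-regroup = solve 2 (λ a b → :- (a :- b) := (:- a) :- (:- b)) refl
    where open +-*-Solver

  cancel : ∀ a b → a ≡ (a ℚ.- b) ℚ.+ b
  cancel = solve 2 (λ a b → a := (a :- b) :+ b) refl
    where open +-*-Solver

const-cauchy : ∀ q → IsCauchy (λ _ → q)
const-cauchy q ε 0<ε = 0 , λ _ _ _ _ → subst (λ z → ℚ.∣ z ∣ ℚ.< ε) (sym (ℚ.+-inverseʳ q)) 0<ε

+-cauchy : ∀ x y → IsCauchy (λ n → seq x n ℚ.+ seq y n)
+-cauchy x y ε 0<ε =
  let (M , hx) = cauchy x (½ ℚ.* ε) (half-pos 0<ε)
      (N , hy) = cauchy y (½ ℚ.* ε) (half-pos 0<ε)
  in M ⊔ N , λ m n p q →
    let a = seq x m ; b = seq y m ; c = seq x n ; d = seq y n in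
    subst₂ ℚ._<_ (cong ℚ.∣_∣ (sym (+-regroup a b c d))) (halves ε)
      (ℚ.≤-<-trans (ℚ.∣p+q∣≤∣p∣+∣q∣ (a ℚ.- c) (b ℚ.- d))
        (ℚ.+-mono-< (hx m n (ℕ.m⊔n≤o⇒m≤o M N p) (ℕ.m⊔n≤o⇒m≤o M N q))
                    (hy m n (ℕ.m⊔n≤o⇒n≤o M N p) (ℕ.m⊔n≤o⇒n≤o M N q))))

neg-cauchy : ∀ x → IsCauchy (λ n → ℚ.- seq x n)
neg-cauchy x ε 0<ε =
  let (M , hx) = cauchy x ε 0<ε
  in M , λ m n p q →
    subst (ℚ._< ε)
      (trans (sym (ℚ.∣-p∣≡∣p∣ (seq x m ℚ.- seq x n))) (cong ℚ.∣_∣ (neg-regroup (seq x m) (seq x n))))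
      (hx m n p q)

private
  bounded : ∀ x → ∃[ B ] (ℚ.Positive B × ∃[ N ] (∀ n → N ≤ n → ℚ.∣ seq x n ∣ ℚ.≤ B))
  bounded x =
    let (N , h) = cauchy x 1ℚ (ℚ.positive⁻¹ 1ℚ)
        c = seq x N
    in 1ℚ ℚ.+ ℚ.∣ c ∣ ,
       ℚ.pos+nonNeg⇒pos 1ℚ ℚ.∣ c ∣ {{ℚ.∣-∣-nonNeg c}} ,
       N , λ n p →
         subst (ℚ._≤ 1ℚ ℚ.+ ℚ.∣ c ∣) (cong ℚ.∣_∣ (sym (cancel (seq x n) c)))
           (ℚ.≤-trans (ℚ.∣p+q∣≤∣p∣+∣q∣ (seq x n ℚ.- c) c)
             (ℚ.+-monoˡ-≤ ℚ.∣ c ∣ (ℚ.<⇒≤ (h n N p ℕ.≤-refl))))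

  *-small : ∀ {a b B δ} → ℚ.Positive B → ℚ.∣ a ∣ ℚ.≤ B → ℚ.∣ b ∣ ℚ.< δ → ℚ.∣ a ℚ.* b ∣ ℚ.< B ℚ.* δ
  *-small {a} {b} {B} {δ} pB a≤ b< =
    subst (ℚ._< B ℚ.* δ) (sym (ℚ.∣p*q∣≡∣p∣*∣q∣ a b))
      (ℚ.≤-<-trans (ℚ.*-monoʳ-≤-nonNeg ℚ.∣ b ∣ {{ℚ.∣-∣-nonNeg b}} a≤)
                   (ℚ.*-monoʳ-<-pos B {{pB}} b<))

  scale : ∀ B → ℚ.Positive B → ∀ {ε} → 0ℚ ℚ.< ε → ∃[ δ ] (0ℚ ℚ.< δ × B ℚ.* δ ≡ ½ ℚ.* ε)
  scale B pB {ε} 0<ε =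
    B⁻¹ ℚ.* (½ ℚ.* ε) ,
    subst (ℚ._< B⁻¹ ℚ.* (½ ℚ.* ε)) (ℚ.*-zeroʳ B⁻¹)
      (ℚ.*-monoʳ-<-pos B⁻¹ {{ℚ.1/pos⇒pos B {{pB}}}} (half-pos 0<ε)) ,
    trans (sym (ℚ.*-assoc B B⁻¹ (½ ℚ.* ε)))
      (trans (cong (ℚ._* (½ ℚ.* ε)) (ℚ.*-inverseʳ B {{nz}})) (ℚ.*-identityˡ (½ ℚ.* ε)))
    where
    nz  = ℚ.pos⇒nonZero B {{pB}}
    B⁻¹ = (ℚ.1/ B) {{nz}}

*-cauchy : ∀ x y → IsCauchy (λ n → seq x n ℚ.* seq y n)
*-cauchy x y ε 0<ε =
  let (B , pB , K , hB) = bounded x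
      (C , pC , L , hC) = bounded y
      (δ , 0<δ , Bδ) = scale B pB 0<ε
      (η , 0<η , Cη) = scale C pC 0<ε
      (M , hx) = cauchy x η 0<η
      (N , hy) = cauchy y δ 0<δ
      KL = K ⊔ L
      MN = M ⊔ N
  in KL ⊔ MN , λ m n p q →
    let a = seq x m ; b = seq y m ; c = seq x n ; d = seq y n
        pKL = ℕ.m⊔n≤o⇒m≤o KL MN p ; pMN = ℕ.m⊔n≤o⇒n≤o KL MN p
        qKL = ℕ.m⊔n≤o⇒m≤o KL MN q ; qMN = ℕ.m⊔n≤o⇒n≤o KL MN q
        s₁ = *-small pB (hB m (ℕ.m⊔n≤o⇒m≤o K L pKL))
                        (hy m n (ℕ.m⊔n≤o⇒n≤o M N pMN) (ℕ.m⊔n≤o⇒n≤o M N qMN))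
        s₂ = *-small pC (hC n (ℕ.m⊔n≤o⇒n≤o K L qKL))
                        (hx m n (ℕ.m⊔n≤o⇒m≤o M N pMN) (ℕ.m⊔n≤o⇒m≤o M N qMN))
    in subst₂ ℚ._<_ (cong ℚ.∣_∣ (sym (*-regroup a b c d))) (halves ε)
         (ℚ.≤-<-trans (ℚ.∣p+q∣≤∣p∣+∣q∣ (a ℚ.* (b ℚ.- d)) ((a ℚ.- c) ℚ.* d))
           (ℚ.+-mono-< (subst (ℚ.∣ a ℚ.* (b ℚ.- d) ∣ ℚ.<_) Bδ s₁)
             (subst₂ ℚ._<_ (cong ℚ.∣_∣ (ℚ.*-comm d (a ℚ.- c))) Cη s₂)))

fromℚ : ℚ → ℝ
fromℚ q = mkℝ (λ _ → q) (const-cauchy q)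

0ℝ 1ℝ : ℝ
0ℝ = fromℚ 0ℚ
1ℝ = fromℚ 1ℚ

ℝ-rawRing : RawRing 0ℓ 0ℓ
ℝ-rawRing = record
  { Carrier = ℝ
  ; _≈_     = _≈ℝ_
  ; _+_     = λ x y → mkℝ (λ n → seq x n ℚ.+ seq y n) (+-cauchy x y)
  ; _*_     = λ x y → mkℝ (λ n → seq x n ℚ.* seq y n) (*-cauchy x y)
  ; -_      = λ x → mkℝ (λ n → ℚ.- seq x n) (neg-cauchy x)
  ; 0#      = 0ℝ
  ; 1#      = 1ℝ
  }

-- The edge set is represented by a repetition-free list, whose order is
-- disregarded by _≅_.
record Hypergraph : Set where
  field
    order  : ℕ
    edges  : List (Subset order)
    unique : Unique edges

  Vertex : Set
  Vertex = Fin order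

open Hypergraph public

_≟ˢ_ : ∀ {n} → DecidableEquality (Subset n)
_≟ˢ_ = Vec.≡-dec Bool._≟_

_∈ᴱ?_ : ∀ {n} (e : Subset n) (es : List (Subset n)) → Dec (e ∈ es)
_∈ᴱ?_ = DecMembership._∈?_ _≟ˢ_

Uniform : ℕ → Hypergraph → Set
Uniform k H = All (λ e → ∣ e ∣ ≡ k) (edges H)

degree : (H : Hypergraph) → Vertex H → ℕ
degree H v = length (filter (v ∈ᵛ?_) (edges H))

Adjacent : (H : Hypergraph) → Vertex H → Vertex H → Set
Adjacent H u v = ∃[ e ] (e ∈ edges H × u ∈ᵛ e × v ∈ᵛ e)

Connected : Hypergraph → Set
Connected H = ∀ u v → Star (Adjacent H) u v

-- A (Berge) cycle v₀ e₀ v₁ e₁ … v₀ with len ≥ 2 distinct vertices and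
-- len distinct hyperedges, where vᵢ and vᵢ₊₁ (indices mod len) lie in eᵢ.
-- In particular two hyperedges sharing two vertices form a cycle.
record Cycle (H : Hypergraph) : Set where
  field
    len-2 : ℕ

  len : ℕ
  len = suc (suc len-2)

  next : Fin len → Fin len
  next i = suc (toℕ i) mod len

  field
    vertex           : Fin len → Vertex H
    edge             : Fin len → Subset (order H)
    vertex-injective : Injective _≡_ _≡_ vertex
    edge-injective   : Injective _≡_ _≡_ edge
    edge∈edges       : ∀ i → edge i ∈ edges H
    vertex∈edge      : ∀ i → vertex i ∈ᵛ edge i
    next∈edge        : ∀ i → vertex (next i) ∈ᵛ edge i

record IsUniformHypertree (k m : ℕ) (H : Hypergraph) : Set where
  field
    uniform   : Uniform k H
    size      : length (edges H) ≡ m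
    connected : Connected H
    acyclic   : ¬ Cycle H

image : ∀ {n₁ n₂} → Fin n₁ ↔ Fin n₂ → Subset n₁ → Subset n₂
image σ e = Vec.tabulate (λ v → Vec.lookup e (Inverse.from σ v))

infix 4 _≅_

_≅_ : Hypergraph → Hypergraph → Set
H₁ ≅ H₂ = Σ[ σ ∈ Fin (order H₁) ↔ Fin (order H₂) ]
  (∀ e → e ∈ edges H₁ ⇔ image σ e ∈ edges H₂)

-- The common vertex is 0; the other vertices, Fin (m * (k ∸ 1)), are split
-- into m consecutive blocks of size k ∸ 1, and hyperedge j is {0} together
-- with the j-th block.
starEdge : ∀ k m → Fin m → Subset (suc (m ℕ.* (k ∸ 1)))
starEdge k m j = inside Vec.∷ Vec.tabulate (λ x → does (quotient {m} (k ∸ 1) x Fin.≟ j))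

private
  tabulate-injective : ∀ {A : Set} {n} {f g : Fin n → A} →
                       Vec.tabulate f ≡ Vec.tabulate g → ∀ x → f x ≡ g x
  tabulate-injective {f = f} {g} eq x =
    trans (sym (Vec.lookup∘tabulate f x))
      (trans (cong (λ v → Vec.lookup v x) eq) (Vec.lookup∘tabulate g x))

  starEdge-injective : ∀ k m → 2 ≤ k → Injective _≡_ _≡_ (starEdge k m)
  starEdge-injective (suc zero)    m (s≤s ())
  starEdge-injective (suc (suc r)) m _ {i} {j} eq = from-does (i Fin.≟ i) (i Fin.≟ j) at-i
    where
    x : Fin (m ℕ.* suc r)
    x = combine i fzero

    at-i : does (i Fin.≟ i) ≡ does (i Fin.≟ j)
    at-i = subst (λ y → does (y Fin.≟ i) ≡ does (y Fin.≟ j))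
      (cong proj₁ (Fin.remQuot-combine {m} {suc r} i fzero))
      (tabulate-injective (Vec.∷-injectiveʳ eq) x)

    from-does : (d : Dec (i ≡ i)) (d′ : Dec (i ≡ j)) → does d ≡ does d′ → i ≡ j
    from-does _         (yes i≡j) _ = i≡j
    from-does (no i≢i)  (no _)    _ = contradiction refl i≢i
    from-does (yes _)   (no _)    ()

hyperstar : ∀ k m → 2 ≤ k → Hypergraph
hyperstar k m 2≤k = record
  { order  = suc (m ℕ.* (k ∸ 1))
  ; edges  = map (starEdge k m) (allFin m)
  ; unique = Unique.map⁺ (starEdge-injective k m 2≤k) (Unique.allFin⁺ m)
  }

words : ∀ n r → List (Vec (Fin n) r)
words n zero    = Vec.[] ∷ []
words n (suc r) = cartesianProductWith Vec._∷_ (allFin n) (words n r)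

-- All (d₁,…,dₙ) with d₁ + ⋯ + dₙ = d.
compositions : ∀ n → ℕ → List (Vec ℕ n)
compositions zero    zero    = Vec.[] ∷ []
compositions zero    (suc d) = []
compositions (suc n) d       = concatMap (λ e → map (e Vec.∷_) (compositions n (d ∸ e))) (upTo (suc d))

-- Meant for a commutative ring R containing the rationals via ι, as fromℚ
-- does for ℝ.
module Tensors {c ℓ} (R : RawRing c ℓ) (ι : ℚ → RawRing.Carrier R) where

  open RawRing R
  open RawMonoidDefs +-rawMonoid using () renaming (_×_ to _·_)

  ∑ : ∀ {a} {A : Set a} → List A → (A → Carrier) → Carrier
  ∑ xs f = foldr (λ x s → f x + s) 0# xs

  ∏ : ∀ {a} {A : Set a} → List A → (A → Carrier) → Carrier
  ∏ xs f = foldr (λ x s → f x * s) 1# xs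

  nat : ℕ → Carrier
  nat n = n · 1#

  1/_! : ℕ → Carrier
  1/ n ! = ι ((1ℤ ℚ./ (n !)) {{n ℕ.!≢0}})

  -- Tensors of order k ≥ 1 and dimension n. The first index is separated
  -- from the remaining k - 1 ones.
  Tensor : ℕ → ℕ → Set c
  Tensor k n = Fin n → Vec (Fin n) (k ∸ 1) → Carrier

  adjacencyTensor : ∀ k (H : Hypergraph) → Tensor k (order H)
  adjacencyTensor k H i γ =
    if does (Vec.foldr′ (λ j s → ⁅ j ⁆ ∪ s) ∅ (i Vec.∷ γ) ∈ᴱ? edges H) then 1/ (k ∸ 1) ! else 0#

  degreeTensor : ∀ k (H : Hypergraph) → Tensor k (order H)
  degreeTensor k H i γ =
    if does (Vec.≡-dec Fin._≟_ γ (Vec.replicate (k ∸ 1) i)) then nat (degree H i) else 0#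

  A[_] : Carrier → ∀ k (H : Hypergraph) → Tensor k (order H)
  A[ α ] k H i γ = α * degreeTensor k H i γ + (1# + - α) * adjacencyTensor k H i γ

  -- Polynomial expressions in the entries a i j of an n × n matrix of
  -- indeterminates.
  data Poly (n : ℕ) : Set c where
    con : Carrier → Poly n
    a   : Fin n → Fin n → Poly n
    _⊕_ : Poly n → Poly n → Poly n
    _⊗_ : Poly n → Poly n → Poly n

  ∑ᴾ : ∀ {n b} {B : Set b} → List B → (B → Poly n) → Poly n
  ∑ᴾ xs f = foldr (λ x s → f x ⊕ s) (con 0#) xs

  ∂ : ∀ {n} → Fin n → Fin n → Poly n → Poly n
  ∂ i j (con _) = con 0#
  ∂ i j (a k l) = if does (≡-dec Fin._≟_ Fin._≟_ (i , j) (k , l)) then con 1# else con 0#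
  ∂ i j (p ⊕ q) = ∂ i j p ⊕ ∂ i j q
  ∂ i j (p ⊗ q) = (∂ i j p ⊗ q) ⊕ (p ⊗ ∂ i j q)

  -- ∂/∂a_{iγ} = ∂/∂a_{i i₂} ⋯ ∂/∂a_{i i_k} for γ = i₂ ⋯ i_k
  ∂* : ∀ {n r} → Fin n → Vec (Fin n) r → Poly n → Poly n
  ∂* i Vec.[]      p = p
  ∂* i (j Vec.∷ γ) p = ∂ i j (∂* i γ p)

  constantTerm : ∀ {n} → Poly n → Carrier
  constantTerm (con x) = x
  constantTerm (a _ _) = 0#
  constantTerm (p ⊕ q) = constantTerm p + constantTerm q
  constantTerm (p ⊗ q) = constantTerm p * constantTerm q

  matrixPower : ∀ {n} → ℕ → Fin n → Fin n → Poly n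
  matrixPower zero        i j = if does (i Fin.≟ j) then con 1# else con 0#
  matrixPower {n} (suc N) i j = ∑ᴾ (allFin n) (λ l → a i l ⊗ matrixPower N l j)

  tr-A^ : ∀ {n} → ℕ → Poly n
  tr-A^ {n} N = ∑ᴾ (allFin n) (λ i → matrixPower N i i)

  operator : ∀ {k n} → Tensor k n → Fin n → Poly n → Poly n
  operator {k} {n} T i p = ∑ᴾ (words n (k ∸ 1)) (λ γ → con (T i γ) ⊗ ∂* i γ p)

  -- Tr_d(T), the sum of the d-th powers of the eigenvalues of T, given by
  -- the explicit trace formula. The differential operator has the order
  -- d (k - 1), which is the degree of the homogeneous polynomial
  -- tr (A^(d (k - 1))), so what it produces is its own constant term.
  Tr : ∀ {k n} → Tensor k n → ℕ → Carrier
  Tr {k} {n} T zero      = nat (n ℕ.* (k ∸ 1) ^ (n ∸ 1))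
  Tr {k} {n} T d@(suc _) = nat ((k ∸ 1) ^ (n ∸ 1)) * ∑ (compositions n d) term
    where
    term : Vec ℕ n → Carrier
    term ds =
      ∏ (allFin n) (λ i → 1/ (Vec.lookup ds i ℕ.* (k ∸ 1)) !) *
      constantTerm
        (foldr (λ i p → fold p (operator {k} T i) (Vec.lookup ds i)) (tr-A^ (d ℕ.* (k ∸ 1))) (allFin n))

open Tensors ℝ-rawRing fromℚ public using () renaming (Tr to Trℝ; A[_] to Aℝ[_])

Sα : ℝ → ℕ → ℕ → Hypergraph → ℝ
Sα α k t H = Trℝ {k} (Aℝ[ α ] k H) t

infix 4 _≺[_,_]_

_≺[_,_]_ : Hypergraph → ℝ → ℕ → Hypergraph → Set
H₁ ≺[ α , k ] H₂ =
  order H₁ ≡ order H₂ ×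
  ∃[ d ] ( 1 ≤ d
         × d ≤ order H₁ ℕ.* (k ∸ 1) ^ (order H₁ ∸ 1) ∸ 1
         × (∀ t → t < d → Sα α k t H₁ ≈ℝ Sα α k t H₂)
         × Sα α k d H₁ <ℝ Sα α k d H₂)

IsLast : ℝ → ℕ → (Hypergraph → Set) → Hypergraph → Set
IsLast α k C X = C X × (∀ H → C H → ¬ (H ≅ X) → H ≺[ α , k ] X)

{-# OPTIONS --safe #-}
-- Traces of degree 0 and 1 agree for all hypertrees with m edges. With
-- r = k − 1 and n = 1 + m r, the second trace is
--   Tr₂ = rⁿ⁻¹ (α² Σᵥ d(v)² + c),
-- where c depends only on k, m and α: by the trace formula a product of tensor
-- entries contributes through the closed walks running exactly once through
-- each of the prescribed arcs, and for two operators these exist only if both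
-- are loops at one vertex or (for k = 2) the two directions of one edge.
-- Finally Σᵥ d(v)² = Σ |e ∩ f| over ordered pairs of edges. In a hypertree,
-- |e ∩ f| ≤ 1 for e ≠ f, so the sum is maximal exactly when all edges meet
-- pairwise; in the absence of triangles they then share one vertex, so that
-- the hypertree is the hyperstar.
-- The order n = 1 + m r is found by adding the edges one at a time and counting
-- components: acyclicity makes each edge join k different ones.
module Submission where

open import Defs
open import Algebra.Bundles using (CommutativeMonoid; CommutativeRing)
open import Algebra.Bundles.Raw using (RawRing)
import Algebra.Properties.CommutativeMonoid.Sum
import Algebra.Properties.Semiring.Sum
open import Data.Bool.Base using (Bool; true; false; if_then_else_)
open import Data.Fin.Base as Fin using (Fin; toℕ; quotient; remainder; remQuot; combine; punchIn; punchOut; _↑ˡ_; _↑ʳ_) renaming (zero to fzero; suc to fsuc)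
import Data.Fin.Properties as Fin
open import Data.Fin.Subset using (Subset; inside; outside; ∣_∣; ⁅_⁆; _∪_) renaming (⊥ to ∅; _∈_ to _∈ᵛ_; _∉_ to _∉ᵛ_)
open import Data.Fin.Subset.Properties using () renaming (_∈?_ to _∈ᵛ?_)
import Data.Fin.Subset.Properties as Subset
open import Data.List.Base as List using (List; []; _∷_; length; allFin; filter; foldr; replicate)
open import Data.List.Membership.Propositional using (_∈_; _∉_)
open import Data.List.Membership.Propositional.Properties using (∈-map⁻; ∈-map⁺; ∈-allFin; ∈-tabulate⁺; ∈-tabulate⁻; ∈-lookup)
import Data.List.Properties as List
open import Data.List.Relation.Unary.All as All using (All; []; _∷_)
open import Data.List.Relation.Unary.All.Properties using (All¬⇒¬Any)
open import Data.List.Relation.Unary.AllPairs using ([]; _∷_)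
open import Data.List.Relation.Unary.Any using (here; there)
open import Data.List.Relation.Unary.Unique.Propositional using (Unique)
open import Data.Nat.Base as ℕ using (ℕ; zero; suc; _∸_; _≤_; _<_; z≤n; s≤s; z<s; s<s; _^_; _!)
open import Data.Nat.DivMod using (_mod_; _%_; m<n⇒m%n≡m; n%n≡0)
open import Data.Nat.GeneralisedArithmetic using (fold)
open import Data.Nat.Induction using (<-rec)
import Data.Nat.Properties as ℕ
open import Data.Nat.Solver using () renaming (module +-*-Solver to ℕ-Solver)
open import Data.Product.Base using (∃-syntax; _×_; _,_; proj₁; proj₂; uncurry)
open import Data.Product.Properties using (≡-dec)
open import Data.Rational.Base as ℚ using (ℚ; 0ℚ; 1ℚ; _+_; _*_; _-_; -_)
import Data.Rational.Properties as ℚ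
open import Data.Rational.Solver using () renaming (module +-*-Solver to ℚ-Solver)
open import Data.Sum.Base using (_⊎_; inj₁; inj₂)
open import Data.Vec.Base as Vec using (Vec; []; _∷_)
import Data.Vec.Properties as Vec
open import Function.Base using (_∘_; id)
open import Function.Bundles using (_↔_; mk↔ₛ′; mk⇔)
open import Level using (0ℓ)
open import Relation.Binary.Construct.Closure.ReflexiveTransitive as Star using (Star; _◅_; _◅◅_)
open import Relation.Binary.Definitions using (tri<; tri≈; tri>)
open import Relation.Binary.PropositionalEquality using (_≡_; _≢_; refl; sym; trans; cong; cong₂; subst; subst₂; module ≡-Reasoning)
open import Relation.Nullary.Decidable using (does-⇔; dec-true; dec-false)
open import Relation.Nullary.Decidable.Core using (Dec; yes; no; does; _×-dec_; ¬?; decidable-stable)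
open import Relation.Nullary.Negation using (¬_; contradiction)

-- Reals are Cauchy sequences with pointwise operations, so each entry of a trace is a rational
-- obtained by the same formula from the corresponding entry of α. The trace identities are
-- therefore exact identities in ℚ, valid with any rational in place of α. Positivity of α enters
-- only at the end, where a single rational gap has to serve all late entries.
--
-- The vanishing in Tr₂ rests on balance: a closed walk leaves each vertex as often as it enters it.
-- An operator at i prescribes r arcs out of i. A diagonal entry makes them loops. An adjacency
-- entry sends them to r distinct vertices other than i, since a word of length k spanning k
-- vertices repeats no letter. An edge term at i thus needs r arcs into i from the other operator;
-- loops do not change the balance, and an edge term supplies at most one such arc, which forces r =
-- 1. Loops at two different vertices are balanced, so they need another argument: a walk along
-- loops never leaves its start.

module Σℕ = Algebra.Properties.Semiring.Sum ℕ.+-*-semiring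

module SingleTerm {c ℓ} (M : CommutativeMonoid c ℓ) where
  open CommutativeMonoid M renaming (refl to ≈-refl; trans to ≈-trans)
  open Algebra.Properties.CommutativeMonoid.Sum M

  sum-zero : ∀ {n} (f : Fin n → Carrier) → (∀ i → f i ≈ ε) → sum f ≈ ε
  sum-zero {zero}  f z = ≈-refl
  sum-zero {suc n} f z = ≈-trans (∙-cong (z fzero) (sum-zero (f ∘ fsuc) (z ∘ fsuc))) (identityˡ ε)

  sum-single : ∀ {n} (f : Fin n → Carrier) i → (∀ j → j ≢ i → f j ≈ ε) → sum f ≈ f i
  sum-single f fzero z = ≈-trans (∙-congˡ (sum-zero (f ∘ fsuc) λ j → z (fsuc j) λ ())) (identityʳ _)
  sum-single f (fsuc i) z =
    ≈-trans (∙-cong (z fzero λ ()) (sum-single (f ∘ fsuc) i λ j j≢i → z (fsuc j) (j≢i ∘ Fin.suc-injective)))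
            (identityˡ _)

module Single-ℕ = SingleTerm ℕ.+-0-commutativeMonoid
module Single-ℚ = SingleTerm ℚ.+-0-commutativeMonoid

sum-mono-≤ : ∀ {n} {f g : Fin n → ℕ} → (∀ i → f i ≤ g i) → Σℕ.sum f ≤ Σℕ.sum g
sum-mono-≤ {zero}  f≤g = z≤n
sum-mono-≤ {suc n} f≤g = ℕ.+-mono-≤ (f≤g fzero) (sum-mono-≤ (f≤g ∘ fsuc))

sum-mono-< : ∀ {n} {f g : Fin n → ℕ} → (∀ i → f i ≤ g i) → ∀ i → f i < g i → Σℕ.sum f < Σℕ.sum g
sum-mono-< f≤g fzero    lt = ℕ.+-mono-<-≤ lt (sum-mono-≤ (f≤g ∘ fsuc))
sum-mono-< f≤g (fsuc i) lt = ℕ.+-mono-≤-< (f≤g fzero) (sum-mono-< (f≤g ∘ fsuc) i lt)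

-- Indicators and cardinalities of subsets

𝟙 : Bool → ℕ
𝟙 b = if b then 1 else 0

𝟙-yes : ∀ {P : Set} (d : Dec P) → P → 𝟙 (does d) ≡ 1
𝟙-yes d p = cong 𝟙 (dec-true d p)

𝟙-no : ∀ {P : Set} (d : Dec P) → ¬ P → 𝟙 (does d) ≡ 0
𝟙-no d ¬p = cong 𝟙 (dec-false d ¬p)

∈⇒lookup : ∀ {n} {v : Fin n} {e : Subset n} → v ∈ᵛ e → Vec.lookup e v ≡ inside
∈⇒lookup = Vec.[]=⇒lookup

∉⇒lookup : ∀ {n} (v : Fin n) (e : Subset n) → v ∉ᵛ e → Vec.lookup e v ≡ outside
∉⇒lookup v e v∉e with Vec.lookup e v in eq
... | true  = contradiction (Vec.lookup⇒[]= v e eq) v∉e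
... | false = refl

does-∈? : ∀ {n} (v : Fin n) (e : Subset n) → does (v ∈ᵛ? e) ≡ Vec.lookup e v
does-∈? v e with v ∈ᵛ? e
... | yes v∈e = sym (∈⇒lookup v∈e)
... | no  v∉e = sym (∉⇒lookup v e v∉e)

∣∣-as-sum : ∀ {n} (e : Subset n) → ∣ e ∣ ≡ Σℕ.sum (λ v → 𝟙 (Vec.lookup e v))
∣∣-as-sum []            = refl
∣∣-as-sum (inside ∷ e)  = cong suc (∣∣-as-sum e)
∣∣-as-sum (outside ∷ e) = ∣∣-as-sum e

∣∣≡suc⇒nonempty : ∀ {n r} (e : Subset n) → ∣ e ∣ ≡ suc r → ∃[ v ] v ∈ᵛ e
∣∣≡suc⇒nonempty (inside ∷ e)  eq = fzero , Vec.here
∣∣≡suc⇒nonempty (outside ∷ e) eq = let (v , v∈e) = ∣∣≡suc⇒nonempty e eq in fsuc v , Vec.there v∈e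

-- Walks, cycles and the number of vertices

-- Indexed by the length, so that a shortest walk is available through strong induction. The list
-- `es` will hold the edges added so far.
data Walk {n} (es : List (Subset n)) : ℕ → Fin n → Fin n → Set where
  []   : ∀ {u} → Walk es 0 u u
  step : ∀ {l u v w} e → e ∈ es → u ∈ᵛ e → w ∈ᵛ e → Walk es l w v → Walk es (suc l) u v

module _ {n} {es : List (Subset n)} where

  _++ʷ_ : ∀ {l₁ l₂ u v w} → Walk es l₁ u v → Walk es l₂ v w → Walk es (l₁ ℕ.+ l₂) u w
  []                 ++ʷ q = q
  step e e∈ u∈ w∈ p ++ʷ q = step e e∈ u∈ w∈ (p ++ʷ q)

  reverseʷ : ∀ {l u v} → Walk es l u v → ∃[ l′ ] Walk es l′ v u
  reverseʷ []                  = 0 , []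
  reverseʷ (step e e∈ u∈ w∈ p) = let (l′ , q) = reverseʷ p in _ , (q ++ʷ step e e∈ w∈ u∈ [])

  weakenʷ : ∀ {e l u v} → Walk es l u v → Walk (e ∷ es) l u v
  weakenʷ []                  = []
  weakenʷ (step e e∈ u∈ w∈ p) = step e (there e∈) u∈ w∈ (weakenʷ p)

  vertexAt : ∀ {l u v} → Walk es l u v → Fin (suc l) → Fin n
  vertexAt {u = u} p fzero                = u
  vertexAt (step e e∈ u∈ w∈ p) (fsuc i) = vertexAt p i

  vertexAt-end : ∀ {l u v} (p : Walk es l u v) i → toℕ i ≡ l → vertexAt p i ≡ v
  vertexAt-end []                  fzero    _  = refl
  vertexAt-end (step e e∈ u∈ w∈ p) fzero    ()
  vertexAt-end (step e e∈ u∈ w∈ p) (fsuc i) eq = vertexAt-end p i (ℕ.suc-injective eq)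

  drop-walk : ∀ {l u v} (p : Walk es l u v) i → ∃[ l′ ] (l′ ≤ l × Walk es l′ (vertexAt p i) v)
  drop-walk p fzero = _ , ℕ.≤-refl , p
  drop-walk (step e e∈ u∈ w∈ p) (fsuc i) =
    let (l′ , l′≤l , q) = drop-walk p i in l′ , ℕ.m≤n⇒m≤1+n l′≤l , q

  shortcut-vertex : ∀ {l u v} (p : Walk es l u v) i j → toℕ i < toℕ j → vertexAt p i ≡ vertexAt p j →
                    ∃[ l′ ] (l′ < l × Walk es l′ u v)
  shortcut-vertex (step e e∈ u∈ w∈ p) fzero (fsuc j) _ eq =
    let (l′ , l′≤l , q) = drop-walk p j in l′ , s≤s l′≤l , subst (λ x → Walk es l′ x _) (sym eq) q
  shortcut-vertex (step e e∈ u∈ w∈ p) (fsuc i) (fsuc j) (s≤s i<j) eq =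
    let (l′ , l′<l , q) = shortcut-vertex p i j i<j eq in suc l′ , s<s l′<l , step e e∈ u∈ w∈ q

  module _ (closing : Subset n) where

    -- The i-th edge of the walk, and the closing edge at the last index.
    edgeAt : ∀ {l u v} → Walk es l u v → Fin (suc l) → Subset n
    edgeAt []                  fzero    = closing
    edgeAt (step e e∈ u∈ w∈ p) fzero    = e
    edgeAt (step e e∈ u∈ w∈ p) (fsuc i) = edgeAt p i

    edgeAt-end : ∀ {l u v} (p : Walk es l u v) i → toℕ i ≡ l → edgeAt p i ≡ closing
    edgeAt-end []                  fzero    _  = refl
    edgeAt-end (step e e∈ u∈ w∈ p) fzero    ()
    edgeAt-end (step e e∈ u∈ w∈ p) (fsuc i) eq = edgeAt-end p i (ℕ.suc-injective eq)

    edgeAt-∈ : ∀ {l u v} (p : Walk es l u v) i → toℕ i < l → edgeAt p i ∈ es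
    edgeAt-∈ (step e e∈ u∈ w∈ p) fzero    _         = e∈
    edgeAt-∈ (step e e∈ u∈ w∈ p) (fsuc i) (s≤s i<l) = edgeAt-∈ p i i<l

    vertexAt∈edgeAt : ∀ {l u v} (p : Walk es l u v) → v ∈ᵛ closing → ∀ i → vertexAt p i ∈ᵛ edgeAt p i
    vertexAt∈edgeAt []                  v∈ fzero    = v∈
    vertexAt∈edgeAt (step e e∈ u∈ w∈ p) v∈ fzero    = u∈
    vertexAt∈edgeAt (step e e∈ u∈ w∈ p) v∈ (fsuc i) = vertexAt∈edgeAt p v∈ i

    nextAt∈edgeAt : ∀ {l u v} (p : Walk es l u v) i j → toℕ j ≡ suc (toℕ i) → vertexAt p j ∈ᵛ edgeAt p i
    nextAt∈edgeAt (step e e∈ u∈ w∈ p) fzero    (fsuc fzero) _  = w∈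
    nextAt∈edgeAt (step e e∈ u∈ w∈ p) (fsuc i) (fsuc j)     eq = nextAt∈edgeAt p i j (ℕ.suc-injective eq)

    -- Cuts the walk behind its i-th edge. The returned vertex still lies in that edge, so an
    -- earlier occurrence of the same edge can jump straight to it.
    drop-after-edge : ∀ {l u v} (p : Walk es l u v) i → toℕ i < l →
                      ∃[ x ] (x ∈ᵛ edgeAt p i × ∃[ l′ ] (l′ < l × Walk es l′ x v))
    drop-after-edge (step e e∈ u∈ w∈ p) fzero    _         = _ , w∈ , _ , ℕ.n<1+n _ , p
    drop-after-edge (step e e∈ u∈ w∈ p) (fsuc i) (s≤s i<l) =
      let (x , x∈ , l′ , l′<l , q) = drop-after-edge p i i<l in x , x∈ , l′ , ℕ.m<n⇒m<1+n l′<l , q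

    shortcut-edge : ∀ {l u v} (p : Walk es l u v) i j → toℕ i < toℕ j → toℕ j < l → edgeAt p i ≡ edgeAt p j →
                    ∃[ l′ ] (l′ < l × Walk es l′ u v)
    shortcut-edge (step e e∈ u∈ w∈ p) fzero (fsuc j) _ (s≤s j<l) eq =
      let (x , x∈ , l′ , l′<l , q) = drop-after-edge p j j<l
      in suc l′ , s<s l′<l , step e e∈ u∈ (subst (x ∈ᵛ_) (sym eq) x∈) q
    shortcut-edge (step e e∈ u∈ w∈ p) (fsuc i) (fsuc j) (s≤s i<j) (s≤s j<l) eq =
      let (l′ , l′<l , q) = shortcut-edge p i j i<j j<l eq in suc l′ , s<s l′<l , step e e∈ u∈ w∈ q

distinct⇒injective : ∀ {n} {A : Set} (f : Fin n → A) → (∀ i j → toℕ i < toℕ j → f i ≢ f j) →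
                     ∀ {i j} → f i ≡ f j → i ≡ j
distinct⇒injective f distinct {i} {j} eq with ℕ.<-cmp (toℕ i) (toℕ j)
... | tri< i<j _ _ = contradiction eq (distinct i j i<j)
... | tri≈ _ i≡j _ = Fin.toℕ-injective i≡j
... | tri> _ _ j<i = contradiction (sym eq) (distinct j i j<i)

toℕ-next : ∀ l (i : Fin (suc l)) →
           (toℕ i ≡ l × suc (toℕ i) mod suc l ≡ fzero) ⊎ (toℕ (suc (toℕ i) mod suc l) ≡ suc (toℕ i))
toℕ-next l i with ℕ.m≤n⇒m<n∨m≡n (Fin.toℕ<n i)
... | inj₁ lt = inj₂ (trans (Fin.toℕ-fromℕ< _) (m<n⇒m%n≡m lt))
... | inj₂ eq = inj₁ (ℕ.suc-injective eq , Fin.toℕ-injective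
                 (trans (Fin.toℕ-fromℕ< _) (trans (cong (_% suc l) eq) (n%n≡0 (suc l)))))

-- A shortest walk between two vertices of a further edge closes up to a cycle.
acyclic⇒separated : ∀ (H : Hypergraph) → ¬ Cycle H → ∀ {es e} → (∀ {f} → f ∈ es → f ∈ edges H) →
                    e ∈ edges H → e ∉ es → ∀ {u v} → u ∈ᵛ e → v ∈ᵛ e → u ≢ v →
                    ∀ l → ¬ Walk es l u v
acyclic⇒separated H acyclic {es} {e} es⊆ e∈H e∉es {u} {v} u∈e v∈e u≢v = <-rec _ no-walk
  where
  no-walk : ∀ l → (∀ {l′} → l′ < l → ¬ Walk es l′ u v) → ¬ Walk es l u v
  no-walk zero    shortest [] = u≢v refl
  no-walk (suc l) shortest p  = acyclic record
    { len-2            = l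
    ; vertex           = vertexAt p
    ; edge             = edgeAt e p
    ; vertex-injective = distinct⇒injective (vertexAt p) (λ i j i<j eq → shorten (shortcut-vertex p i j i<j eq))
    ; edge-injective   = distinct⇒injective (edgeAt e p) edge-distinct
    ; edge∈edges       = edge∈H
    ; vertex∈edge      = vertexAt∈edgeAt e p v∈e
    ; next∈edge        = next∈
    }
    where
    shorten : ¬ (∃[ l′ ] (l′ < suc l × Walk es l′ u v))
    shorten (l′ , l′<l , q) = shortest l′<l q

    last? : ∀ (i : Fin (suc (suc l))) → toℕ i < suc l ⊎ toℕ i ≡ suc l
    last? i = ℕ.m≤n⇒m<n∨m≡n (ℕ.s≤s⁻¹ (Fin.toℕ<n i))

    edge-distinct : ∀ i j → toℕ i < toℕ j → edgeAt e p i ≢ edgeAt e p j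
    edge-distinct i j i<j eq with last? j
    ... | inj₁ j<l = shorten (shortcut-edge e p i j i<j j<l eq)
    -- The last index carries the closing edge `e`, which is not among the edges of the walk.
    ... | inj₂ j≡l = e∉es (subst (_∈ es) (trans eq (edgeAt-end e p j j≡l))
                            (edgeAt-∈ e p i (subst (toℕ i <_) j≡l i<j)))

    edge∈H : ∀ i → edgeAt e p i ∈ edges H
    edge∈H i with last? i
    ... | inj₁ i<l = es⊆ (edgeAt-∈ e p i i<l)
    ... | inj₂ i≡l = subst (_∈ edges H) (sym (edgeAt-end e p i i≡l)) e∈H

    next∈ : ∀ i → vertexAt p (suc (toℕ i) mod suc (suc l)) ∈ᵛ edgeAt e p i
    next∈ i with toℕ-next (suc l) i
    ... | inj₂ eq        = nextAt∈edgeAt e p i _ eq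
    ... | inj₁ (end , z) = subst₂ (λ j f → vertexAt p j ∈ᵛ f) (sym z) (sym (edgeAt-end e p i end)) u∈e

-- Connected components and the order of a hypertree

-- The partition is stored as an idempotent map to representatives: membership in one component
-- becomes a decidable equation, and components are counted as fixed points.
record Components {n} (es : List (Subset n)) : Set where
  field
    rep            : Fin n → Fin n
    rep-idempotent : ∀ v → rep (rep v) ≡ rep v
    same⇒walk      : ∀ u v → rep u ≡ rep v → ∃[ l ] Walk es l u v
    edge⇒same      : ∀ {e u v} → e ∈ es → u ∈ᵛ e → v ∈ᵛ e → rep u ≡ rep v

  count : ℕ
  count = Σℕ.sum (λ v → 𝟙 (does (rep v Fin.≟ v)))

open Components using (count)

discrete : ∀ {n} → Components {n} []
discrete = record
  { rep            = id
  ; rep-idempotent = λ _ → refl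
  ; same⇒walk      = λ { u .u refl → 0 , [] }
  ; edge⇒same      = λ ()
  }

count-discrete : ∀ n → count (discrete {n}) ≡ n
count-discrete n = trans (Σℕ.sum-cong-≗ {n} (λ v → 𝟙-yes (v Fin.≟ v) refl)) (sum-ones n)
  where
  sum-ones : ∀ n → Σℕ.sum {n} (λ _ → 1) ≡ n
  sum-ones zero    = refl
  sum-ones (suc n) = cong suc (sum-ones n)

-- The vertices of the new edge `e` lie in pairwise different components, because two in the same
-- one would be joined by a walk. All components hit by `e` receive the representative of `u₀`.
module Merge {n} {es : List (Subset n)} (C : Components es) {e : Subset n} {u₀ : Fin n} (u₀∈e : u₀ ∈ᵛ e)
             (separated : ∀ {u v} → u ∈ᵛ e → v ∈ᵛ e → u ≢ v → ∀ l → ¬ Walk es l u v) where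
  open Components C hiding (count)

  Hit : Fin n → Set
  Hit w = ∃[ u ] (u ∈ᵛ e × rep u ≡ w)

  hit? : ∀ w → Dec (Hit w)
  hit? w = Fin.any? (λ u → (u ∈ᵛ? e) ×-dec (rep u Fin.≟ w))

  rep-injective : ∀ {u v} → u ∈ᵛ e → v ∈ᵛ e → rep u ≡ rep v → u ≡ v
  rep-injective {u} {v} u∈e v∈e eq with u Fin.≟ v
  ... | yes u≡v = u≡v
  ... | no  u≢v = let (l , p) = same⇒walk u v eq in contradiction p (separated u∈e v∈e u≢v l)

  r₀ : Fin n
  r₀ = rep u₀

  rep′ : Fin n → Fin n
  rep′ v = if does (hit? (rep v)) then r₀ else rep v

  rep′-hit : ∀ {v} → Hit (rep v) → rep′ v ≡ r₀
  rep′-hit {v} h with hit? (rep v)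
  ... | yes _ = refl
  ... | no ¬h = contradiction h ¬h

  rep′-miss : ∀ {v} → ¬ Hit (rep v) → rep′ v ≡ rep v
  rep′-miss {v} ¬h with hit? (rep v)
  ... | yes h = contradiction h ¬h
  ... | no _  = refl

  hit-rep⇒walk : ∀ {v} → Hit (rep v) → ∃[ l ] Walk (e ∷ es) l v u₀
  hit-rep⇒walk {v} (u , u∈e , eq) =
    let (l , p) = same⇒walk v u (sym eq)
    in l ℕ.+ 1 , (weakenʷ p ++ʷ step e (here refl) u∈e u₀∈e [])

  same′⇒walk : ∀ u v → rep′ u ≡ rep′ v → ∃[ l ] Walk (e ∷ es) l u v
  same′⇒walk u v eq with hit? (rep u) | hit? (rep v)
  ... | no _  | no _  = let (l , p) = same⇒walk u v eq in l , weakenʷ p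
  ... | yes _ | no ¬h = contradiction (u₀ , u₀∈e , eq) ¬h
  ... | no ¬h | yes _ = contradiction (u₀ , u₀∈e , sym eq) ¬h
  ... | yes h | yes g = let (_ , p) = hit-rep⇒walk h
                            (_ , q) = reverseʷ (proj₂ (hit-rep⇒walk g))
                        in _ , (p ++ʷ q)

  merged : Components (e ∷ es)
  merged = record
    { rep            = rep′
    ; rep-idempotent = idem
    ; same⇒walk      = same′⇒walk
    ; edge⇒same      = edge⇒same′
    }
    where
    idem : ∀ v → rep′ (rep′ v) ≡ rep′ v
    idem v with hit? (rep v)
    ... | yes h = rep′-hit (u₀ , u₀∈e , sym (rep-idempotent u₀))
    ... | no ¬h = trans (rep′-miss (¬h ∘ subst Hit (rep-idempotent v))) (rep-idempotent v)

    edge⇒same′ : ∀ {f u v} → f ∈ e ∷ es → u ∈ᵛ f → v ∈ᵛ f → rep′ u ≡ rep′ v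
    edge⇒same′ (here refl) u∈ v∈ = trans (rep′-hit (_ , u∈ , refl)) (sym (rep′-hit (_ , v∈ , refl)))
    edge⇒same′ (there f∈)  u∈ v∈ =
      cong (λ w → if does (hit? w) then r₀ else w) (edge⇒same f∈ u∈ v∈)

  -- Double counting of the pairs (u, v) with u in `e` and `rep u ≡ v`: every row of a vertex of `e`
  -- has one entry, and by `rep-injective` every column has at most one.
  hit-count : Σℕ.sum (λ v → 𝟙 (does (hit? v))) ≡ ∣ e ∣
  hit-count = begin
    Σℕ.sum (λ v → 𝟙 (does (hit? v)))            ≡⟨ Σℕ.sum-cong-≗ column ⟩
    Σℕ.sum (λ v → Σℕ.sum (λ u → incidence u v)) ≡⟨ Σℕ.∑-comm (λ v u → incidence u v) ⟩
    Σℕ.sum (λ u → Σℕ.sum (λ v → incidence u v)) ≡⟨ Σℕ.sum-cong-≗ row ⟩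
    Σℕ.sum (λ u → 𝟙 (Vec.lookup e u))           ≡⟨ ∣∣-as-sum e ⟨
    ∣ e ∣                                       ∎
    where
    open ≡-Reasoning
    incidence : Fin n → Fin n → ℕ
    incidence u v = 𝟙 (Vec.lookup e u) ℕ.* 𝟙 (does (rep u Fin.≟ v))

    row : ∀ u → Σℕ.sum (incidence u) ≡ 𝟙 (Vec.lookup e u)
    row u = trans (Single-ℕ.sum-single (incidence u) (rep u) λ v v≢ →
                    trans (cong (𝟙 (Vec.lookup e u) ℕ.*_) (𝟙-no (rep u Fin.≟ v) (v≢ ∘ sym))) (ℕ.*-zeroʳ (𝟙 (Vec.lookup e u))))
                  (trans (cong (𝟙 (Vec.lookup e u) ℕ.*_) (𝟙-yes (rep u Fin.≟ rep u) refl)) (ℕ.*-identityʳ _))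

    vanish : ∀ u v → (u ∈ᵛ e → rep u ≢ v) → incidence u v ≡ 0
    vanish u v miss with u ∈ᵛ? e
    ... | no u∉e  = cong (λ b → 𝟙 b ℕ.* 𝟙 (does (rep u Fin.≟ v))) (∉⇒lookup u e u∉e)
    ... | yes u∈e = trans (cong (𝟙 (Vec.lookup e u) ℕ.*_) (𝟙-no (rep u Fin.≟ v) (miss u∈e))) (ℕ.*-zeroʳ (𝟙 (Vec.lookup e u)))

    column : ∀ v → 𝟙 (does (hit? v)) ≡ Σℕ.sum (λ u → incidence u v)
    column v with hit? v
    ... | no ¬h = sym (Single-ℕ.sum-zero _ λ u → vanish u v λ u∈e eq → ¬h (u , u∈e , eq))
    ... | yes (u , u∈e , eq) = sym (trans
            (Single-ℕ.sum-single _ u λ w w≢u → vanish w v λ w∈e eq′ → w≢u (rep-injective w∈e u∈e (trans eq′ (sym eq))))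
            (cong₂ (λ b c → 𝟙 b ℕ.* c) (∈⇒lookup u∈e) (𝟙-yes (rep u Fin.≟ v) eq)))

  -- Stated additively to avoid truncated subtraction. Pointwise, the representatives hit by `e`
  -- stop being fixed, with the sole exception of `r₀`.
  count-merged : count merged ℕ.+ ∣ e ∣ ≡ count C ℕ.+ 1
  count-merged = begin
    count merged ℕ.+ ∣ e ∣
      ≡⟨ cong (count merged ℕ.+_) hit-count ⟨
    count merged ℕ.+ Σℕ.sum (λ v → 𝟙 (does (hit? v)))
      ≡⟨ Σℕ.∑-distrib-+ (λ v → 𝟙 (does (rep′ v Fin.≟ v))) (λ v → 𝟙 (does (hit? v))) ⟨
    Σℕ.sum (λ v → 𝟙 (does (rep′ v Fin.≟ v)) ℕ.+ 𝟙 (does (hit? v)))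
      ≡⟨ Σℕ.sum-cong-≗ pointwise ⟩
    Σℕ.sum (λ v → 𝟙 (does (rep v Fin.≟ v)) ℕ.+ 𝟙 (does (r₀ Fin.≟ v)))
      ≡⟨ Σℕ.∑-distrib-+ (λ v → 𝟙 (does (rep v Fin.≟ v))) (λ v → 𝟙 (does (r₀ Fin.≟ v))) ⟩
    count C ℕ.+ Σℕ.sum (λ v → 𝟙 (does (r₀ Fin.≟ v)))
      ≡⟨ cong (count C ℕ.+_) (trans (Single-ℕ.sum-single _ r₀ λ v v≢ → 𝟙-no (r₀ Fin.≟ v) (v≢ ∘ sym)) (𝟙-yes (r₀ Fin.≟ r₀) refl)) ⟩
    count C ℕ.+ 1 ∎
    where
    open ≡-Reasoning
    pointwise : ∀ v → 𝟙 (does (rep′ v Fin.≟ v)) ℕ.+ 𝟙 (does (hit? v))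
                    ≡ 𝟙 (does (rep v Fin.≟ v)) ℕ.+ 𝟙 (does (r₀ Fin.≟ v))
    pointwise v with hit? v
    ... | yes (u , u∈e , eq) = begin
      𝟙 (does (rep′ v Fin.≟ v)) ℕ.+ 1
        ≡⟨ cong (λ w → 𝟙 (does (w Fin.≟ v)) ℕ.+ 1) (rep′-hit (u , u∈e , trans eq (sym fixed))) ⟩
      𝟙 (does (r₀ Fin.≟ v)) ℕ.+ 1
        ≡⟨ ℕ.+-comm _ 1 ⟩
      1 ℕ.+ 𝟙 (does (r₀ Fin.≟ v))
        ≡⟨ cong (ℕ._+ 𝟙 (does (r₀ Fin.≟ v))) (𝟙-yes (rep v Fin.≟ v) fixed) ⟨
      𝟙 (does (rep v Fin.≟ v)) ℕ.+ 𝟙 (does (r₀ Fin.≟ v)) ∎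
      where
      fixed : rep v ≡ v
      fixed = trans (cong rep (sym eq)) (trans (rep-idempotent u) eq)
    ... | no ¬hv = trans (cong (ℕ._+ 0) same) (cong (𝟙 (does (rep v Fin.≟ v)) ℕ.+_)
                     (sym (𝟙-no (r₀ Fin.≟ v) λ eq → ¬hv (u₀ , u₀∈e , eq))))
      where
      same : 𝟙 (does (rep′ v Fin.≟ v)) ≡ 𝟙 (does (rep v Fin.≟ v))
      same with hit? (rep v)
      ... | no _  = refl
      ... | yes h = trans (𝟙-no (r₀ Fin.≟ v) λ eq → ¬hv (u₀ , u₀∈e , eq))
                      (sym (𝟙-no (rep v Fin.≟ v) λ eq → ¬hv (subst Hit eq h)))

-- The invariant of adding edges one by one: each edge merges `suc r` components into one, so the
-- number of components drops by r.
components : ∀ (H : Hypergraph) → ¬ Cycle H → ∀ {r} es → (∀ {f} → f ∈ es → f ∈ edges H) → Unique es →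
             All (λ e → ∣ e ∣ ≡ suc r) es → ∃[ C ] (count {es = es} C ℕ.+ length es ℕ.* r ≡ order H)
components H acyclic [] es⊆ _ _ = discrete , trans (ℕ.+-identityʳ _) (count-discrete (order H))
components H acyclic {r} (e ∷ es) es⊆ (e≢ ∷ unique) (∣e∣ ∷ uniform) =
  let (C , size)  = components H acyclic es (es⊆ ∘ there) unique uniform
      (u₀ , u₀∈e) = ∣∣≡suc⇒nonempty e ∣e∣
      module M = Merge C u₀∈e (acyclic⇒separated H acyclic (es⊆ ∘ there) (es⊆ (here refl)) (All¬⇒¬Any e≢))
  in M.merged , (begin
    count M.merged ℕ.+ (r ℕ.+ length es ℕ.* r) ≡⟨ ℕ.+-assoc (count M.merged) r _ ⟨
    count M.merged ℕ.+ r ℕ.+ length es ℕ.* r   ≡⟨ cong (ℕ._+ length es ℕ.* r) (ℕ.+-cancelʳ-≡ 1 _ _ (trans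
                                              (trans (ℕ.+-assoc (count M.merged) r 1) (cong (count M.merged ℕ.+_) (trans (ℕ.+-comm r 1) (sym ∣e∣))))
                                              M.count-merged)) ⟩
    count C ℕ.+ length es ℕ.* r              ≡⟨ size ⟩
    order H                              ∎)
  where open ≡-Reasoning

-- Connectedness leaves at most one component. That there is one at all comes from a vertex of the
-- first edge, hence the size `suc m`.
hypertree-order : ∀ {r m H} → IsUniformHypertree (suc r) (suc m) H → order H ≡ suc (suc m ℕ.* r)
hypertree-order {r} {m} {H} T =
  let (C , size) = components H acyclic (edges H) id (Hypergraph.unique H) uniform
  in trans (sym size) (cong₂ (λ c l → c ℕ.+ l ℕ.* r) (connected⇒one C) size-edges)
  where
  open IsUniformHypertree T renaming (size to size-edges)
  open ≡-Reasoning

  a-vertex : ∀ es → length es ≡ suc m → All (λ e → ∣ e ∣ ≡ suc r) es → Fin (order H)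
  a-vertex (e ∷ es) _ (∣e∣ ∷ _) = proj₁ (∣∣≡suc⇒nonempty e ∣e∣)

  v₀ : Fin (order H)
  v₀ = a-vertex (edges H) size-edges uniform

  connected⇒one : (C : Components (edges H)) → count C ≡ 1
  connected⇒one C = trans
      (Single-ℕ.sum-single _ (rep v₀) λ v v≢ → 𝟙-no (rep v Fin.≟ v) λ eq → v≢ (trans (sym eq) (sym (star⇒same (connected v₀ v)))))
      (𝟙-yes (rep (rep v₀) Fin.≟ rep v₀) (rep-idempotent v₀))
    where
    open Components C hiding (count)
    star⇒same : ∀ {u v} → Star (Adjacent H) u v → rep u ≡ rep v
    star⇒same Star.ε = refl
    star⇒same ((e , e∈ , u∈ , w∈) ◅ p) = trans (edge⇒same e∈ u∈ w∈) (star⇒same p)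

-- The hyperstar

sum-const : ∀ n c → Σℕ.sum {n} (λ _ → c) ≡ n ℕ.* c
sum-const zero    c = refl
sum-const (suc n) c = cong (c ℕ.+_) (sum-const n c)

sum-split : ∀ m {n} (f : Fin (m ℕ.+ n) → ℕ) →
            Σℕ.sum f ≡ Σℕ.sum (λ i → f (i ↑ˡ n)) ℕ.+ Σℕ.sum (λ i → f (m ↑ʳ i))
sum-split zero    f = refl
sum-split (suc m) f = trans (cong (f fzero ℕ.+_) (sum-split m (f ∘ fsuc))) (sym (ℕ.+-assoc (f fzero) _ _))

sum-combine : ∀ m {r} (f : Fin (m ℕ.* r) → ℕ) → Σℕ.sum f ≡ Σℕ.sum {m} (λ i → Σℕ.sum {r} (λ s → f (combine i s)))
sum-combine zero        f = refl
sum-combine (suc m) {r} f = trans (sum-split r f) (cong (Σℕ.sum (λ s → f (s ↑ˡ m ℕ.* r)) ℕ.+_) (sum-combine m (λ x → f (r ↑ʳ x))))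

quotient-combine : ∀ {m r} (i : Fin m) (s : Fin r) → quotient r (combine i s) ≡ i
quotient-combine {m} {r} i s = cong proj₁ (Fin.remQuot-combine {m} {r} i s)

module _ {m r : ℕ} where

  lookup-starEdge : ∀ (j : Fin m) x →
                    Vec.lookup (starEdge (suc r) m j) (fsuc x) ≡ does (quotient {m} r x Fin.≟ j)
  lookup-starEdge j x = Vec.lookup∘tabulate _ x

  ∈starEdge : ∀ (x : Fin (m ℕ.* r)) → fsuc x ∈ᵛ starEdge (suc r) m (quotient {m} r x)
  ∈starEdge x = Vec.lookup⇒[]= _ _ (trans (lookup-starEdge (quotient {m} r x) x) (dec-true (quotient {m} r x Fin.≟ quotient {m} r x) refl))

  ∈starEdge⇒quotient : ∀ {j : Fin m} {x} → fsuc x ∈ᵛ starEdge (suc r) m j → quotient {m} r x ≡ j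
  ∈starEdge⇒quotient {j} {x} x∈ with quotient {m} r x Fin.≟ j | trans (sym (lookup-starEdge j x)) (∈⇒lookup x∈)
  ... | yes q≡j | _ = q≡j
  ... | no _    | ()

  ∣starEdge∣ : ∀ (j : Fin m) → ∣ starEdge (suc r) m j ∣ ≡ suc r
  ∣starEdge∣ j = cong suc (begin
    _                                                         ≡⟨ ∣∣-as-sum (Vec.tabulate block) ⟩
    Σℕ.sum (λ x → 𝟙 (Vec.lookup (Vec.tabulate block) x))      ≡⟨ Σℕ.sum-cong-≗ (λ x → cong 𝟙 (Vec.lookup∘tabulate block x)) ⟩
    Σℕ.sum (λ x → 𝟙 (block x))                                ≡⟨ sum-combine m (λ x → 𝟙 (block x)) ⟩
    Σℕ.sum {m} (λ i → Σℕ.sum {r} (λ s → 𝟙 (block (combine i s))))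
      ≡⟨ Σℕ.sum-cong-≗ {m} (λ i → Σℕ.sum-cong-≗ {r} (λ s → cong (λ q → 𝟙 (does (q Fin.≟ j))) (quotient-combine {m} i s))) ⟩
    Σℕ.sum {m} (λ i → Σℕ.sum {r} (λ _ → 𝟙 (does (i Fin.≟ j)))) ≡⟨ Single-ℕ.sum-single {m} _ j (λ i i≢j → Single-ℕ.sum-zero {r} _ (λ _ → 𝟙-no (i Fin.≟ j) i≢j)) ⟩
    Σℕ.sum {r} (λ _ → 𝟙 (does (j Fin.≟ j)))                   ≡⟨ Σℕ.sum-cong-≗ {r} (λ _ → 𝟙-yes (j Fin.≟ j) refl) ⟩
    Σℕ.sum {r} (λ _ → 1)                                      ≡⟨ sum-const r 1 ⟩
    r ℕ.* 1                                                     ≡⟨ ℕ.*-identityʳ r ⟩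
    r                                                         ∎)
    where
    open ≡-Reasoning
    block : Fin (m ℕ.* r) → Bool
    block x = does (quotient {m} r x Fin.≟ j)

  starEdges-meet : ∀ {i j : Fin m} {v} → v ∈ᵛ starEdge (suc r) m i → v ∈ᵛ starEdge (suc r) m j → i ≢ j → v ≡ fzero
  starEdges-meet {v = fzero}  _  _  _   = refl
  starEdges-meet {v = fsuc x} v∈ w∈ i≢j = contradiction (trans (sym (∈starEdge⇒quotient v∈)) (∈starEdge⇒quotient w∈)) i≢j

-- Consecutive edges of a cycle are different, and different star edges share only the centre. So
-- the cycle passes through the centre at two successive turns, against the injectivity of its
-- vertices.
hyperstar-acyclic : ∀ r m (2≤k : 2 ≤ suc r) → ¬ Cycle (hyperstar (suc r) m 2≤k)
hyperstar-acyclic r m 2≤k C = turns-distinct (vertex-injective (trans (at-turn fzero first-moves) (sym (at-turn (fsuc fzero) second-moves))))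
  where
  open Cycle C

  at-turn : ∀ i → next i ≢ i → vertex (next i) ≡ fzero
  at-turn i moves =
    let (j , _ , eqⱼ) = ∈-map⁻ (starEdge (suc r) m) (edge∈edges i)
        (l , _ , eqₗ) = ∈-map⁻ (starEdge (suc r) m) (edge∈edges (next i))
    in starEdges-meet {m} {r} (subst (vertex (next i) ∈ᵛ_) eqⱼ (next∈edge i)) (subst (vertex (next i) ∈ᵛ_) eqₗ (vertex∈edge (next i)))
         λ j≡l → moves (edge-injective (trans eqₗ (trans (cong (starEdge (suc r) m) (sym j≡l)) (sym eqⱼ))))

  first-moves : next fzero ≢ fzero
  first-moves ()

  second-moves : next (fsuc fzero) ≢ fsuc fzero
  second-moves eq with toℕ-next (suc len-2) (fsuc fzero)
  ... | inj₁ (_ , z) with () ← trans (sym eq) z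
  ... | inj₂ s       with () ← trans (sym s) (cong toℕ eq)

  turns-distinct : next fzero ≢ next (fsuc fzero)
  turns-distinct eq with toℕ-next (suc len-2) (fsuc fzero)
  ... | inj₁ (_ , z) with () ← trans eq z
  ... | inj₂ s       with () ← trans (cong toℕ eq) s

hyperstar-isHypertree : ∀ r m (2≤k : 2 ≤ suc r) → IsUniformHypertree (suc r) m (hyperstar (suc r) m 2≤k)
hyperstar-isHypertree r m 2≤k = record
  { uniform   = All.tabulate λ e∈ → let (j , _ , eq) = ∈-map⁻ (starEdge (suc r) m) e∈
                                    in trans (cong ∣_∣ eq) (∣starEdge∣ {m} {r} j)
  ; size      = trans (List.length-map _ (allFin m)) (List.length-tabulate id)
  ; connected = λ u v → to-centre u ◅◅ from-centre v
  ; acyclic   = hyperstar-acyclic r m 2≤k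
  }
  where
  S = hyperstar (suc r) m 2≤k

  blockEdge∈ : ∀ (x : Fin (m ℕ.* r)) → starEdge (suc r) m (quotient {m} r x) ∈ edges S
  blockEdge∈ x = ∈-map⁺ (starEdge (suc r) m) (∈-allFin (quotient {m} r x))

  to-centre : ∀ u → Star (Adjacent S) u fzero
  to-centre fzero    = Star.ε
  to-centre (fsuc x) = (_ , blockEdge∈ x , ∈starEdge {m} {r} x , Vec.here) ◅ Star.ε

  from-centre : ∀ v → Star (Adjacent S) fzero v
  from-centre fzero    = Star.ε
  from-centre (fsuc x) = (_ , blockEdge∈ x , Vec.here , ∈starEdge {m} {r} x) ◅ Star.ε

-- Hypertrees whose edges meet pairwise

-- A numbering by `Fin m` lets sums over pairs of edges of two hypergraphs of the same size be
-- compared term by term.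
record EdgeIndexing (H : Hypergraph) (m : ℕ) : Set where
  field
    edge     : Fin m → Subset (order H)
    edges≡   : edges H ≡ List.tabulate edge
    distinct : ∀ {i j} → edge i ≡ edge j → i ≡ j

  edge∈ : ∀ i → edge i ∈ edges H
  edge∈ i = subst (edge i ∈_) (sym edges≡) (∈-tabulate⁺ i)

  ∈⇒edge : ∀ {e} → e ∈ edges H → ∃[ i ] e ≡ edge i
  ∈⇒edge {e} e∈ = ∈-tabulate⁻ (subst (e ∈_) edges≡ e∈)

lookup-injective : ∀ {A : Set} {xs : List A} → Unique xs → ∀ {i j} → List.lookup xs i ≡ List.lookup xs j → i ≡ j
lookup-injective (x≢ ∷ u) {fzero}  {fzero}  _  = refl
lookup-injective (x≢ ∷ u) {fzero}  {fsuc j} eq = contradiction eq (All.lookup x≢ (∈-lookup j))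
lookup-injective (x≢ ∷ u) {fsuc i} {fzero}  eq = contradiction (sym eq) (All.lookup x≢ (∈-lookup i))
lookup-injective (x≢ ∷ u) {fsuc i} {fsuc j} eq = cong fsuc (lookup-injective u eq)

edgeIndexing : ∀ H {m} → length (edges H) ≡ m → EdgeIndexing H m
edgeIndexing H refl = record
  { edge     = List.lookup (edges H)
  ; edges≡   = sym (List.tabulate-lookup (edges H))
  ; distinct = lookup-injective (Hypergraph.unique H)
  }

-- Intersections of edges and squared degrees

shared : ∀ {n} → Subset n → Subset n → ℕ
shared e f = Σℕ.sum (λ v → 𝟙 (Vec.lookup e v) ℕ.* 𝟙 (Vec.lookup f v))

shared-diag : ∀ {n} (e : Subset n) → shared e e ≡ ∣ e ∣
shared-diag e = trans (Σℕ.sum-cong-≗ (λ v → idem (Vec.lookup e v))) (sym (∣∣-as-sum e))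
  where
  idem : ∀ b → 𝟙 b ℕ.* 𝟙 b ≡ 𝟙 b
  idem true  = refl
  idem false = refl

shared-term : ∀ {n} {e f : Subset n} {v} → v ∈ᵛ e → v ∈ᵛ f → 𝟙 (Vec.lookup e v) ℕ.* 𝟙 (Vec.lookup f v) ≡ 1
shared-term v∈e v∈f = cong₂ (λ a b → 𝟙 a ℕ.* 𝟙 b) (∈⇒lookup v∈e) (∈⇒lookup v∈f)

shared-vanish : ∀ {n} (e f : Subset n) v → ¬ (v ∈ᵛ e × v ∈ᵛ f) → 𝟙 (Vec.lookup e v) ℕ.* 𝟙 (Vec.lookup f v) ≡ 0
shared-vanish e f v ¬both with v ∈ᵛ? e | v ∈ᵛ? f
... | yes v∈e | yes v∈f = contradiction (v∈e , v∈f) ¬both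
... | no v∉e  | _       = cong (λ a → 𝟙 a ℕ.* 𝟙 (Vec.lookup f v)) (∉⇒lookup v e v∉e)
... | yes _   | no v∉f  = trans (cong (λ b → 𝟙 (Vec.lookup e v) ℕ.* 𝟙 b) (∉⇒lookup v f v∉f)) (ℕ.*-zeroʳ (𝟙 (Vec.lookup e v)))

Meet : ∀ {n} → Subset n → Subset n → Set
Meet e f = ∃[ v ] (v ∈ᵛ e × v ∈ᵛ f)

meet? : ∀ {n} (e f : Subset n) → Dec (Meet e f)
meet? e f = Fin.any? (λ v → (v ∈ᵛ? e) ×-dec (v ∈ᵛ? f))

shared-disjoint : ∀ {n} {e f : Subset n} → ¬ Meet e f → shared e f ≡ 0
shared-disjoint {e = e} {f} ¬meet = Single-ℕ.sum-zero _ λ v → shared-vanish e f v λ both → ¬meet (v , both)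

shared-one : ∀ {n} {e f : Subset n} → Meet e f → (∀ {u v} → u ∈ᵛ e → u ∈ᵛ f → v ∈ᵛ e → v ∈ᵛ f → u ≡ v) → shared e f ≡ 1
shared-one {e = e} {f} (v , v∈e , v∈f) unique = trans
  (Single-ℕ.sum-single _ v λ u u≢v → shared-vanish e f u λ (u∈e , u∈f) → u≢v (unique u∈e u∈f v∈e v∈f))
  (shared-term v∈e v∈f)

length-filter-∈? : ∀ {n m} (v : Fin n) (e : Fin m → Subset n) →
                   length (filter (v ∈ᵛ?_) (List.tabulate e)) ≡ Σℕ.sum (λ i → 𝟙 (Vec.lookup (e i) v))
length-filter-∈? {m = zero}  v e = refl
length-filter-∈? {m = suc m} v e
  with does (v ∈ᵛ? e fzero) | does-∈? v (e fzero)
... | true  | eq = cong₂ ℕ._+_ (cong 𝟙 eq) (length-filter-∈? v (e ∘ fsuc))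
... | false | eq = trans (length-filter-∈? v (e ∘ fsuc)) (cong (λ b → 𝟙 b ℕ.+ Σℕ.sum (λ i → 𝟙 (Vec.lookup (e (fsuc i)) v))) eq)

module _ {H m} (E : EdgeIndexing H m) where
  open EdgeIndexing E
  open ≡-Reasoning

  degree-as-sum : ∀ v → degree H v ≡ Σℕ.sum (λ i → 𝟙 (Vec.lookup (edge i) v))
  degree-as-sum v = trans (cong (λ es → length (filter (v ∈ᵛ?_) es)) edges≡) (length-filter-∈? v edge)

  sum-degree : ∀ {k} → Uniform k H → Σℕ.sum (degree H) ≡ m ℕ.* k
  sum-degree {k} uniform = begin
    Σℕ.sum (degree H)                                          ≡⟨ Σℕ.sum-cong-≗ degree-as-sum ⟩
    Σℕ.sum (λ v → Σℕ.sum (λ i → 𝟙 (Vec.lookup (edge i) v))) ≡⟨ Σℕ.∑-comm (λ v i → 𝟙 (Vec.lookup (edge i) v)) ⟩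
    Σℕ.sum (λ i → Σℕ.sum (λ v → 𝟙 (Vec.lookup (edge i) v))) ≡⟨ Σℕ.sum-cong-≗ (λ i → trans (sym (∣∣-as-sum (edge i))) (All.lookup uniform (edge∈ i))) ⟩
    Σℕ.sum {m} (λ i → k)                                       ≡⟨ sum-const m k ⟩
    m ℕ.* k                                                      ∎

  -- The square of d(v) counts the ordered pairs of edges through v; summing over v first turns each
  -- pair into the size of its intersection.
  sum-degree² : Σℕ.sum (λ v → degree H v ℕ.* degree H v) ≡ Σℕ.sum (λ i → Σℕ.sum (λ j → shared (edge i) (edge j)))
  sum-degree² = begin
    Σℕ.sum (λ v → degree H v ℕ.* degree H v)
      ≡⟨ Σℕ.sum-cong-≗ (λ v → cong₂ ℕ._*_ (degree-as-sum v) (degree-as-sum v)) ⟩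
    Σℕ.sum (λ v → Σℕ.sum (x v) ℕ.* Σℕ.sum (x v))
      ≡⟨ Σℕ.sum-cong-≗ (λ v → Σℕ.*-distribʳ-sum (Σℕ.sum (x v)) (x v)) ⟩
    Σℕ.sum (λ v → Σℕ.sum (λ i → x v i ℕ.* Σℕ.sum (x v)))
      ≡⟨ Σℕ.∑-comm (λ v i → x v i ℕ.* Σℕ.sum (x v)) ⟩
    Σℕ.sum (λ i → Σℕ.sum (λ v → x v i ℕ.* Σℕ.sum (x v)))
      ≡⟨ Σℕ.sum-cong-≗ (λ i → Σℕ.sum-cong-≗ (λ v → Σℕ.*-distribˡ-sum (x v i) (x v))) ⟩
    Σℕ.sum (λ i → Σℕ.sum (λ v → Σℕ.sum (λ j → x v i ℕ.* x v j)))
      ≡⟨ Σℕ.sum-cong-≗ (λ i → Σℕ.∑-comm (λ v j → x v i ℕ.* x v j)) ⟩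
    Σℕ.sum (λ i → Σℕ.sum (λ j → shared (edge i) (edge j))) ∎
    where
    x : Fin (order H) → Fin m → ℕ
    x v i = 𝟙 (Vec.lookup (edge i) v)

module Acyclic {H m} (E : EdgeIndexing H m) (acyclic : ¬ Cycle H) where
  open EdgeIndexing E

  -- Two edges with two common vertices form a cycle of length 2.
  linear : ∀ {i j} → i ≢ j → ∀ {u v} → u ∈ᵛ edge i → u ∈ᵛ edge j → v ∈ᵛ edge i → v ∈ᵛ edge j → u ≡ v
  linear {i} {j} i≢j {u} {v} u∈i u∈j v∈i v∈j with u Fin.≟ v
  ... | yes u≡v = u≡v
  ... | no  u≢v = contradiction digon acyclic
    where
    digon : Cycle H
    digon = record
      { len-2            = 0
      ; vertex           = λ { fzero → u ; (fsuc _) → v }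
      ; edge             = λ { fzero → edge i ; (fsuc _) → edge j }
      ; vertex-injective = λ { {fzero} {fzero} _ → refl ; {fzero} {fsuc fzero} eq → contradiction eq u≢v
                             ; {fsuc fzero} {fzero} eq → contradiction (sym eq) u≢v ; {fsuc fzero} {fsuc fzero} _ → refl }
      ; edge-injective   = λ { {fzero} {fzero} _ → refl ; {fzero} {fsuc fzero} eq → contradiction (distinct eq) i≢j
                             ; {fsuc fzero} {fzero} eq → contradiction (distinct (sym eq)) i≢j ; {fsuc fzero} {fsuc fzero} _ → refl }
      ; edge∈edges       = λ { fzero → edge∈ i ; (fsuc _) → edge∈ j }
      ; vertex∈edge      = λ { fzero → u∈i ; (fsuc _) → v∈j }
      ; next∈edge        = λ { fzero → v∈i ; (fsuc fzero) → u∈j }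
      }

  no-triangle : ∀ {i j l u v w} → i ≢ j → j ≢ l → i ≢ l → u ≢ v → v ≢ w → u ≢ w →
                u ∈ᵛ edge i → v ∈ᵛ edge i → v ∈ᵛ edge j → w ∈ᵛ edge j → w ∈ᵛ edge l → ¬ (u ∈ᵛ edge l)
  no-triangle {i} {j} {l} {u} {v} {w} i≢j j≢l i≢l u≢v v≢w u≢w u∈i v∈i v∈j w∈j w∈l u∈l = acyclic record
    { len-2            = 1
    ; vertex           = vs
    ; edge             = es
    ; vertex-injective = distinct⇒injective vs λ
        { fzero (fsuc fzero) _ → u≢v ; fzero (fsuc (fsuc fzero)) _ → u≢w
        ; (fsuc fzero) (fsuc fzero) (s≤s ()) ; (fsuc fzero) (fsuc (fsuc fzero)) _ → v≢w
        ; (fsuc (fsuc fzero)) (fsuc fzero) (s≤s ()) ; (fsuc (fsuc fzero)) (fsuc (fsuc fzero)) (s≤s (s≤s ())) }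
    ; edge-injective   = distinct⇒injective es λ
        { fzero (fsuc fzero) _ → i≢j ∘ distinct ; fzero (fsuc (fsuc fzero)) _ → i≢l ∘ distinct
        ; (fsuc fzero) (fsuc fzero) (s≤s ()) ; (fsuc fzero) (fsuc (fsuc fzero)) _ → j≢l ∘ distinct
        ; (fsuc (fsuc fzero)) (fsuc fzero) (s≤s ()) ; (fsuc (fsuc fzero)) (fsuc (fsuc fzero)) (s≤s (s≤s ())) }
    ; edge∈edges       = λ { fzero → edge∈ i ; (fsuc fzero) → edge∈ j ; (fsuc (fsuc fzero)) → edge∈ l }
    ; vertex∈edge      = λ { fzero → u∈i ; (fsuc fzero) → v∈j ; (fsuc (fsuc fzero)) → w∈l }
    ; next∈edge        = λ { fzero → v∈i ; (fsuc fzero) → w∈j ; (fsuc (fsuc fzero)) → u∈l }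
    }
    where
    vs : Fin 3 → Fin (order H)
    vs fzero               = u
    vs (fsuc fzero)        = v
    vs (fsuc (fsuc fzero)) = w

    es : Fin 3 → Subset (order H)
    es fzero               = edge i
    es (fsuc fzero)        = edge j
    es (fsuc (fsuc fzero)) = edge l

-- The isomorphism with the hyperstar

record Listing {n} (p : Subset n) (s : ℕ) : Set where
  field
    at           : Fin s → Fin n
    at-∈         : ∀ i → at i ∈ᵛ p
    at-injective : ∀ {i j} → at i ≡ at j → i ≡ j
    index        : ∀ {v} → v ∈ᵛ p → ∃[ i ] at i ≡ v

listing : ∀ {n} (p : Subset n) → Listing p ∣ p ∣
listing []            = record { at = λ () ; at-∈ = λ () ; at-injective = λ { {()} } ; index = λ () }
listing (outside ∷ p) = record
  { at           = fsuc ∘ at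
  ; at-∈         = Vec.there ∘ at-∈
  ; at-injective = at-injective ∘ Fin.suc-injective
  ; index        = λ { (Vec.there v∈) → let (i , eq) = index v∈ in i , cong fsuc eq }
  }
  where open Listing (listing p)
listing (inside ∷ p) = record
  { at           = λ { fzero → fzero ; (fsuc i) → fsuc (at i) }
  ; at-∈         = λ { fzero → Vec.here ; (fsuc i) → Vec.there (at-∈ i) }
  ; at-injective = λ { {fzero} {fzero} _ → refl ; {fsuc i} {fsuc j} eq → cong fsuc (at-injective (Fin.suc-injective eq)) }
  ; index        = λ { Vec.here → fzero , refl ; (Vec.there v∈) → let (i , eq) = index v∈ in fsuc i , cong fsuc eq }
  }
  where open Listing (listing p)

module MeetingEdges {r m H} (2≤k : 2 ≤ suc r) (T : IsUniformHypertree (suc r) (suc m) H) (E : EdgeIndexing H (suc m))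
                    (meet : ∀ i j → i ≢ j → Meet (EdgeIndexing.edge E i) (EdgeIndexing.edge E j)) where
  open IsUniformHypertree T
  open EdgeIndexing E
  open Acyclic E acyclic

  ∣edge∣ : ∀ i → ∣ edge i ∣ ≡ suc r
  ∣edge∣ i = All.lookup uniform (edge∈ i)

  Common : Fin (order H) → Set
  Common c = ∀ i → c ∈ᵛ edge i

  -- If the common vertex of edges i and j missed l, then l would meet i and j
  -- in two further vertices, forming a triangle.
  common-third : ∀ {i j c} → i ≢ j → c ∈ᵛ edge i → c ∈ᵛ edge j → Common c
  common-third {i} {j} {c} i≢j c∈i c∈j l with l Fin.≟ i | l Fin.≟ j | c ∈ᵛ? edge l
  ... | _        | _        | yes c∈l = c∈l
  ... | yes refl | _        | no  _   = c∈i
  ... | no  _    | yes refl | no  _   = c∈j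
  ... | no  l≢i  | no  l≢j  | no  c∉l =
    let (u , u∈i , u∈l) = meet i l (l≢i ∘ sym)
        (w , w∈j , w∈l) = meet j l (l≢j ∘ sym)
        u≢c : u ≢ c
        u≢c u≡c = c∉l (subst (_∈ᵛ edge l) u≡c u∈l)
        c≢w : c ≢ w
        c≢w c≡w = c∉l (subst (_∈ᵛ edge l) (sym c≡w) w∈l)
        u≢w : u ≢ w
        u≢w u≡w = u≢c (linear i≢j u∈i (subst (_∈ᵛ edge j) (sym u≡w) w∈j) c∈i c∈j)
    in contradiction u∈l (no-triangle i≢j (l≢j ∘ sym) (l≢i ∘ sym) u≢c c≢w u≢w u∈i c∈i c∈j w∈j w∈l)

module Isomorphism {r m H} (2≤k : 2 ≤ suc r) (T : IsUniformHypertree (suc r) m H) (E : EdgeIndexing H m)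
                   {c : Fin (order H)} (common : ∀ i → c ∈ᵛ EdgeIndexing.edge E i) where
  open IsUniformHypertree T
  open EdgeIndexing E
  open Acyclic E acyclic

  edge-listing : ∀ i → Listing (edge i) (suc r)
  edge-listing i = subst (Listing (edge i)) (All.lookup uniform (edge∈ i)) (listing (edge i))

  module L i = Listing (edge-listing i)

  c-index : Fin m → Fin (suc r)
  c-index i = proj₁ (L.index i (common i))

  -- The vertices of edge i other than `c`: `punchIn` skips the position at which `c` is listed.
  leaf : Fin m → Fin r → Fin (order H)
  leaf i s = L.at i (punchIn (c-index i) s)

  leaf-∈ : ∀ i s → leaf i s ∈ᵛ edge i
  leaf-∈ i s = L.at-∈ i _

  leaf≢c : ∀ i s → leaf i s ≢ c
  leaf≢c i s eq = Fin.punchInᵢ≢i (c-index i) s (L.at-injective i (trans eq (sym (proj₂ (L.index i (common i))))))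

  leaf-injective : ∀ i {s t} → leaf i s ≡ leaf i t → s ≡ t
  leaf-injective i eq = Fin.punchIn-injective (c-index i) _ _ (L.at-injective i eq)

  -- The centre already lies in both edges, so a leaf in two different edges would be a second
  -- common vertex.
  leaf-edge : ∀ {i j s} → leaf i s ∈ᵛ edge j → i ≡ j
  leaf-edge {i} {j} {s} ∈j with i Fin.≟ j
  ... | yes i≡j = i≡j
  ... | no  i≢j = contradiction (linear i≢j (leaf-∈ i s) ∈j (common i) (common j)) (leaf≢c i s)

  leaf-index : ∀ {i v} → v ∈ᵛ edge i → v ≢ c → ∃[ s ] leaf i s ≡ v
  leaf-index {i} {v} v∈ v≢c =
    let (x , at-x) = L.index i v∈
        (_ , at-c) = L.index i (common i)
        c≢x : c-index i ≢ x
        c≢x eq = v≢c (trans (sym at-x) (trans (cong (L.at i) (sym eq)) at-c))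
    in punchOut c≢x , trans (cong (L.at i) (Fin.punchIn-punchOut c≢x)) at-x

  -- A vertex other than `c` has a walk to `c` by connectedness, and the first step of that walk
  -- lies in an edge.
  covered : ∀ v → v ≢ c → ∃[ i ] v ∈ᵛ edge i
  covered v v≢c with connected v c
  ... | Star.ε                      = contradiction refl v≢c
  ... | (e , e∈ , v∈ , _) ◅ _ = let (i , eq) = ∈⇒edge e∈ in i , subst (v ∈ᵛ_) eq v∈

  -- Built from the side of the star because `image` pulls edges back along the inverse map. Block i
  -- lists the leaves of edge i, in accordance with `starEdge`.
  from-star : Fin (suc (m ℕ.* r)) → Fin (order H)
  from-star fzero    = c
  from-star (fsuc x) = leaf (quotient r x) (remainder {m} r x)

  from-star-injective : ∀ {x y} → from-star x ≡ from-star y → x ≡ y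
  from-star-injective {fzero}  {fzero}  eq = refl
  from-star-injective {fzero}  {fsuc y} eq = contradiction (sym eq) (leaf≢c _ _)
  from-star-injective {fsuc x} {fzero}  eq = contradiction eq (leaf≢c _ _)
  from-star-injective {fsuc x} {fsuc y} eq = cong fsuc (trans (sym (Fin.combine-remQuot {m} r x))
      (trans (cong (uncurry combine) (same-leaf (remQuot r x) (remQuot r y) eq)) (Fin.combine-remQuot {m} r y)))
    where
    same-leaf : ∀ (p q : Fin m × Fin r) → leaf (proj₁ p) (proj₂ p) ≡ leaf (proj₁ q) (proj₂ q) → p ≡ q
    same-leaf (i , s) (j , t) eq with refl ← leaf-edge {i} {j} {s} (subst (_∈ᵛ edge j) (sym eq) (leaf-∈ j t)) =
      cong (i ,_) (leaf-injective i eq)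

  from-star-combine : ∀ i s → from-star (fsuc (combine i s)) ≡ leaf i s
  from-star-combine i s = cong (uncurry leaf) (Fin.remQuot-combine {m} {r} i s)

  preimage : ∀ v → ∃[ x ] from-star x ≡ v
  preimage v with v Fin.≟ c
  ... | yes v≡c = fzero , sym v≡c
  ... | no  v≢c = let (i , v∈) = covered v v≢c
                      (s , eq) = leaf-index v∈ v≢c
                  in fsuc (combine i s) , trans (from-star-combine i s) eq

  σ : Fin (order H) ↔ Fin (suc (m ℕ.* r))
  σ = mk↔ₛ′ (proj₁ ∘ preimage) from-star (λ x → from-star-injective (proj₂ (preimage (from-star x)))) (proj₂ ∘ preimage)

  image-edge : ∀ i → image σ (edge i) ≡ starEdge (suc r) m i
  image-edge i = cong₂ _∷_ (∈⇒lookup (common i)) (Vec.tabulate-cong block)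
    where
    block : ∀ x → Vec.lookup (edge i) (from-star (fsuc x)) ≡ does (quotient {m} r x Fin.≟ i)
    block x with quotient {m} r x Fin.≟ i
    ... | yes q≡i = ∈⇒lookup (subst (λ j → leaf (quotient {m} r x) (remainder {m} r x) ∈ᵛ edge j) q≡i (leaf-∈ _ _))
    ... | no  q≢i = ∉⇒lookup _ (edge i) (q≢i ∘ leaf-edge)

  -- `image σ` is composition with `from-star`, which is surjective.
  image-injective : ∀ {e f} → image σ e ≡ image σ f → e ≡ f
  image-injective {e} {f} eq = trans (sym (Vec.tabulate∘lookup e)) (trans (Vec.tabulate-cong pointwise) (Vec.tabulate∘lookup f))
    where
    at-preimage : ∀ (g : Subset (order H)) v → Vec.lookup (image σ g) (proj₁ (preimage v)) ≡ Vec.lookup g v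
    at-preimage g v = trans (Vec.lookup∘tabulate (Vec.lookup g ∘ from-star) (proj₁ (preimage v))) (cong (Vec.lookup g) (proj₂ (preimage v)))

    pointwise : ∀ v → Vec.lookup e v ≡ Vec.lookup f v
    pointwise v = trans (sym (at-preimage e v)) (trans (cong (λ g → Vec.lookup g (proj₁ (preimage v))) eq) (at-preimage f v))

  isomorphic : H ≅ hyperstar (suc r) m 2≤k
  isomorphic = σ , λ e → mk⇔
    (λ e∈ → let (i , eq) = ∈⇒edge e∈
            in subst (_∈ edges (hyperstar (suc r) m 2≤k)) (sym (trans (cong (image σ) eq) (image-edge i))) (∈-map⁺ (starEdge (suc r) m) (∈-allFin i)))
    (λ ∈star → let (i , _ , eq) = ∈-map⁻ (starEdge (suc r) m) ∈star
               in subst (_∈ edges H) (sym (image-injective (trans eq (sym (image-edge i))))) (edge∈ i))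

meeting⇒hyperstar : ∀ {r m H} (2≤k : 2 ≤ suc r) → IsUniformHypertree (suc r) (suc m) H → (E : EdgeIndexing H (suc m)) →
                    (∀ i j → i ≢ j → Meet (EdgeIndexing.edge E i) (EdgeIndexing.edge E j)) → H ≅ hyperstar (suc r) (suc m) 2≤k
-- With a single edge, any of its vertices serves as the centre.
meeting⇒hyperstar {m = zero} 2≤k T E meet =
  Isomorphism.isomorphic 2≤k T E {proj₁ v} λ { fzero → proj₂ v }
  where v = ∣∣≡suc⇒nonempty _ (MeetingEdges.∣edge∣ 2≤k T E meet fzero)
meeting⇒hyperstar {m = suc m} 2≤k T E meet =
  let (c , c∈₀ , c∈₁) = meet fzero (fsuc fzero) λ ()
  in Isomorphism.isomorphic 2≤k T E (MeetingEdges.common-third 2≤k T E meet (λ ()) c∈₀ c∈₁)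

module _ {k m H S} (T : IsUniformHypertree k m H) (E : EdgeIndexing H m)
         (U : IsUniformHypertree k m S) (F : EdgeIndexing S m) where
  private
    module T = IsUniformHypertree T
    module U = IsUniformHypertree U
    module E = EdgeIndexing E
    module F = EdgeIndexing F

  -- Term by term over ordered pairs of edges: a diagonal pair contributes k on both sides, any
  -- other pair at most 1 for `H` and exactly 1 for `S`. The disjoint pair makes one term strictly
  -- smaller.
  sum-degree²-< : (∀ i j → i ≢ j → Meet (F.edge i) (F.edge j)) →
                  ∀ {i j} → i ≢ j → ¬ Meet (E.edge i) (E.edge j) →
                  Σℕ.sum (λ v → degree H v ℕ.* degree H v) < Σℕ.sum (λ v → degree S v ℕ.* degree S v)
  sum-degree²-< meeting {i} {j} i≢j disjoint =
    subst₂ _<_ (sym (sum-degree² E)) (sym (sum-degree² F))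
      (sum-mono-< (λ p → sum-mono-≤ (shared-≤ p)) i
        (sum-mono-< (shared-≤ i) j
          (subst₂ _<_ (sym (shared-disjoint disjoint)) (sym (meeting-shared i≢j)) z<s)))
    where
    meeting-shared : ∀ {p q} → p ≢ q → shared (F.edge p) (F.edge q) ≡ 1
    meeting-shared p≢q = shared-one (meeting _ _ p≢q) (Acyclic.linear F U.acyclic p≢q)

    shared-≤ : ∀ p q → shared (E.edge p) (E.edge q) ≤ shared (F.edge p) (F.edge q)
    shared-≤ p q with p Fin.≟ q
    ... | yes refl = ℕ.≤-reflexive (begin
      shared (E.edge p) (E.edge p) ≡⟨ shared-diag (E.edge p) ⟩
      ∣ E.edge p ∣                 ≡⟨ All.lookup T.uniform (E.edge∈ p) ⟩
      k                            ≡⟨ All.lookup U.uniform (F.edge∈ p) ⟨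
      ∣ F.edge p ∣                 ≡⟨ shared-diag (F.edge p) ⟨
      shared (F.edge p) (F.edge p) ∎)
      where open ≡-Reasoning
    ... | no p≢q with meet? (E.edge p) (E.edge q)
    ...   | yes met = ℕ.≤-reflexive (trans (shared-one met (Acyclic.linear E T.acyclic p≢q)) (sym (meeting-shared p≢q)))
    ...   | no ¬met = subst (_≤ _) (sym (shared-disjoint ¬met)) z≤n

module Σℚ = Algebra.Properties.Semiring.Sum (CommutativeRing.semiring ℚ.+-*-commutativeRing)

-- Derivatives of tr (A^N) as counts of closed walks

natℚ : ℕ → ℚ
natℚ zero    = 0ℚ
natℚ (suc n) = 1ℚ + natℚ n

natℚ-+ : ∀ m n → natℚ (m ℕ.+ n) ≡ natℚ m + natℚ n
natℚ-+ zero    n = sym (ℚ.+-identityˡ (natℚ n))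
natℚ-+ (suc m) n = trans (cong (1ℚ +_) (natℚ-+ m n)) (sym (ℚ.+-assoc 1ℚ (natℚ m) (natℚ n)))

natℚ-* : ∀ m n → natℚ (m ℕ.* n) ≡ natℚ m * natℚ n
natℚ-* zero    n = sym (ℚ.*-zeroˡ (natℚ n))
natℚ-* (suc m) n = begin
  natℚ (n ℕ.+ m ℕ.* n)            ≡⟨ natℚ-+ n (m ℕ.* n) ⟩
  natℚ n + natℚ (m ℕ.* n)         ≡⟨ cong₂ _+_ (sym (ℚ.*-identityˡ (natℚ n))) (natℚ-* m n) ⟩
  1ℚ * natℚ n + natℚ m * natℚ n   ≡⟨ ℚ.*-distribʳ-+ (natℚ n) 1ℚ (natℚ m) ⟨
  (1ℚ + natℚ m) * natℚ n          ∎
  where open ≡-Reasoning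

natℚ-sum : ∀ {n} (f : Fin n → ℕ) → Σℚ.sum (natℚ ∘ f) ≡ natℚ (Σℕ.sum f)
natℚ-sum {zero}  f = refl
natℚ-sum {suc n} f = trans (cong (natℚ (f fzero) +_) (natℚ-sum (f ∘ fsuc))) (sym (natℚ-+ (f fzero) _))

0≤natℚ : ∀ n → 0ℚ ℚ.≤ natℚ n
0≤natℚ zero    = ℚ.≤-refl
0≤natℚ (suc n) = ℚ.≤-trans (ℚ.<⇒≤ (ℚ.positive⁻¹ 1ℚ)) (subst (ℚ._≤ 1ℚ + natℚ n) (ℚ.+-identityʳ 1ℚ) (ℚ.+-monoʳ-≤ 1ℚ (0≤natℚ n)))

0<natℚ-suc : ∀ n → 0ℚ ℚ.< natℚ (suc n)
0<natℚ-suc n = ℚ.<-≤-trans (ℚ.positive⁻¹ 1ℚ) (subst (ℚ._≤ 1ℚ + natℚ n) (ℚ.+-identityʳ 1ℚ) (ℚ.+-monoʳ-≤ 1ℚ (0≤natℚ n)))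

𝟙ℚ : Bool → ℚ
𝟙ℚ b = if b then 1ℚ else 0ℚ

𝟙ℚ-yes : ∀ {P : Set} (d : Dec P) → P → 𝟙ℚ (does d) ≡ 1ℚ
𝟙ℚ-yes d p = cong 𝟙ℚ (dec-true d p)

𝟙ℚ-no : ∀ {P : Set} (d : Dec P) → ¬ P → 𝟙ℚ (does d) ≡ 0ℚ
𝟙ℚ-no d ¬p = cong 𝟙ℚ (dec-false d ¬p)

∑ˡ : ∀ {A : Set} → List A → (A → ℚ) → ℚ
∑ˡ xs f = foldr (λ x s → f x + s) 0ℚ xs

module _ {A : Set} where

  ∑ˡ-cong : ∀ (xs : List A) {f g : A → ℚ} → (∀ x → f x ≡ g x) → ∑ˡ xs f ≡ ∑ˡ xs g
  ∑ˡ-cong []       eq = refl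
  ∑ˡ-cong (x ∷ xs) eq = cong₂ _+_ (eq x) (∑ˡ-cong xs eq)

  ∑ˡ-zero : ∀ (xs : List A) {f : A → ℚ} → (∀ x → f x ≡ 0ℚ) → ∑ˡ xs f ≡ 0ℚ
  ∑ˡ-zero []       eq = refl
  ∑ˡ-zero (x ∷ xs) eq = trans (cong₂ _+_ (eq x) (∑ˡ-zero xs eq)) (ℚ.+-identityˡ 0ℚ)

  ∑ˡ-+ : ∀ (xs : List A) (f g : A → ℚ) → ∑ˡ xs (λ x → f x + g x) ≡ ∑ˡ xs f + ∑ˡ xs g
  ∑ˡ-+ []       f g = sym (ℚ.+-identityˡ 0ℚ)
  ∑ˡ-+ (x ∷ xs) f g = trans (cong (f x + g x +_) (∑ˡ-+ xs f g)) (exchange (f x) (g x) (∑ˡ xs f) (∑ˡ xs g))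
    where
    open ℚ-Solver
    exchange : ∀ p q s t → p + q + (s + t) ≡ p + s + (q + t)
    exchange = solve 4 (λ p q s t → p :+ q :+ (s :+ t) := p :+ s :+ (q :+ t)) refl

  ∑ˡ-* : ∀ (xs : List A) c (f : A → ℚ) → ∑ˡ xs (λ x → c * f x) ≡ c * ∑ˡ xs f
  ∑ˡ-* []       c f = sym (ℚ.*-zeroʳ c)
  ∑ˡ-* (x ∷ xs) c f = trans (cong (c * f x +_) (∑ˡ-* xs c f)) (sym (ℚ.*-distribˡ-+ c (f x) _))

  ∑ˡ-++ : ∀ (xs ys : List A) (f : A → ℚ) → ∑ˡ (xs List.++ ys) f ≡ ∑ˡ xs f + ∑ˡ ys f
  ∑ˡ-++ []       ys f = sym (ℚ.+-identityˡ _)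
  ∑ˡ-++ (x ∷ xs) ys f = trans (cong (f x +_) (∑ˡ-++ xs ys f)) (sym (ℚ.+-assoc (f x) _ _))

  ∑ˡ-map : ∀ {B : Set} (g : B → A) (xs : List B) (f : A → ℚ) → ∑ˡ (List.map g xs) f ≡ ∑ˡ xs (f ∘ g)
  ∑ˡ-map g []       f = refl
  ∑ˡ-map g (x ∷ xs) f = cong (f (g x) +_) (∑ˡ-map g xs f)

  ∑ˡ-tabulate : ∀ {n} (g : Fin n → A) (f : A → ℚ) → ∑ˡ (List.tabulate g) f ≡ Σℚ.sum (f ∘ g)
  ∑ˡ-tabulate {zero}  g f = refl
  ∑ˡ-tabulate {suc n} g f = cong (f (g fzero) +_) (∑ˡ-tabulate (g ∘ fsuc) f)

Arc : ℕ → Set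
Arc n = Fin n × Fin n

_≟ᵃ_ : ∀ {n} (b c : Arc n) → Dec (b ≡ c)
_≟ᵃ_ = ≡-dec Fin._≟_ Fin._≟_

module _ {A : Set} where

  -- The sum of F x (L without x) over all positions of L.
  pickSum : List A → (A → List A → ℚ) → ℚ
  pickSum []      F = 0ℚ
  pickSum (x ∷ L) F = F x L + pickSum L (λ y rest → F y (x ∷ rest))

  -- The positions over which `pickSum` runs, as a relation, so that summands can be discarded by
  -- reasoning about the chosen element and the rest.
  data Pick : List A → A → List A → Set where
    here  : ∀ {x L} → Pick (x ∷ L) x L
    there : ∀ {x y L rest} → Pick L y rest → Pick (x ∷ L) y (x ∷ rest)

  pickSum-zero : ∀ L {F : A → List A → ℚ} → (∀ {x rest} → Pick L x rest → F x rest ≡ 0ℚ) → pickSum L F ≡ 0ℚ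
  pickSum-zero []      eq = refl
  pickSum-zero (x ∷ L) eq = trans (cong₂ _+_ (eq here) (pickSum-zero L (eq ∘ there))) (ℚ.+-identityˡ 0ℚ)

  -- Removing any position of a constant list leaves the same list, one shorter, so all summands
  -- coincide.
  pickSum-replicate : ∀ N x (F : A → List A → ℚ) c → (∀ M → N ≡ suc M → F x (replicate M x) ≡ c) →
                      pickSum (replicate N x) F ≡ natℚ N * c
  pickSum-replicate zero    x F c eq = sym (ℚ.*-zeroˡ c)
  pickSum-replicate (suc N) x F c eq = begin
    F x (replicate N x) + pickSum (replicate N x) (λ y rest → F y (x ∷ rest))
      ≡⟨ cong₂ _+_ (eq N refl) (pickSum-replicate N x _ c λ { M refl → eq (suc M) refl }) ⟩
    c + natℚ N * c        ≡⟨ cong (_+ natℚ N * c) (ℚ.*-identityˡ c) ⟨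
    1ℚ * c + natℚ N * c   ≡⟨ ℚ.*-distribʳ-+ c 1ℚ (natℚ N) ⟨
    (1ℚ + natℚ N) * c     ∎
    where open ≡-Reasoning

  total : (A → ℕ) → List A → ℕ
  total f L = foldr (λ x s → f x ℕ.+ s) 0 L

  total-pick : ∀ (f : A → ℕ) {L x rest} → Pick L x rest → total f L ≡ f x ℕ.+ total f rest
  total-pick f here = refl
  total-pick f (there {x} {y} {L} {rest} p) = trans (cong (f x ℕ.+_) (total-pick f p)) (exchange (f x) (f y) (total f rest))
    where
    open ℕ-Solver
    exchange : ∀ p q s → p ℕ.+ (q ℕ.+ s) ≡ q ℕ.+ (p ℕ.+ s)
    exchange = solve 3 (λ p q s → p :+ (q :+ s) := q :+ (p :+ s)) refl

  ∈-pick : ∀ {z : A} {L x rest} → Pick L x rest → z ∈ L → z ≢ x → z ∈ rest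
  ∈-pick here      (here z≡x) z≢x = contradiction z≡x z≢x
  ∈-pick here      (there z∈) z≢x = z∈
  ∈-pick (there p) (here z≡)  z≢x = here z≡
  ∈-pick (there p) (there z∈) z≢x = there (∈-pick p z∈ z≢x)

  All-pick : ∀ {P : A → Set} {L x rest} → Pick L x rest → All P L → P x × All P rest
  All-pick here      (px ∷ ps) = px , ps
  All-pick (there p) (px ∷ ps) = let (q , qs) = All-pick p ps in q , px ∷ qs

sum-arc : ∀ {n} (b : Arc n) (F : Fin n → Fin n → ℚ) →
          Σℚ.sum (λ x → Σℚ.sum (λ l → 𝟙ℚ (does (b ≟ᵃ (x , l))) * F x l)) ≡ F (proj₁ b) (proj₂ b)
sum-arc (p , q) F = begin
  Σℚ.sum (λ x → Σℚ.sum (λ l → 𝟙ℚ (does ((p , q) ≟ᵃ (x , l))) * F x l))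
    ≡⟨ Single-ℚ.sum-single _ p (λ x x≢p → Single-ℚ.sum-zero _ λ l → miss x l (x≢p ∘ sym ∘ cong proj₁)) ⟩
  Σℚ.sum (λ l → 𝟙ℚ (does ((p , q) ≟ᵃ (p , l))) * F p l)
    ≡⟨ Single-ℚ.sum-single _ q (λ l l≢q → miss p l (l≢q ∘ sym ∘ cong proj₂)) ⟩
  𝟙ℚ (does ((p , q) ≟ᵃ (p , q))) * F p q
    ≡⟨ cong (_* F p q) (𝟙ℚ-yes ((p , q) ≟ᵃ (p , q)) refl) ⟩
  1ℚ * F p q
    ≡⟨ ℚ.*-identityˡ _ ⟩
  F p q ∎
  where
  open ≡-Reasoning
  miss : ∀ x l → (p , q) ≢ (x , l) → 𝟙ℚ (does ((p , q) ≟ᵃ (x , l))) * F x l ≡ 0ℚ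
  miss x l ≢ = trans (cong (_* F x l) (𝟙ℚ-no ((p , q) ≟ᵃ (x , l)) ≢)) (ℚ.*-zeroˡ (F x l))

-- A map to ℚ respecting the ring operations and undoing `ι`. It carries the trace formula over `R`
-- to an identity of rationals.
record Evaluation (R : RawRing 0ℓ 0ℓ) (ι : ℚ → RawRing.Carrier R) : Set where
  private
    module R = RawRing R
  field
    ⟪_⟫ : R.Carrier → ℚ
    ⟪+⟫ : ∀ x y → ⟪ x R.+ y ⟫ ≡ ⟪ x ⟫ + ⟪ y ⟫
    ⟪*⟫ : ∀ x y → ⟪ x R.* y ⟫ ≡ ⟪ x ⟫ * ⟪ y ⟫
    ⟪-⟫ : ∀ x → ⟪ R.- x ⟫ ≡ - ⟪ x ⟫
    ⟪0⟫ : ⟪ R.0# ⟫ ≡ 0ℚ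
    ⟪1⟫ : ⟪ R.1# ⟫ ≡ 1ℚ
    ⟪ι⟫ : ∀ q → ⟪ ι q ⟫ ≡ q

-- All operations on ℝ are pointwise.
entry : ℕ → Evaluation ℝ-rawRing fromℚ
entry t = record
  { ⟪_⟫ = λ x → seq x t
  ; ⟪+⟫ = λ _ _ → refl
  ; ⟪*⟫ = λ _ _ → refl
  ; ⟪-⟫ = λ _ → refl
  ; ⟪0⟫ = refl
  ; ⟪1⟫ = refl
  ; ⟪ι⟫ = λ _ → refl
  }

-- The trace formula is evaluated over an abstract ring R, so that the Cauchy
-- proofs inside ℝ stay out of the normal forms.
module Derivatives {R : RawRing 0ℓ 0ℓ} {ι : ℚ → RawRing.Carrier R} (E : Evaluation R ι) where
  open Evaluation E
  open RawRing R using (0#; 1#)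
  open Tensors R ι using (Poly; con; a; _⊕_; _⊗_; ∑ᴾ; ∂; constantTerm; matrixPower; tr-A^; nat)

  ⟪nat⟫ : ∀ n → ⟪ nat n ⟫ ≡ natℚ n
  ⟪nat⟫ zero    = ⟪0⟫
  ⟪nat⟫ (suc n) = trans (⟪+⟫ 1# (nat n)) (cong₂ _+_ ⟪1⟫ (⟪nat⟫ n))

  ⟪0*⟫ : ∀ x → ⟪ RawRing._*_ R 0# x ⟫ ≡ 0ℚ
  ⟪0*⟫ x = trans (⟪*⟫ 0# x) (trans (cong (_* ⟪ x ⟫) ⟪0⟫) (ℚ.*-zeroˡ ⟪ x ⟫))

  module _ {n : ℕ} where

    -- Differentiates once for each arc of the list and takes the constant term. Polynomials are
    -- compared only through this additive functional, which stands in for an equality on the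
    -- syntactic type `Poly`.
    D : List (Arc n) → Poly n → ℚ
    D []            p = ⟪ constantTerm p ⟫
    D ((i , j) ∷ L) p = D L (∂ i j p)

    D-⊕ : ∀ L p q → D L (p ⊕ q) ≡ D L p + D L q
    D-⊕ []            p q = ⟪+⟫ _ _
    D-⊕ ((i , j) ∷ L) p q = D-⊕ L (∂ i j p) (∂ i j q)

    D-con-0 : ∀ L → D L (con 0#) ≡ 0ℚ
    D-con-0 []      = ⟪0⟫
    D-con-0 (_ ∷ L) = D-con-0 L

    D-0⊗ : ∀ L p → D L (con 0# ⊗ p) ≡ 0ℚ
    D-0⊗ []            p = ⟪0*⟫ (constantTerm p)
    D-0⊗ ((i , j) ∷ L) p = trans (D-⊕ L _ _) (trans (cong₂ _+_ (D-0⊗ L p) (D-0⊗ L (∂ i j p))) (ℚ.+-identityˡ 0ℚ))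

    D-con⊗ : ∀ L c p → D L (con c ⊗ p) ≡ ⟪ c ⟫ * D L p
    D-con⊗ []            c p = ⟪*⟫ c _
    D-con⊗ ((i , j) ∷ L) c p = trans (D-⊕ L _ _) (trans (cong₂ _+_ (D-0⊗ L p) (D-con⊗ L c (∂ i j p))) (ℚ.+-identityˡ _))

    D-∑ᴾ : ∀ {B : Set} L (xs : List B) (f : B → Poly n) → D L (∑ᴾ xs f) ≡ ∑ˡ xs (D L ∘ f)
    D-∑ᴾ L []       f = D-con-0 L
    D-∑ᴾ L (x ∷ xs) f = trans (D-⊕ L _ _) (cong (D L (f x) +_) (D-∑ᴾ L xs f))

    D-∑ᴾ-allFin : ∀ L (f : Fin n → Poly n) → D L (∑ᴾ (allFin n) f) ≡ Σℚ.sum (D L ∘ f)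
    D-∑ᴾ-allFin L f = trans (D-∑ᴾ L (allFin n) f) (∑ˡ-tabulate id (D L ∘ f))

    -- The Leibniz rule: exactly one of the derivatives must fall on the variable, since a surviving
    -- variable kills the constant term and a second derivative kills the factor. The others pass to
    -- `q`.
    D-a⊗ : ∀ L x l q → D L (a x l ⊗ q) ≡ pickSum L (λ b rest → 𝟙ℚ (does (b ≟ᵃ (x , l))) * D rest q)
    D-a⊗ []            x l q = ⟪0*⟫ (constantTerm q)
    D-a⊗ ((i , j) ∷ L) x l q = trans (D-⊕ L _ _) (cong₂ _+_ derived (D-a⊗ L x l (∂ i j q)))
      where
      derived : D L ((if does ((i , j) ≟ᵃ (x , l)) then con 1# else con 0#) ⊗ q) ≡ 𝟙ℚ (does ((i , j) ≟ᵃ (x , l))) * D L q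
      derived with does ((i , j) ≟ᵃ (x , l))
      ... | true  = trans (D-con⊗ L 1# q) (cong (_* D L q) ⟪1⟫)
      ... | false = trans (D-con⊗ L 0# q) (cong (_* D L q) ⟪0⟫)

    -- The number of walks x → y of length N using each arc of the list L
    -- exactly once.
    W : ℕ → List (Arc n) → Fin n → Fin n → ℚ
    W N L x y = D L (matrixPower N x y)

    W-suc : ∀ N L x y → W (suc N) L x y ≡
            Σℚ.sum (λ l → pickSum L (λ b rest → 𝟙ℚ (does (b ≟ᵃ (x , l))) * W N rest l y))
    W-suc N L x y = trans (D-∑ᴾ-allFin L _) (Σℚ.sum-cong-≗ λ l → D-a⊗ L x l (matrixPower N l y))

    W-zero-diag : ∀ x → W 0 [] x x ≡ 1ℚ
    W-zero-diag x with x Fin.≟ x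
    ... | yes _  = ⟪1⟫
    ... | no x≢x = contradiction refl x≢x

    W-zero-∷ : ∀ b L x y → W 0 (b ∷ L) x y ≡ 0ℚ
    W-zero-∷ b L x y with does (x Fin.≟ y)
    ... | true  = D-con-0 L
    ... | false = D-con-0 L

    D-tr : ∀ L N → D L (tr-A^ N) ≡ Σℚ.sum (λ x → W N L x x)
    D-tr L N = D-∑ᴾ-allFin L _

    W-suc-zero : ∀ N L x y → (∀ {l rest} → Pick L (x , l) rest → W N rest l y ≡ 0ℚ) → W (suc N) L x y ≡ 0ℚ
    W-suc-zero N L x y vanish = trans (W-suc N L x y) (Single-ℚ.sum-zero _ λ l → pickSum-zero L (term l))
      where
      term : ∀ l {b rest} → Pick L b rest → 𝟙ℚ (does (b ≟ᵃ (x , l))) * W N rest l y ≡ 0ℚ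
      term l {b} {rest} p with b ≟ᵃ (x , l)
      ... | yes refl = trans (ℚ.*-identityˡ _) (vanish p)
      ... | no _     = ℚ.*-zeroˡ (W N rest l y)

    out in′ : Fin n → Arc n → ℕ
    out v (i , j) = 𝟙 (does (i Fin.≟ v))
    in′ v (i , j) = 𝟙 (does (j Fin.≟ v))

    -- The balance of a walk: apart from its two ends it leaves v as often as it enters v. Removing
    -- the first arc moves the start along and preserves the relation, so where it fails no walk
    -- exists.
    W-unbalanced : ∀ v N L x y → total (out v) L ℕ.+ 𝟙 (does (y Fin.≟ v)) ≢ total (in′ v) L ℕ.+ 𝟙 (does (x Fin.≟ v)) →
                   W N L x y ≡ 0ℚ
    W-unbalanced v zero    (b ∷ L) x y _ = W-zero-∷ b L x y
    W-unbalanced v zero    []      x y ≢ with x Fin.≟ y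
    ... | yes refl = contradiction refl ≢
    ... | no _     = ⟪0⟫
    W-unbalanced v (suc N) L       x y ≢ = W-suc-zero N L x y λ {l} {rest} p → W-unbalanced v N rest l y λ eq → ≢ (begin
      total (out v) L ℕ.+ [ y ]                    ≡⟨ cong (ℕ._+ [ y ]) (total-pick (out v) p) ⟩
      [ x ] ℕ.+ total (out v) rest ℕ.+ [ y ]       ≡⟨ ℕ.+-assoc [ x ] _ _ ⟩
      [ x ] ℕ.+ (total (out v) rest ℕ.+ [ y ])     ≡⟨ cong ([ x ] ℕ.+_) eq ⟩
      [ x ] ℕ.+ (total (in′ v) rest ℕ.+ [ l ])     ≡⟨ ℕ.+-comm [ x ] _ ⟩
      total (in′ v) rest ℕ.+ [ l ] ℕ.+ [ x ]       ≡⟨ cong (ℕ._+ [ x ]) (trans (ℕ.+-comm (total (in′ v) rest) [ l ]) (sym (total-pick (in′ v) p))) ⟩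
      total (in′ v) L ℕ.+ [ x ]                    ∎)
      where
      open ≡-Reasoning
      [_] : Fin n → ℕ
      [ z ] = 𝟙 (does (z Fin.≟ v))

    tr-unbalanced : ∀ v N L → total (out v) L ≢ total (in′ v) L → D L (tr-A^ N) ≡ 0ℚ
    tr-unbalanced v N L ≢ = trans (D-tr L N) (Single-ℚ.sum-zero _ λ x → W-unbalanced v N L x x (≢ ∘ ℕ.+-cancelʳ-≡ _ _ _))

    Loop : Arc n → Set
    Loop (i , j) = i ≡ j

    -- When all arcs are loops, a walk from x stays at x and can never use up the loop at u.
    W-foreign-loop : ∀ {u x} → u ≢ x → ∀ N L y → All Loop L → (u , u) ∈ L → W N L x y ≡ 0ℚ
    W-foreign-loop {u} {x} u≢x zero    (b ∷ L) y loops u∈ = W-zero-∷ b L x y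
    W-foreign-loop {u} {x} u≢x (suc N) L       y loops u∈ = W-suc-zero N L x y rest-zero
      where
      rest-zero : ∀ {l rest} → Pick L (x , l) rest → W N rest l y ≡ 0ℚ
      rest-zero p with All-pick p loops
      ... | refl , rest-loops = W-foreign-loop u≢x N _ y rest-loops (∈-pick p u∈ (u≢x ∘ cong proj₁))

    tr-distinct-loops : ∀ {i j} → i ≢ j → ∀ N L → All Loop L → (i , i) ∈ L → (j , j) ∈ L → D L (tr-A^ N) ≡ 0ℚ
    tr-distinct-loops {i} {j} i≢j N L loops i∈ j∈ = trans (D-tr L N) (Single-ℚ.sum-zero _ vanish)
      where
      vanish : ∀ x → W N L x x ≡ 0ℚ
      vanish x with i Fin.≟ x
      ... | no i≢x   = W-foreign-loop i≢x N L x loops i∈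
      ... | yes refl = W-foreign-loop (i≢j ∘ sym) N L x loops j∈

    -- The N copies of the loop are distinct positions of the list and can be used in any order.
    W-loops : ∀ N i → W N (replicate N (i , i)) i i ≡ natℚ (N !)
    W-loops zero    i = trans (W-zero-diag i) (sym (ℚ.+-identityʳ 1ℚ))
    W-loops (suc N) i = begin
      W (suc N) L i i
        ≡⟨ W-suc N L i i ⟩
      Σℚ.sum (λ l → pickSum L (λ b rest → 𝟙ℚ (does (b ≟ᵃ (i , l))) * W N rest l i))
        ≡⟨ Σℚ.sum-cong-≗ {n} (λ l → pickSum-replicate (suc N) (i , i) (λ b rest → 𝟙ℚ (does (b ≟ᵃ (i , l))) * W N rest l i) _ λ { _ refl → refl }) ⟩
      Σℚ.sum (λ l → natℚ (suc N) * (𝟙ℚ (does ((i , i) ≟ᵃ (i , l))) * W N (replicate N (i , i)) l i))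
        ≡⟨ Single-ℚ.sum-single _ i (λ l l≢i → trans (cong (λ z → natℚ (suc N) * (z * W N (replicate N (i , i)) l i))
                                               (𝟙ℚ-no ((i , i) ≟ᵃ (i , l)) (l≢i ∘ sym ∘ cong proj₂)))
                                             (trans (cong (natℚ (suc N) *_) (ℚ.*-zeroˡ (W N (replicate N (i , i)) l i))) (ℚ.*-zeroʳ (natℚ (suc N))))) ⟩
      natℚ (suc N) * (𝟙ℚ (does ((i , i) ≟ᵃ (i , i))) * W N (replicate N (i , i)) i i)
        ≡⟨ cong (λ z → natℚ (suc N) * (z * W N (replicate N (i , i)) i i)) (𝟙ℚ-yes ((i , i) ≟ᵃ (i , i)) refl) ⟩
      natℚ (suc N) * (1ℚ * W N (replicate N (i , i)) i i)
        ≡⟨ cong (natℚ (suc N) *_) (trans (ℚ.*-identityˡ _) (W-loops N i)) ⟩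
      natℚ (suc N) * natℚ (N !)
        ≡⟨ natℚ-* (suc N) (N !) ⟨
      natℚ (suc N !) ∎
      where
      open ≡-Reasoning
      L = replicate (suc N) (i , i)

    tr-loops : ∀ N i → D (replicate (suc N) (i , i)) (tr-A^ (suc N)) ≡ natℚ (suc N !)
    tr-loops N i = trans (D-tr (replicate (suc N) (i , i)) (suc N)) (trans
      (Single-ℚ.sum-single _ i λ x x≢i → W-foreign-loop (x≢i ∘ sym) (suc N) (replicate (suc N) (i , i)) x (loops (suc N)) (here refl))
      (W-loops (suc N) i))
      where
      loops : ∀ M → All Loop (replicate M (i , i))
      loops zero    = []
      loops (suc M) = refl ∷ loops M

    W-one : ∀ p q → W 1 ((p , q) ∷ []) p q ≡ 1ℚ
    W-one p q = begin
      W 1 ((p , q) ∷ []) p q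
        ≡⟨ W-suc 0 ((p , q) ∷ []) p q ⟩
      Σℚ.sum (λ l → 𝟙ℚ (does ((p , q) ≟ᵃ (p , l))) * W 0 [] l q + 0ℚ)
        ≡⟨ Single-ℚ.sum-single _ q (λ l l≢q → trans (ℚ.+-identityʳ _) (trans
             (cong (_* W 0 [] l q) (𝟙ℚ-no ((p , q) ≟ᵃ (p , l)) (l≢q ∘ sym ∘ cong proj₂))) (ℚ.*-zeroˡ (W 0 [] l q)))) ⟩
      𝟙ℚ (does ((p , q) ≟ᵃ (p , q))) * W 0 [] q q + 0ℚ
        ≡⟨ trans (ℚ.+-identityʳ _) (cong₂ _*_ (𝟙ℚ-yes ((p , q) ≟ᵃ (p , q)) refl) (W-zero-diag q)) ⟩
      1ℚ * 1ℚ
        ≡⟨⟩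
      1ℚ ∎
      where open ≡-Reasoning

    -- The two summands are the closed walks that begin with the first and with the second arc.
    tr-digon : ∀ i j → D ((i , j) ∷ (j , i) ∷ []) (tr-A^ 2) ≡ natℚ 2
    tr-digon i j = begin
      D L (tr-A^ 2)
        ≡⟨ D-tr L 2 ⟩
      Σℚ.sum (λ x → W 2 L x x)
        ≡⟨ Σℚ.sum-cong-≗ (λ x → trans (W-suc 1 L x x) (Σℚ.∑-distrib-+ (first x) (λ l → second x l + 0ℚ))) ⟩
      Σℚ.sum (λ x → Σℚ.sum (first x) + Σℚ.sum (λ l → second x l + 0ℚ))
        ≡⟨ Σℚ.∑-distrib-+ (λ x → Σℚ.sum (first x)) (λ x → Σℚ.sum (λ l → second x l + 0ℚ)) ⟩
      Σℚ.sum (λ x → Σℚ.sum (first x)) + Σℚ.sum (λ x → Σℚ.sum (λ l → second x l + 0ℚ))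
        ≡⟨ cong (Σℚ.sum (λ x → Σℚ.sum (first x)) +_) (Σℚ.sum-cong-≗ λ x → Σℚ.sum-cong-≗ λ l → ℚ.+-identityʳ (second x l)) ⟩
      Σℚ.sum (λ x → Σℚ.sum (first x)) + Σℚ.sum (λ x → Σℚ.sum (second x))
        ≡⟨ cong₂ _+_ (sum-arc (i , j) (λ x l → W 1 ((j , i) ∷ []) l x)) (sum-arc (j , i) (λ x l → W 1 ((i , j) ∷ []) l x)) ⟩
      W 1 ((j , i) ∷ []) j i + W 1 ((i , j) ∷ []) i j
        ≡⟨ cong₂ _+_ (W-one j i) (W-one i j) ⟩
      natℚ 2 ∎
      where
      open ≡-Reasoning
      L = (i , j) ∷ (j , i) ∷ []
      first second : Fin n → Fin n → ℚ
      first  x l = 𝟙ℚ (does ((i , j) ≟ᵃ (x , l))) * W 1 ((j , i) ∷ []) l x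
      second x l = 𝟙ℚ (does ((j , i) ≟ᵃ (x , l))) * W 1 ((i , j) ∷ []) l x

-- The compositions of 1 and 2

-- The sum over pairs i < j, split off at the first index in the same way as `compositions`.
∑-pairs : ∀ n → (Fin n → Fin n → ℚ) → ℚ
∑-pairs zero    f = 0ℚ
∑-pairs (suc n) f = Σℚ.sum (λ j → f fzero (fsuc j)) + ∑-pairs n (λ i j → f (fsuc i) (fsuc j))

∑-pairs-cong : ∀ n {f g : Fin n → Fin n → ℚ} → (∀ {i j} → i Fin.< j → f i j ≡ g i j) → ∑-pairs n f ≡ ∑-pairs n g
∑-pairs-cong zero    eq = refl
∑-pairs-cong (suc n) eq = cong₂ _+_ (Σℚ.sum-cong-≗ λ j → eq {fzero} {fsuc j} (s≤s z≤n)) (∑-pairs-cong n λ i<j → eq (s≤s i<j))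

∑-pairs-zero : ∀ n → ∑-pairs n (λ _ _ → 0ℚ) ≡ 0ℚ
∑-pairs-zero zero    = refl
∑-pairs-zero (suc n) = trans (cong₂ _+_ (Single-ℚ.sum-zero {n} _ λ _ → refl) (∑-pairs-zero n)) (ℚ.+-identityˡ 0ℚ)

∑-pairs-*ʳ : ∀ n (f : Fin n → Fin n → ℚ) c → ∑-pairs n (λ i j → f i j * c) ≡ ∑-pairs n f * c
∑-pairs-*ʳ zero    f c = sym (ℚ.*-zeroˡ c)
∑-pairs-*ʳ (suc n) f c = trans
  (cong₂ _+_ (sym (Σℚ.*-distribʳ-sum c (λ j → f fzero (fsuc j)))) (∑-pairs-*ʳ n (λ i j → f (fsuc i) (fsuc j)) c))
  (sym (ℚ.*-distribʳ-+ c (Σℚ.sum (λ j → f fzero (fsuc j))) (∑-pairs n (λ i j → f (fsuc i) (fsuc j)))))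

∑-pairs-sum : ∀ n {m} (f : Fin m → Fin n → Fin n → ℚ) →
              ∑-pairs n (λ i j → Σℚ.sum (λ s → f s i j)) ≡ Σℚ.sum (λ s → ∑-pairs n (f s))
∑-pairs-sum zero    {m} f = sym (Single-ℚ.sum-zero {m} _ λ _ → refl)
∑-pairs-sum (suc n) {m} f = trans
  (cong₂ _+_ (Σℚ.∑-comm (λ j s → f s fzero (fsuc j))) (∑-pairs-sum n (λ s i j → f s (fsuc i) (fsuc j))))
  (sym (Σℚ.∑-distrib-+ (λ s → Σℚ.sum (λ j → f s fzero (fsuc j))) (λ s → ∑-pairs n (λ i j → f s (fsuc i) (fsuc j)))))

zeros : ∀ n → Vec ℕ n
zeros n = Vec.replicate n 0

unit : ∀ {n} → Fin n → Vec ℕ n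
unit {suc n} fzero    = 1 ∷ zeros n
unit {suc n} (fsuc i) = 0 ∷ unit i

-- The sum of the unit vectors at i and j, that is, the composition of 2 belonging to one operator
-- at each of them.
two : ∀ {n} → Fin n → Fin n → Vec ℕ n
two {suc n} fzero    fzero    = 2 ∷ zeros n
two {suc n} fzero    (fsuc j) = 1 ∷ unit j
two {suc n} (fsuc i) fzero    = 1 ∷ unit i
two {suc n} (fsuc i) (fsuc j) = 0 ∷ two i j

compositions-zero : ∀ n → compositions n 0 ≡ zeros n ∷ []
compositions-zero zero    = refl
compositions-zero (suc n) rewrite compositions-zero n = refl

compositions-one : ∀ n (G : Vec ℕ n → ℚ) → ∑ˡ (compositions n 1) G ≡ Σℚ.sum (G ∘ unit)
compositions-one zero    G = refl
compositions-one (suc n) G rewrite compositions-zero n = begin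
  ∑ˡ (List.map (0 ∷_) (compositions n 1) List.++ (1 ∷ zeros n) ∷ []) G
    ≡⟨ ∑ˡ-++ (List.map (0 ∷_) (compositions n 1)) _ G ⟩
  ∑ˡ (List.map (0 ∷_) (compositions n 1)) G + (G (1 ∷ zeros n) + 0ℚ)
    ≡⟨ cong₂ _+_ (trans (∑ˡ-map (0 ∷_) (compositions n 1) G) (compositions-one n (G ∘ (0 ∷_)))) (ℚ.+-identityʳ _) ⟩
  Σℚ.sum (λ i → G (0 ∷ unit i)) + G (1 ∷ zeros n)
    ≡⟨ ℚ.+-comm _ (G (1 ∷ zeros n)) ⟩
  G (1 ∷ zeros n) + Σℚ.sum (λ i → G (0 ∷ unit i)) ∎
  where open ≡-Reasoning

compositions-two : ∀ n (G : Vec ℕ n → ℚ) →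
                   ∑ˡ (compositions n 2) G ≡ Σℚ.sum (λ i → G (two i i)) + ∑-pairs n (λ i j → G (two i j))
compositions-two zero    G = refl
compositions-two (suc n) G rewrite compositions-zero n = begin
  ∑ˡ (List.map (0 ∷_) (compositions n 2) List.++ (List.map (1 ∷_) (compositions n 1) List.++ (2 ∷ zeros n) ∷ [])) G
    ≡⟨ ∑ˡ-++ (List.map (0 ∷_) (compositions n 2)) _ G ⟩
  ∑ˡ (List.map (0 ∷_) (compositions n 2)) G + ∑ˡ (List.map (1 ∷_) (compositions n 1) List.++ (2 ∷ zeros n) ∷ []) G
    ≡⟨ cong₂ _+_ (trans (∑ˡ-map (0 ∷_) (compositions n 2) G) (compositions-two n (G ∘ (0 ∷_))))
                 (trans (∑ˡ-++ (List.map (1 ∷_) (compositions n 1)) _ G)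
                        (cong₂ _+_ (trans (∑ˡ-map (1 ∷_) (compositions n 1) G) (compositions-one n (G ∘ (1 ∷_)))) (ℚ.+-identityʳ _))) ⟩
  (s + p) + (q + G (2 ∷ zeros n))
    ≡⟨ exchange s p q (G (2 ∷ zeros n)) ⟩
  (G (2 ∷ zeros n) + s) + (q + p) ∎
  where
  open ≡-Reasoning
  s = Σℚ.sum (λ i → G (0 ∷ two i i))
  p = ∑-pairs n (λ i j → G (0 ∷ two i j))
  q = Σℚ.sum (λ j → G (1 ∷ unit j))
  open ℚ-Solver
  exchange : ∀ s p q z → (s + p) + (q + z) ≡ (z + s) + (q + p)
  exchange = solve 4 (λ s p q z → (s :+ p) :+ (q :+ z) := (z :+ s) :+ (q :+ p)) refl

foldr-tabulate : ∀ {A B C : Set} {n} (F : A → C → C) (g : B → A) (h : Fin n → B) z →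
                 foldr F z (List.tabulate (g ∘ h)) ≡ foldr (F ∘ g) z (List.tabulate h)
foldr-tabulate F g h z = trans (cong (foldr F z) (sym (List.map-tabulate h g))) (List.foldr-map F g z (List.tabulate h))

module _ {A : Set} where

  act : ∀ {n} → (Fin n → A → A) → Vec ℕ n → A → A
  act {n} op ds z = foldr (λ i p → fold p (op i) (Vec.lookup ds i)) z (allFin n)

  act-∷ : ∀ {n} (op : Fin (suc n) → A → A) d ds z → act op (d ∷ ds) z ≡ fold (act (op ∘ fsuc) ds z) (op fzero) d
  act-∷ op d ds z = cong (λ p → fold p (op fzero) d)
    (foldr-tabulate (λ i p → fold p (op i) (Vec.lookup (d ∷ ds) i)) fsuc id z)

  act-zeros : ∀ {n} (op : Fin n → A → A) z → act op (zeros n) z ≡ z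
  act-zeros {zero}  op z = refl
  act-zeros {suc n} op z = trans (act-∷ op 0 (zeros n) z) (act-zeros (op ∘ fsuc) z)

  act-unit : ∀ {n} (op : Fin n → A → A) i z → act op (unit i) z ≡ op i z
  act-unit op fzero    z = trans (act-∷ op 1 _ z) (cong (op fzero) (act-zeros (op ∘ fsuc) z))
  act-unit op (fsuc i) z = trans (act-∷ op 0 (unit i) z) (act-unit (op ∘ fsuc) i z)

  -- `foldr` over `allFin` leaves the operator of the smaller index outermost, which fixes the order
  -- of i and j.
  act-two : ∀ {n} (op : Fin n → A → A) {i j} z → i Fin.≤ j → act op (two i j) z ≡ op i (op j z)
  act-two op {fzero}  {fzero}  z _         = trans (act-∷ op 2 _ z) (cong (op fzero ∘ op fzero) (act-zeros (op ∘ fsuc) z))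
  act-two op {fzero}  {fsuc j} z _         = trans (act-∷ op 1 (unit j) z) (cong (op fzero) (act-unit (op ∘ fsuc) j z))
  act-two op {fsuc i} {fsuc j} z (s≤s i≤j) = trans (act-∷ op 0 (two i j) z) (act-two (op ∘ fsuc) z i≤j)

module _ (c : ℕ → ℚ) (c₀≡1 : c 0 ≡ 1ℚ) where

  -- The product of the inverse factorials in the trace formula. As `c 0` is 1, only the nonzero
  -- parts of a composition matter.
  weight : ∀ {n} → Vec ℕ n → ℚ
  weight {n} ds = foldr (λ i s → c (Vec.lookup ds i) * s) 1ℚ (allFin n)

  weight-∷ : ∀ {n} d (ds : Vec ℕ n) → weight (d ∷ ds) ≡ c d * weight ds
  weight-∷ d ds = cong (c d *_) (foldr-tabulate (λ i s → c (Vec.lookup (d ∷ ds) i) * s) fsuc id 1ℚ)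

  weight-0∷ : ∀ {n} (ds : Vec ℕ n) → weight (0 ∷ ds) ≡ weight ds
  weight-0∷ ds = trans (weight-∷ 0 ds) (trans (cong (_* weight ds) c₀≡1) (ℚ.*-identityˡ _))

  weight-zeros : ∀ n → weight (zeros n) ≡ 1ℚ
  weight-zeros zero    = refl
  weight-zeros (suc n) = trans (weight-0∷ (zeros n)) (weight-zeros n)

  weight-∷zeros : ∀ n d → weight (d ∷ zeros n) ≡ c d
  weight-∷zeros n d = trans (weight-∷ d (zeros n)) (trans (cong (c d *_) (weight-zeros n)) (ℚ.*-identityʳ (c d)))

  weight-unit : ∀ {n} (i : Fin n) → weight (unit i) ≡ c 1
  weight-unit {suc n} fzero    = weight-∷zeros n 1
  weight-unit         (fsuc i) = trans (weight-0∷ (unit i)) (weight-unit i)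

  weight-two-diag : ∀ {n} (i : Fin n) → weight (two i i) ≡ c 2
  weight-two-diag {suc n} fzero    = weight-∷zeros n 2
  weight-two-diag         (fsuc i) = trans (weight-0∷ (two i i)) (weight-two-diag i)

  weight-two : ∀ {n} {i j : Fin n} → i Fin.< j → weight (two i j) ≡ c 1 * c 1
  weight-two {i = fzero}  {fsuc j} _         = trans (weight-∷ 1 (unit j)) (cong (c 1 *_) (weight-unit j))
  weight-two {i = fsuc i} {fsuc j} (s≤s i<j) = trans (weight-0∷ (two i j)) (weight-two i<j)

∣∣≡0⇒∅ : ∀ {n} (e : Subset n) → ∣ e ∣ ≡ 0 → e ≡ ∅
∣∣≡0⇒∅ []            _  = refl
∣∣≡0⇒∅ (outside ∷ e) eq = cong (outside ∷_) (∣∣≡0⇒∅ e eq)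

∷-≟ : ∀ {n} s {p q : Subset n} (e : Subset n) → p ≡ q → 𝟙ℚ (does ((s ∷ p) ≟ˢ (s ∷ e))) ≡ 𝟙ℚ (does (q ≟ˢ e))
∷-≟ s {p} e refl = cong 𝟙ℚ (does-⇔ (mk⇔ Vec.∷-injectiveʳ (cong (s ∷_))) ((s ∷ p) ≟ˢ (s ∷ e)) (p ≟ˢ e))

singleton-count : ∀ {n} (e : Subset n) → ∣ e ∣ ≡ 1 → Σℚ.sum (λ j → 𝟙ℚ (does ((⁅ j ⁆ ∪ ∅) ≟ˢ e))) ≡ 1ℚ
singleton-count {suc n} (inside ∷ e) eq with refl ← ∣∣≡0⇒∅ e (ℕ.suc-injective eq) = trans
  (cong₂ _+_ (𝟙ℚ-yes ((⁅ fzero {n} ⁆ ∪ ∅) ≟ˢ (inside ∷ ∅)) (cong (inside ∷_) (Subset.∪-identityˡ ∅)))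
             (Single-ℚ.sum-zero {n} _ λ j → 𝟙ℚ-no ((⁅ fsuc j ⁆ ∪ ∅) ≟ˢ (inside ∷ ∅)) λ ()))
  (ℚ.+-identityʳ 1ℚ)
singleton-count {suc n} (outside ∷ e) eq = trans
  (cong₂ _+_ (𝟙ℚ-no ((⁅ fzero ⁆ ∪ ∅) ≟ˢ (outside ∷ e)) λ ())
             (trans (Σℚ.sum-cong-≗ {n} λ j → ∷-≟ outside {⁅ j ⁆ ∪ ∅} e refl) (singleton-count e eq)))
  (ℚ.+-identityˡ 1ℚ)

-- For graphs: each edge arises from exactly one pair i < j, so that a sum over adjacent pairs
-- becomes the number of edges.
pair-count : ∀ {n} (e : Subset n) → ∣ e ∣ ≡ 2 → ∑-pairs n (λ i j → 𝟙ℚ (does ((⁅ i ⁆ ∪ (⁅ j ⁆ ∪ ∅)) ≟ˢ e))) ≡ 1ℚ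
pair-count {suc n} (inside ∷ e) eq = trans
  (cong₂ _+_ (trans (Σℚ.sum-cong-≗ {n} λ j → ∷-≟ inside e (Subset.∪-identityˡ (⁅ j ⁆ ∪ ∅))) (singleton-count e (ℕ.suc-injective eq)))
             (trans (∑-pairs-cong n λ {i} {j} _ → 𝟙ℚ-no ((⁅ fsuc i ⁆ ∪ (⁅ fsuc j ⁆ ∪ ∅)) ≟ˢ (inside ∷ e)) λ ()) (∑-pairs-zero n)))
  (ℚ.+-identityʳ 1ℚ)
pair-count {suc n} (outside ∷ e) eq = trans
  (cong₂ _+_ (Single-ℚ.sum-zero {n} _ λ j → 𝟙ℚ-no ((⁅ fzero ⁆ ∪ (⁅ fsuc j ⁆ ∪ ∅)) ≟ˢ (outside ∷ e)) λ ())
             (trans (∑-pairs-cong n λ {i} {j} _ → ∷-≟ outside {⁅ i ⁆ ∪ (⁅ j ⁆ ∪ ∅)} e refl) (pair-count e eq)))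
  (ℚ.+-identityˡ 1ℚ)

-- The traces of degree 1 and 2

vertexSet : ∀ {n r} → Vec (Fin n) r → Subset n
vertexSet = Vec.foldr′ (λ j s → ⁅ j ⁆ ∪ s) ∅

occurrences : ∀ {n r} → Fin n → Vec (Fin n) r → ℕ
occurrences v []      = 0
occurrences v (j ∷ γ) = 𝟙 (does (j Fin.≟ v)) ℕ.+ occurrences v γ

∣⁅⁆∪∣≤ : ∀ {n} (j : Fin n) (p : Subset n) → ∣ ⁅ j ⁆ ∪ p ∣ ≤ suc ∣ p ∣
∣⁅⁆∪∣≤ fzero    (inside  ∷ p) = ℕ.m≤n⇒m≤1+n (ℕ.≤-reflexive (cong (suc ∘ ∣_∣) (Subset.∪-identityˡ p)))
∣⁅⁆∪∣≤ fzero    (outside ∷ p) = ℕ.≤-reflexive (cong (suc ∘ ∣_∣) (Subset.∪-identityˡ p))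
∣⁅⁆∪∣≤ (fsuc j) (inside  ∷ p) = s≤s (∣⁅⁆∪∣≤ j p)
∣⁅⁆∪∣≤ (fsuc j) (outside ∷ p) = ∣⁅⁆∪∣≤ j p

∈⇒⁅⁆∪ : ∀ {n} {j : Fin n} {p : Subset n} → j ∈ᵛ p → ⁅ j ⁆ ∪ p ≡ p
∈⇒⁅⁆∪ {p = inside ∷ p} Vec.here           = cong (inside ∷_) (Subset.∪-identityˡ p)
∈⇒⁅⁆∪ {p = s ∷ p}      (Vec.there j∈) = cong (s ∷_) (∈⇒⁅⁆∪ j∈)

∉vertexSet⇒occurrences : ∀ {n r} {v : Fin n} (γ : Vec (Fin n) r) → v ∉ᵛ vertexSet γ → occurrences v γ ≡ 0
∉vertexSet⇒occurrences         []      v∉ = refl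
∉vertexSet⇒occurrences {v = v} (j ∷ γ) v∉ = cong₂ ℕ._+_
  (𝟙-no (j Fin.≟ v) λ { refl → v∉ (Subset.x∈p∪q⁺ (inj₁ (Subset.x∈⁅x⁆ j))) })
  (∉vertexSet⇒occurrences γ (v∉ ∘ Subset.x∈p∪q⁺ ∘ inj₂))

∣vertexSet∣≤ : ∀ {n r} (γ : Vec (Fin n) r) → ∣ vertexSet γ ∣ ≤ r
∣vertexSet∣≤ {n} []      = ℕ.≤-reflexive (Subset.∣⊥∣≡0 n)
∣vertexSet∣≤     (j ∷ γ) = ℕ.≤-trans (∣⁅⁆∪∣≤ j (vertexSet γ)) (s≤s (∣vertexSet∣≤ γ))

-- A repeated letter adds nothing to the vertex set, so r letters that span r vertices are all
-- different.
occurrences≤1 : ∀ {n r} (v : Fin n) (γ : Vec (Fin n) r) → ∣ vertexSet γ ∣ ≡ r → occurrences v γ ≤ 1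
occurrences≤1 v []      _  = z≤n
occurrences≤1 {r = suc r} v (j ∷ γ) eq with j ∈ᵛ? vertexSet γ
... | yes j∈ = contradiction (subst (_≤ r) (trans (cong ∣_∣ (sym (∈⇒⁅⁆∪ j∈))) eq) (∣vertexSet∣≤ γ)) ℕ.1+n≰n
... | no  j∉ with j Fin.≟ v
...   | yes refl = s≤s (ℕ.≤-reflexive (∉vertexSet⇒occurrences γ j∉))
...   | no  _    = occurrences≤1 v γ (ℕ.≤-antisym (∣vertexSet∣≤ γ)
                     (ℕ.s≤s⁻¹ (subst (_≤ suc ∣ vertexSet γ ∣) eq (∣⁅⁆∪∣≤ j (vertexSet γ)))))

occurrences-replicate : ∀ {n} r (i v : Fin n) → occurrences v (Vec.replicate r i) ≡ r ℕ.* 𝟙 (does (i Fin.≟ v))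
occurrences-replicate zero    i v = refl
occurrences-replicate (suc r) i v = cong (𝟙 (does (i Fin.≟ v)) ℕ.+_) (occurrences-replicate r i v)

∑ˡ-cartesianProductWith : ∀ {A B C : Set} (g : A → B → C) xs ys (f : C → ℚ) →
                          ∑ˡ (List.cartesianProductWith g xs ys) f ≡ ∑ˡ xs (λ x → ∑ˡ ys (f ∘ g x))
∑ˡ-cartesianProductWith g []       ys f = refl
∑ˡ-cartesianProductWith g (x ∷ xs) ys f = trans (∑ˡ-++ (List.map (g x) ys) _ f)
  (cong₂ _+_ (∑ˡ-map (g x) ys f) (∑ˡ-cartesianProductWith g xs ys f))

words-single : ∀ n {r} (w : Vec (Fin n) r) (f : Vec (Fin n) r → ℚ) → (∀ γ → γ ≢ w → f γ ≡ 0ℚ) → ∑ˡ (words n r) f ≡ f w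
words-single n []      f vanish = ℚ.+-identityʳ (f [])
words-single n {suc r} (i ∷ w) f vanish = begin
  ∑ˡ (words n (suc r)) f
    ≡⟨ ∑ˡ-cartesianProductWith _∷_ (allFin n) (words n r) f ⟩
  ∑ˡ (allFin n) (λ j → ∑ˡ (words n r) (f ∘ (j ∷_)))
    ≡⟨ ∑ˡ-tabulate id (λ j → ∑ˡ (words n r) (f ∘ (j ∷_))) ⟩
  Σℚ.sum (λ j → ∑ˡ (words n r) (f ∘ (j ∷_)))
    ≡⟨ Single-ℚ.sum-single (λ j → ∑ˡ (words n r) (f ∘ (j ∷_))) i (λ j j≢i → ∑ˡ-zero (words n r) λ γ → vanish (j ∷ γ) (j≢i ∘ Vec.∷-injectiveˡ)) ⟩
  ∑ˡ (words n r) (f ∘ (i ∷_))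
    ≡⟨ words-single n w (f ∘ (i ∷_)) (λ γ γ≢w → vanish (i ∷ γ) (γ≢w ∘ Vec.∷-injectiveʳ)) ⟩
  f (i ∷ w) ∎
  where open ≡-Reasoning

-- The arcs from i to the letters of the word, pushed one after the other onto `L`. This is the
-- order in which `D` absorbs the derivatives of `∂*`.
arcs : ∀ {n r} → Fin n → Vec (Fin n) r → List (Arc n) → List (Arc n)
arcs i []      L = L
arcs i (j ∷ γ) L = arcs i γ ((i , j) ∷ L)

arcs-keep : ∀ {n r} (i : Fin n) (γ : Vec (Fin n) r) {L b} → b ∈ L → b ∈ arcs i γ L
arcs-keep i []      b∈ = b∈
arcs-keep i (j ∷ γ) b∈ = arcs-keep i γ (there b∈)

arcs-replicate : ∀ {n} r s (i : Fin n) → arcs i (Vec.replicate r i) (replicate s (i , i)) ≡ replicate (r ℕ.+ s) (i , i)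
arcs-replicate zero    s i = refl
arcs-replicate (suc r) s i = trans (arcs-replicate r (suc s) i) (cong (λ m → replicate m (i , i)) (ℕ.+-suc r s))

module Traces {R : RawRing 0ℓ 0ℓ} {ι : ℚ → RawRing.Carrier R} (E : Evaluation R ι) where
  open Evaluation E
  open Derivatives E
  private
    module R = RawRing R
  open Tensors R ι using (Poly; Tensor; ∂*; constantTerm; tr-A^; nat; operator; ∑; ∏; 1/_!; degreeTensor; adjacencyTensor; A[_]; Tr)

  module _ {n : ℕ} where

    arcs-loops : ∀ r (i : Fin n) {L} → All Loop L → All Loop (arcs i (Vec.replicate r i) L)
    arcs-loops zero    i loops = loops
    arcs-loops (suc r) i loops = arcs-loops r i (refl ∷ loops)

    total-out : ∀ {r} v (i : Fin n) (γ : Vec (Fin n) r) L → total (out v) (arcs i γ L) ≡ r ℕ.* 𝟙 (does (i Fin.≟ v)) ℕ.+ total (out v) L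
    total-out v i []              L = refl
    total-out {suc r} v i (j ∷ γ) L = trans (total-out v i γ ((i , j) ∷ L))
      (exchange (𝟙 (does (i Fin.≟ v))) (r ℕ.* 𝟙 (does (i Fin.≟ v))) (total (out v) L))
      where
      open ℕ-Solver
      exchange : ∀ p q s → q ℕ.+ (p ℕ.+ s) ≡ p ℕ.+ q ℕ.+ s
      exchange = solve 3 (λ p q s → q :+ (p :+ s) := p :+ q :+ s) refl

    total-in : ∀ {r} v (i : Fin n) (γ : Vec (Fin n) r) L → total (in′ v) (arcs i γ L) ≡ occurrences v γ ℕ.+ total (in′ v) L
    total-in v i []      L = refl
    total-in v i (j ∷ γ) L = trans (total-in v i γ ((i , j) ∷ L))
      (exchange (𝟙 (does (j Fin.≟ v))) (occurrences v γ) (total (in′ v) L))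
      where
      open ℕ-Solver
      exchange : ∀ p q s → q ℕ.+ (p ℕ.+ s) ≡ p ℕ.+ q ℕ.+ s
      exchange = solve 3 (λ p q s → q :+ (p :+ s) := p :+ q :+ s) refl

    D-∂* : ∀ {r} L i (γ : Vec (Fin n) r) p → D L (∂* i γ p) ≡ D (arcs i γ L) p
    D-∂* L i []      p = refl
    D-∂* L i (j ∷ γ) p = D-∂* ((i , j) ∷ L) i γ p

    D-operator : ∀ {r} (T : Tensor (suc r) n) L i p →
                 D L (operator {suc r} T i p) ≡ ∑ˡ (words n r) (λ γ → ⟪ T i γ ⟫ * D (arcs i γ L) p)
    D-operator {r} T L i p = trans (D-∑ᴾ L (words n r) _) (∑ˡ-cong (words n r) λ γ →
      trans (D-con⊗ L (T i γ) (∂* i γ p)) (cong (⟪ T i γ ⟫ *_) (D-∂* L i γ p)))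

    D₂ : ∀ {r} → ℕ → Fin n → Fin n → Vec (Fin n) r → Vec (Fin n) r → ℚ
    D₂ N i j γ δ = D (arcs j δ (arcs i γ [])) (tr-A^ N)

    D₁-vanish : ∀ {q} N i (γ : Vec (Fin n) (suc q)) → occurrences i γ ≡ 0 → D (arcs i γ []) (tr-A^ N) ≡ 0ℚ
    D₁-vanish {q} N i γ none = tr-unbalanced i N (arcs i γ []) λ eq → ℕ.1+n≢0 (begin
      suc q                                     ≡⟨ ℕ.*-identityʳ (suc q) ⟨
      suc q ℕ.* 1                               ≡⟨ cong (suc q ℕ.*_) (𝟙-yes (i Fin.≟ i) refl) ⟨
      suc q ℕ.* 𝟙 (does (i Fin.≟ i))            ≡⟨ ℕ.+-identityʳ _ ⟨
      suc q ℕ.* 𝟙 (does (i Fin.≟ i)) ℕ.+ 0      ≡⟨ total-out i i γ [] ⟨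
      total (out i) (arcs i γ [])               ≡⟨ eq ⟩
      total (in′ i) (arcs i γ [])               ≡⟨ total-in i i γ [] ⟩
      occurrences i γ ℕ.+ 0                     ≡⟨ cong (ℕ._+ 0) none ⟩
      0                                         ∎)
      where open ≡-Reasoning

    D₂-vanish : ∀ {r} N v i j (γ δ : Vec (Fin n) r) →
                r ℕ.* 𝟙 (does (j Fin.≟ v)) ℕ.+ r ℕ.* 𝟙 (does (i Fin.≟ v)) ≢ occurrences v δ ℕ.+ occurrences v γ →
                D₂ N i j γ δ ≡ 0ℚ
    D₂-vanish {r} N v i j γ δ ≢ = tr-unbalanced v N (arcs j δ (arcs i γ [])) λ eq → ≢ (begin
      r ℕ.* [ j ] ℕ.+ r ℕ.* [ i ]
        ≡⟨ cong (r ℕ.* [ j ] ℕ.+_) (sym (trans (total-out v i γ []) (ℕ.+-identityʳ _))) ⟩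
      r ℕ.* [ j ] ℕ.+ total (out v) (arcs i γ [])
        ≡⟨ total-out v j δ (arcs i γ []) ⟨
      total (out v) (arcs j δ (arcs i γ []))
        ≡⟨ eq ⟩
      total (in′ v) (arcs j δ (arcs i γ []))
        ≡⟨ total-in v j δ (arcs i γ []) ⟩
      occurrences v δ ℕ.+ total (in′ v) (arcs i γ [])
        ≡⟨ cong (occurrences v δ ℕ.+_) (trans (total-in v i γ []) (ℕ.+-identityʳ _)) ⟩
      occurrences v δ ℕ.+ occurrences v γ ∎)
      where
      open ≡-Reasoning
      [_] : Fin n → ℕ
      [ z ] = 𝟙 (does (z Fin.≟ v))

    D₂-loops : ∀ q i → D₂ (2 ℕ.* suc q) i i (Vec.replicate (suc q) i) (Vec.replicate (suc q) i) ≡ natℚ ((2 ℕ.* suc q) !)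
    D₂-loops q i = trans
      (cong (λ L → D L (tr-A^ (2 ℕ.* suc q)))
        (trans (cong (arcs i (Vec.replicate (suc q) i)) (arcs-replicate (suc q) 0 i)) (arcs-replicate (suc q) (suc q ℕ.+ 0) i)))
      (tr-loops (q ℕ.+ (suc q ℕ.+ 0)) i)

    D₂-distinct-loops : ∀ N q {i j} → i ≢ j → D₂ N i j (Vec.replicate (suc q) i) (Vec.replicate (suc q) j) ≡ 0ℚ
    D₂-distinct-loops N q {i} {j} i≢j = tr-distinct-loops i≢j N _
      (arcs-loops (suc q) j (arcs-loops (suc q) i []))
      (arcs-keep j (Vec.replicate (suc q) j) (arcs-keep i (Vec.replicate q i) (here refl)))
      (arcs-keep j (Vec.replicate q j) (here refl))

  ⟪∑⟫ : ∀ {A : Set} (xs : List A) (f : A → R.Carrier) → ⟪ ∑ xs f ⟫ ≡ ∑ˡ xs (λ x → ⟪ f x ⟫)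
  ⟪∑⟫ []       f = ⟪0⟫
  ⟪∑⟫ (x ∷ xs) f = trans (⟪+⟫ (f x) (∑ xs f)) (cong (⟪ f x ⟫ +_) (⟪∑⟫ xs f))

  ⟪∏⟫ : ∀ {A : Set} (xs : List A) (f : A → R.Carrier) → ⟪ ∏ xs f ⟫ ≡ foldr (λ x s → ⟪ f x ⟫ * s) 1ℚ xs
  ⟪∏⟫ []       f = ⟪1⟫
  ⟪∏⟫ (x ∷ xs) f = trans (⟪*⟫ (f x) (∏ xs f)) (cong (⟪ f x ⟫ *_) (⟪∏⟫ xs f))

  invFact : ℕ → ℕ → ℚ
  invFact r d = ⟪ 1/ (d ℕ.* r) ! ⟫

  invFact-0 : ∀ r → invFact r 0 ≡ 1ℚ
  invFact-0 r = ⟪ι⟫ _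

  ⟪Tr⟫ : ∀ {n r} (T : Tensor (suc r) n) d →
         ⟪ Tr {suc r} T (suc d) ⟫ ≡
         natℚ (r ^ (n ∸ 1)) * ∑ˡ (compositions n (suc d)) (λ ds →
           weight (invFact r) (invFact-0 r) ds * D [] (act (operator {suc r} T) ds (tr-A^ (suc d ℕ.* r))))
  ⟪Tr⟫ {n} {r} T d = trans (⟪*⟫ _ _) (cong₂ _*_ (⟪nat⟫ (r ^ (n ∸ 1))) (trans (⟪∑⟫ (compositions n (suc d)) term)
    (∑ˡ-cong (compositions n (suc d)) λ ds → trans (⟪*⟫ _ (derivative ds))
      (cong (_* ⟪ derivative ds ⟫) (⟪∏⟫ (allFin n) (λ i → 1/ (Vec.lookup ds i ℕ.* r) !))))))
    where
    derivative : Vec ℕ n → R.Carrier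
    derivative ds = constantTerm (act (operator {suc r} T) ds (tr-A^ (suc d ℕ.* r)))

    term : Vec ℕ n → R.Carrier
    term ds = ∏ (allFin n) (λ i → 1/ (Vec.lookup ds i ℕ.* r) !) R.* derivative ds

module TracesOfHypergraph {R : RawRing 0ℓ 0ℓ} {ι : ℚ → RawRing.Carrier R} (E : Evaluation R ι) (α : RawRing.Carrier R) where
  open Evaluation E
  open Derivatives E
  open Traces E
  private
    module R = RawRing R
  open Tensors R ι using (Tensor; constantTerm; tr-A^; nat; operator; degreeTensor; adjacencyTensor; A[_]; Tr)

  x y : ℚ
  x = ⟪ α ⟫
  y = 1ℚ - x

  -- The contribution to Tr₂ of two operators at distinct vertices: the closed
  -- walks i j i along the edges of a graph, which exist for r = 1 only.
  pairTerm : ℕ → ℕ → ℚ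
  pairTerm 1 m = natℚ m * (invFact 1 1 * invFact 1 1 * (y * y * natℚ 2))
  pairTerm _ m = 0ℚ

  module _ (H : Hypergraph) {q m : ℕ} (uniform : Uniform (suc (suc q)) H) (I : EdgeIndexing H m) where
    private
      r = suc q
      n = order H

    open EdgeIndexing I

    dg ad : Fin n → Vec (Fin n) r → ℚ
    dg i γ = ⟪ degreeTensor (suc r) H i γ ⟫
    ad i γ = ⟪ adjacencyTensor (suc r) H i γ ⟫

    deg : Fin n → ℚ
    deg i = natℚ (degree H i)

    loop : Fin n → Vec (Fin n) r
    loop = Vec.replicate r

    entry-split : ∀ i γ → ⟪ A[ α ] (suc r) H i γ ⟫ ≡ x * dg i γ + y * ad i γ
    entry-split i γ = trans (⟪+⟫ _ _) (cong₂ _+_ (⟪*⟫ _ _) (trans (⟪*⟫ _ _)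
      (cong (_* ad i γ) (trans (⟪+⟫ _ _) (cong₂ _+_ ⟪1⟫ (⟪-⟫ α))))))

    dg-loop : ∀ i → dg i (loop i) ≡ deg i
    dg-loop i = trans (cong (λ b → ⟪ if b then nat (degree H i) else R.0# ⟫) (dec-true (Vec.≡-dec Fin._≟_ (loop i) (loop i)) refl))
                      (⟪nat⟫ (degree H i))

    dg-other : ∀ i γ → γ ≢ loop i → dg i γ ≡ 0ℚ
    dg-other i γ ≢ = trans (cong (λ b → ⟪ if b then nat (degree H i) else R.0# ⟫) (dec-false (Vec.≡-dec Fin._≟_ γ (loop i)) ≢)) ⟪0⟫

    -- A nonzero entry means that the k letters of `i ∷ γ` form an edge, which has k vertices by
    -- uniformity; hence no letter is repeated.
    ad-support : ∀ i γ → ad i γ ≡ 0ℚ ⊎ (∀ v → occurrences v (i ∷ γ) ≤ 1)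
    ad-support i γ with vertexSet (i ∷ γ) ∈ᴱ? edges H
    ... | yes e∈ = inj₂ λ v → occurrences≤1 v (i ∷ γ) (All.lookup uniform e∈)
    ... | no _   = inj₁ ⟪0⟫

    -- An adjacency entry allows its cofactor to be studied under the assumption that i is absent
    -- from γ and that γ has no repetition.
    ad-zero : ∀ i γ z → (occurrences i γ ≡ 0 → (∀ v → occurrences v γ ≤ 1) → z ≡ 0ℚ) → ad i γ * z ≡ 0ℚ
    ad-zero i γ z vanish with ad-support i γ
    ... | inj₁ eq = trans (cong (_* z) eq) (ℚ.*-zeroˡ z)
    ... | inj₂ ≤1 = trans (cong (ad i γ *_) (vanish none λ v → ℕ.m+n≤o⇒n≤o (𝟙 (does (i Fin.≟ v))) (≤1 v))) (ℚ.*-zeroʳ (ad i γ))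
      where
      none : occurrences i γ ≡ 0
      none = ℕ.n≤0⇒n≡0 (ℕ.s≤s⁻¹ (subst (λ s → s ℕ.+ occurrences i γ ≤ 1) (𝟙-yes (i Fin.≟ i) refl) (≤1 i)))

    dg-zero : ∀ i γ z → (γ ≡ loop i → z ≡ 0ℚ) → dg i γ * z ≡ 0ℚ
    dg-zero i γ z vanish = helper (Vec.≡-dec Fin._≟_ γ (loop i))
      where
      helper : Dec (γ ≡ loop i) → dg i γ * z ≡ 0ℚ
      helper (yes eq) = trans (cong (dg i γ *_) (vanish eq)) (ℚ.*-zeroʳ (dg i γ))
      helper (no ≢)   = trans (cong (_* z) (dg-other i γ ≢)) (ℚ.*-zeroˡ z)

    ∑-dg : ∀ i (F : Vec (Fin n) r → ℚ) → ∑ˡ (words n r) (λ γ → dg i γ * F γ) ≡ deg i * F (loop i)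
    ∑-dg i F = trans (words-single n (loop i) (λ γ → dg i γ * F γ) λ γ ≢ → trans (cong (_* F γ) (dg-other i γ ≢)) (ℚ.*-zeroˡ (F γ)))
      (cong (_* F (loop i)) (dg-loop i))

    op : Fin n → Tensors.Poly R ι n → Tensors.Poly R ι n
    op = operator {suc r} (A[ α ] (suc r) H)

    -- A single edge term is unbalanced at i, so only the loop word survives. Tr₁ is then governed
    -- by the sum of the degrees, which is mk.
    D-op₁ : ∀ i → D [] (op i (tr-A^ (1 ℕ.* r))) ≡ x * (deg i * natℚ ((1 ℕ.* r) !))
    D-op₁ i = begin
      D [] (op i (tr-A^ (1 ℕ.* r)))
        ≡⟨ D-operator (A[ α ] (suc r) H) [] i (tr-A^ (1 ℕ.* r)) ⟩
      ∑ˡ (words n r) (λ γ → ⟪ A[ α ] (suc r) H i γ ⟫ * F γ)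
        ≡⟨ ∑ˡ-cong (words n r) split ⟩
      ∑ˡ (words n r) (λ γ → x * (dg i γ * F γ))
        ≡⟨ ∑ˡ-* (words n r) x (λ γ → dg i γ * F γ) ⟩
      x * ∑ˡ (words n r) (λ γ → dg i γ * F γ)
        ≡⟨ cong (x *_) (∑-dg i F) ⟩
      x * (deg i * F (loop i))
        ≡⟨ cong (λ z → x * (deg i * z)) (trans (cong (λ L → D L (tr-A^ (1 ℕ.* r))) (arcs-replicate r 0 i)) (tr-loops (q ℕ.+ 0) i)) ⟩
      x * (deg i * natℚ ((1 ℕ.* r) !)) ∎
      where
      open ≡-Reasoning
      F : Vec (Fin n) r → ℚ
      F γ = D (arcs i γ []) (tr-A^ (1 ℕ.* r))

      expand : ∀ x d y e z → (x * d + y * e) * z ≡ x * (d * z) + y * (e * z)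
      expand = solve 5 (λ x d y e z → (x :* d :+ y :* e) :* z := x :* (d :* z) :+ y :* (e :* z)) refl
        where open ℚ-Solver

      split : ∀ γ → ⟪ A[ α ] (suc r) H i γ ⟫ * F γ ≡ x * (dg i γ * F γ)
      split γ = begin
        ⟪ A[ α ] (suc r) H i γ ⟫ * F γ            ≡⟨ cong (_* F γ) (entry-split i γ) ⟩
        (x * dg i γ + y * ad i γ) * F γ           ≡⟨ expand x (dg i γ) y (ad i γ) (F γ) ⟩
        x * (dg i γ * F γ) + y * (ad i γ * F γ)   ≡⟨ cong (λ z → x * (dg i γ * F γ) + y * z) (ad-zero i γ (F γ) λ none _ → D₁-vanish (1 ℕ.* r) i γ none) ⟩
        x * (dg i γ * F γ) + y * 0ℚ               ≡⟨ cong (x * (dg i γ * F γ) +_) (ℚ.*-zeroʳ y) ⟩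
        x * (dg i γ * F γ) + 0ℚ                   ≡⟨ ℚ.+-identityʳ _ ⟩
        x * (dg i γ * F γ)                        ∎

    ⟪Tr₁⟫ : Evaluation.⟪_⟫ E (Tensors.Tr R ι {suc (suc q)} (Tensors.A[_] R ι α (suc (suc q)) H) 1) ≡
            natℚ (r ^ (n ∸ 1)) * (natℚ (Σℕ.sum (degree H)) * (invFact r 1 * x * natℚ ((1 ℕ.* r) !)))
    ⟪Tr₁⟫ = trans (⟪Tr⟫ (A[ α ] (suc r) H) 0) (cong (natℚ (r ^ (n ∸ 1)) *_) (begin
      ∑ˡ (compositions n 1) G
        ≡⟨ compositions-one n G ⟩
      Σℚ.sum (G ∘ unit)
        ≡⟨ Σℚ.sum-cong-≗ (λ i → cong₂ _*_ (weight-unit (invFact r) (invFact-0 r) i)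
             (trans (cong (D []) (act-unit op i (tr-A^ (1 ℕ.* r)))) (D-op₁ i))) ⟩
      Σℚ.sum (λ i → invFact r 1 * (x * (deg i * M)))
        ≡⟨ Σℚ.sum-cong-≗ (λ i → regroup (invFact r 1) x (deg i) M) ⟩
      Σℚ.sum (λ i → deg i * (invFact r 1 * x * M))
        ≡⟨ Σℚ.*-distribʳ-sum (invFact r 1 * x * M) deg ⟨
      Σℚ.sum deg * (invFact r 1 * x * M)
        ≡⟨ cong (_* (invFact r 1 * x * M)) (natℚ-sum (degree H)) ⟩
      natℚ (Σℕ.sum (degree H)) * (invFact r 1 * x * M) ∎))
      where
      open ≡-Reasoning
      M = natℚ ((1 ℕ.* r) !)
      G : Vec ℕ n → ℚ
      G ds = weight (invFact r) (invFact-0 r) ds * D [] (act op ds (tr-A^ (1 ℕ.* r)))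

      regroup : ∀ c x d M → c * (x * (d * M)) ≡ d * (c * x * M)
      regroup = solve 4 (λ c x d M → c :* (x :* (d :* M)) := d :* (c :* x :* M)) refl
        where open ℚ-Solver

    D₂′ : Fin n → Fin n → Vec (Fin n) r → Vec (Fin n) r → ℚ
    D₂′ = D₂ (2 ℕ.* r)

    adjacent₂ : Fin n → Fin n → ℚ
    adjacent₂ i j = ∑ˡ (words n r) (λ γ → ∑ˡ (words n r) (λ δ → ad i γ * (ad j δ * D₂′ i j γ δ)))

    r≢0 : ∀ s → r ℕ.+ s ≢ s
    r≢0 s eq = ℕ.1+n≢0 (ℕ.+-cancelʳ-≡ s r 0 eq)

    𝟙-diag : ∀ (i : Fin n) → 𝟙 (does (i Fin.≟ i)) ≡ 1
    𝟙-diag i = 𝟙-yes (i Fin.≟ i) refl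

    -- Balance at j: the loops at i count equally as incoming and outgoing arcs, while the edge word
    -- of j adds r outgoing arcs and no incoming one.
    loop-edge-zero : ∀ i j γ δ → dg i γ * (ad j δ * D₂′ i j γ δ) ≡ 0ℚ
    loop-edge-zero i j γ δ = dg-zero i γ _ λ { refl → ad-zero j δ _ λ none _ → D₂-vanish (2 ℕ.* r) j i j γ δ λ eq →
      r≢0 (r ℕ.* 𝟙 (does (i Fin.≟ j))) (begin
        r ℕ.+ r ℕ.* 𝟙 (does (i Fin.≟ j))
          ≡⟨ cong (ℕ._+ r ℕ.* 𝟙 (does (i Fin.≟ j))) (trans (sym (ℕ.*-identityʳ r)) (cong (r ℕ.*_) (sym (𝟙-diag j)))) ⟩
        r ℕ.* 𝟙 (does (j Fin.≟ j)) ℕ.+ r ℕ.* 𝟙 (does (i Fin.≟ j))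
          ≡⟨ eq ⟩
        occurrences j δ ℕ.+ occurrences j (loop i)
          ≡⟨ cong₂ ℕ._+_ none (occurrences-replicate r i j) ⟩
        r ℕ.* 𝟙 (does (i Fin.≟ j)) ∎) }
      where open ≡-Reasoning

    -- The mirror image, with the balance taken at i.
    edge-loop-zero : ∀ i j γ δ → ad i γ * (dg j δ * D₂′ i j γ δ) ≡ 0ℚ
    edge-loop-zero i j γ δ = ad-zero i γ _ λ none _ → dg-zero j δ _ λ { refl → D₂-vanish (2 ℕ.* r) i i j γ δ λ eq →
      r≢0 (r ℕ.* 𝟙 (does (j Fin.≟ i))) (begin
        r ℕ.+ r ℕ.* 𝟙 (does (j Fin.≟ i))
          ≡⟨ ℕ.+-comm r _ ⟩
        r ℕ.* 𝟙 (does (j Fin.≟ i)) ℕ.+ r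
          ≡⟨ cong (r ℕ.* 𝟙 (does (j Fin.≟ i)) ℕ.+_) (trans (sym (ℕ.*-identityʳ r)) (cong (r ℕ.*_) (sym (𝟙-diag i)))) ⟩
        r ℕ.* 𝟙 (does (j Fin.≟ i)) ℕ.+ r ℕ.* 𝟙 (does (i Fin.≟ i))
          ≡⟨ eq ⟩
        occurrences i (loop j) ℕ.+ occurrences i γ
          ≡⟨ cong₂ ℕ._+_ (occurrences-replicate r j i) none ⟩
        r ℕ.* 𝟙 (does (j Fin.≟ i)) ℕ.+ 0
          ≡⟨ ℕ.+-identityʳ _ ⟩
        r ℕ.* 𝟙 (does (j Fin.≟ i)) ∎) }
      where open ≡-Reasoning

    -- Of the four products of a diagonal or adjacency part at i with one at j, the two mixed ones
    -- vanish. In the pure diagonal product only the loop words remain.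
    D-op₂ : ∀ i j → D [] (op i (op j (tr-A^ (2 ℕ.* r)))) ≡
            x * x * (deg i * (deg j * D₂′ i j (loop i) (loop j))) + y * y * adjacent₂ i j
    D-op₂ i j = begin
      D [] (op i (op j (tr-A^ (2 ℕ.* r))))
        ≡⟨ D-operator T [] i _ ⟩
      ∑ˡ (words n r) (λ γ → ⟪ T i γ ⟫ * D (arcs i γ []) (op j (tr-A^ (2 ℕ.* r))))
        ≡⟨ ∑ˡ-cong (words n r) (λ γ → trans (cong (⟪ T i γ ⟫ *_) (D-operator T (arcs i γ []) j _))
                                            (sym (∑ˡ-* (words n r) ⟪ T i γ ⟫ _))) ⟩
      ∑ˡ (words n r) (λ γ → ∑ˡ (words n r) (λ δ → ⟪ T i γ ⟫ * (⟪ T j δ ⟫ * W′ γ δ)))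
        ≡⟨ ∑ˡ-cong (words n r) (λ γ → trans (∑ˡ-cong (words n r) (split γ))
             (trans (∑ˡ-+ (words n r) (λ δ → x * x * (dg i γ * (dg j δ * W′ γ δ))) (λ δ → y * y * (ad i γ * (ad j δ * W′ γ δ))))
                    (cong₂ _+_ (∑ˡ-* (words n r) (x * x) (λ δ → dg i γ * (dg j δ * W′ γ δ)))
                               (∑ˡ-* (words n r) (y * y) (λ δ → ad i γ * (ad j δ * W′ γ δ)))))) ⟩
      ∑ˡ (words n r) (λ γ → x * x * loops γ + y * y * adjs γ)
        ≡⟨ trans (∑ˡ-+ (words n r) (λ γ → x * x * loops γ) (λ γ → y * y * adjs γ))
                 (cong₂ _+_ (∑ˡ-* (words n r) (x * x) loops) (∑ˡ-* (words n r) (y * y) adjs)) ⟩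
      x * x * ∑ˡ (words n r) loops + y * y * adjacent₂ i j
        ≡⟨ cong (λ z → x * x * z + y * y * adjacent₂ i j) (trans
             (∑ˡ-cong (words n r) λ γ → trans (∑ˡ-* (words n r) (dg i γ) (λ δ → dg j δ * W′ γ δ)) (cong (dg i γ *_) (∑-dg j (W′ γ))))
             (∑-dg i (λ γ → deg j * W′ γ (loop j)))) ⟩
      x * x * (deg i * (deg j * W′ (loop i) (loop j))) + y * y * adjacent₂ i j ∎
      where
      open ≡-Reasoning
      T : Tensor (suc r) n
      T = A[ α ] (suc r) H

      W′ : Vec (Fin n) r → Vec (Fin n) r → ℚ
      W′ = D₂′ i j

      loops adjs : Vec (Fin n) r → ℚ
      loops γ = ∑ˡ (words n r) (λ δ → dg i γ * (dg j δ * W′ γ δ))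
      adjs  γ = ∑ˡ (words n r) (λ δ → ad i γ * (ad j δ * W′ γ δ))

      expand : ∀ x y d d′ e e′ z → (x * d + y * e) * ((x * d′ + y * e′) * z)
             ≡ (x * x * (d * (d′ * z)) + y * y * (e * (e′ * z))) + x * y * (d * (e′ * z) + e * (d′ * z))
      expand = solve 7 (λ x y d d′ e e′ z → (x :* d :+ y :* e) :* ((x :* d′ :+ y :* e′) :* z)
             := (x :* x :* (d :* (d′ :* z)) :+ y :* y :* (e :* (e′ :* z))) :+ x :* y :* (d :* (e′ :* z) :+ e :* (d′ :* z))) refl
        where open ℚ-Solver

      split : ∀ γ δ → ⟪ T i γ ⟫ * (⟪ T j δ ⟫ * W′ γ δ) ≡ x * x * (dg i γ * (dg j δ * W′ γ δ)) + y * y * (ad i γ * (ad j δ * W′ γ δ))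
      split γ δ = begin
        ⟪ T i γ ⟫ * (⟪ T j δ ⟫ * W′ γ δ)
          ≡⟨ cong₂ (λ s t → s * (t * W′ γ δ)) (entry-split i γ) (entry-split j δ) ⟩
        (x * dg i γ + y * ad i γ) * ((x * dg j δ + y * ad j δ) * W′ γ δ)
          ≡⟨ expand x y (dg i γ) (dg j δ) (ad i γ) (ad j δ) (W′ γ δ) ⟩
        Z + x * y * (dg i γ * (ad j δ * W′ γ δ) + ad i γ * (dg j δ * W′ γ δ))
          ≡⟨ cong₂ (λ s t → Z + x * y * (s + t)) (loop-edge-zero i j γ δ) (edge-loop-zero i j γ δ) ⟩
        Z + x * y * (0ℚ + 0ℚ)
          ≡⟨ cong (Z +_) (ℚ.*-zeroʳ (x * y)) ⟩
        Z + 0ℚ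
          ≡⟨ ℚ.+-identityʳ Z ⟩
        Z ∎
        where Z = x * x * (dg i γ * (dg j δ * W′ γ δ)) + y * y * (ad i γ * (ad j δ * W′ γ δ))

    adjacent₂-zero : ∀ i j → (∀ γ δ → occurrences i γ ≡ 0 → (∀ v → occurrences v δ ≤ 1) → occurrences j δ ≡ 0 → D₂′ i j γ δ ≡ 0ℚ) →
                     adjacent₂ i j ≡ 0ℚ
    adjacent₂-zero i j vanish = ∑ˡ-zero (words n r) λ γ → ∑ˡ-zero (words n r) λ δ →
      ad-zero i γ _ λ i∉γ _ → ad-zero j δ _ λ j∉δ ≤1 → vanish γ δ i∉γ ≤1 j∉δ

    -- Two edge words at the same vertex i give 2r arcs out of i and none into it.
    adjacent₂-diag : ∀ i → adjacent₂ i i ≡ 0ℚ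
    adjacent₂-diag i = adjacent₂-zero i i λ γ δ i∉γ _ i∉δ → D₂-vanish (2 ℕ.* r) i i i γ δ λ eq →
      r≢0 0 (ℕ.m+n≡0⇒m≡0 (r ℕ.+ 0) (trans (sym (cong₂ ℕ._+_ (one i) (trans (one i) (ℕ.+-identityʳ r)))) (trans eq (cong₂ ℕ._+_ i∉δ i∉γ))))
      where
      one : ∀ i → r ℕ.* 𝟙 (does (i Fin.≟ i)) ≡ r ℕ.+ 0
      one i = trans (cong (r ℕ.*_) (𝟙-diag i)) (trans (ℕ.*-identityʳ r) (sym (ℕ.+-identityʳ r)))

    adjacentPairs : ℚ
    adjacentPairs = ∑-pairs n (λ i j → invFact r 1 * invFact r 1 * (y * y * adjacent₂ i j))

    ⟪Tr₂⟫-pairs : ⟪ Tr {suc r} (A[ α ] (suc r) H) 2 ⟫ ≡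
                  natℚ (r ^ (n ∸ 1)) * (natℚ (Σℕ.sum (λ v → degree H v ℕ.* degree H v)) * (invFact r 2 * natℚ ((2 ℕ.* r) !) * (x * x)) + adjacentPairs)
    ⟪Tr₂⟫-pairs = trans (⟪Tr⟫ (A[ α ] (suc r) H) 1) (cong (natℚ (r ^ (n ∸ 1)) *_) (begin
      ∑ˡ (compositions n 2) G
        ≡⟨ compositions-two n G ⟩
      Σℚ.sum (λ i → G (two i i)) + ∑-pairs n (λ i j → G (two i j))
        ≡⟨ cong₂ _+_ (Σℚ.sum-cong-≗ diagonal) (∑-pairs-cong n off-diagonal) ⟩
      Σℚ.sum (λ i → natℚ (degree H i ℕ.* degree H i) * K) + adjacentPairs
        ≡⟨ cong (_+ adjacentPairs) (Σℚ.*-distribʳ-sum K (λ i → natℚ (degree H i ℕ.* degree H i))) ⟨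
      Σℚ.sum (λ i → natℚ (degree H i ℕ.* degree H i)) * K + adjacentPairs
        ≡⟨ cong (λ z → z * K + adjacentPairs) (natℚ-sum (λ v → degree H v ℕ.* degree H v)) ⟩
      natℚ (Σℕ.sum (λ v → degree H v ℕ.* degree H v)) * K + adjacentPairs ∎))
      where
      open ≡-Reasoning
      M = natℚ ((2 ℕ.* r) !)
      K = invFact r 2 * M * (x * x)

      G : Vec ℕ n → ℚ
      G ds = weight (invFact r) (invFact-0 r) ds * D [] (act op ds (tr-A^ (2 ℕ.* r)))

      regroup : ∀ c x d M y → c * (x * x * (d * (d * M)) + y * y * 0ℚ) ≡ d * d * (c * M * (x * x))
      regroup = solve 5 (λ c x d M y → c :* (x :* x :* (d :* (d :* M)) :+ y :* y :* con 0ℚ) := d :* d :* (c :* M :* (x :* x))) refl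
        where open ℚ-Solver

      kill : ∀ x d e z → x * x * (d * (e * 0ℚ)) + z ≡ z
      kill = solve 4 (λ x d e z → x :* x :* (d :* (e :* con 0ℚ)) :+ z := z) refl
        where open ℚ-Solver

      diagonal : ∀ i → G (two i i) ≡ natℚ (degree H i ℕ.* degree H i) * K
      diagonal i = begin
        G (two i i)
          ≡⟨ cong₂ _*_ (weight-two-diag (invFact r) (invFact-0 r) i)
               (trans (cong (D []) (act-two op (tr-A^ (2 ℕ.* r)) (ℕ.≤-refl {toℕ i}))) (D-op₂ i i)) ⟩
        invFact r 2 * (x * x * (deg i * (deg i * D₂′ i i (loop i) (loop i))) + y * y * adjacent₂ i i)
          ≡⟨ cong₂ (λ s t → invFact r 2 * (x * x * (deg i * (deg i * s)) + y * y * t)) (D₂-loops q i) (adjacent₂-diag i) ⟩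
        invFact r 2 * (x * x * (deg i * (deg i * M)) + y * y * 0ℚ)
          ≡⟨ regroup (invFact r 2) x (deg i) M y ⟩
        deg i * deg i * K
          ≡⟨ cong (_* K) (natℚ-* (degree H i) (degree H i)) ⟨
        natℚ (degree H i ℕ.* degree H i) * K ∎

      off-diagonal : ∀ {i j} → i Fin.< j → G (two i j) ≡ invFact r 1 * invFact r 1 * (y * y * adjacent₂ i j)
      off-diagonal {i} {j} i<j = begin
        G (two i j)
          ≡⟨ cong₂ _*_ (weight-two (invFact r) (invFact-0 r) i<j)
               (trans (cong (D []) (act-two op (tr-A^ (2 ℕ.* r)) (ℕ.<⇒≤ i<j))) (D-op₂ i j)) ⟩
        c₁² * (x * x * (deg i * (deg j * D₂′ i j (loop i) (loop j))) + y * y * adjacent₂ i j)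
          ≡⟨ cong (λ s → c₁² * (x * x * (deg i * (deg j * s)) + y * y * adjacent₂ i j)) (D₂-distinct-loops (2 ℕ.* r) q (Fin.<⇒≢ i<j)) ⟩
        c₁² * (x * x * (deg i * (deg j * 0ℚ)) + y * y * adjacent₂ i j)
          ≡⟨ cong (c₁² *_) (kill x (deg i) (deg j) (y * y * adjacent₂ i j)) ⟩
        c₁² * (y * y * adjacent₂ i j) ∎
        where c₁² = invFact r 1 * invFact r 1

  -- Balance at i: r = 2 + q arcs leave i, but γ avoids i and δ contains it at most once.
  adjacent₂-hyper : ∀ H {q m} (uniform : Uniform (3 ℕ.+ q) H) (I : EdgeIndexing H m) i j → i ≢ j →
                    adjacent₂ H uniform I i j ≡ 0ℚ
  adjacent₂-hyper H {q} uniform I i j i≢j = adjacent₂-zero H uniform I i j λ γ δ i∉γ ≤1 _ → D₂-vanish (2 ℕ.* r) i i j γ δ λ eq →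
    ℕ.1+n≰n (ℕ.≤-trans (ℕ.m≤m+n 2 q) (subst (_≤ 1) (trans (sym (cong (occurrences i δ ℕ.+_) i∉γ)) (trans (sym eq) out-i))
      (subst (_≤ 1) (sym (ℕ.+-identityʳ (occurrences i δ))) (≤1 i))))
    where
    r = 2 ℕ.+ q
    out-i : r ℕ.* 𝟙 (does (j Fin.≟ i)) ℕ.+ r ℕ.* 𝟙 (does (i Fin.≟ i)) ≡ r
    out-i = trans (cong₂ (λ s t → r ℕ.* s ℕ.+ r ℕ.* t) (𝟙-no (j Fin.≟ i) (i≢j ∘ sym)) (𝟙-yes (i Fin.≟ i) refl))
                  (cong₂ ℕ._+_ (ℕ.*-zeroʳ r) (ℕ.*-identityʳ r))

  -- Each of i and j has one outgoing arc and needs one incoming arc. This forces γ to be j and δ to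
  -- be i, leaving the digon, whose two closed walks give the factor 2.
  adjacent₂-graph : ∀ H {m} (uniform : Uniform 2 H) (I : EdgeIndexing H m) i j → i ≢ j →
                    adjacent₂ H uniform I i j ≡ 𝟙ℚ (does (vertexSet (i ∷ j ∷ []) ∈ᴱ? edges H)) * natℚ 2
  adjacent₂-graph H uniform I i j i≢j = begin
    ∑ˡ (words n 1) (λ γ → ∑ˡ (words n 1) (λ δ → summand γ δ))
      ≡⟨ words-single n (j ∷ []) (λ γ → ∑ˡ (words n 1) (summand γ)) (λ γ γ≢ → ∑ˡ-zero (words n 1) λ δ → off-γ γ δ γ≢) ⟩
    ∑ˡ (words n 1) (summand (j ∷ []))
      ≡⟨ words-single n (i ∷ []) (summand (j ∷ [])) off-δ ⟩
    summand (j ∷ []) (i ∷ [])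
      ≡⟨ cong (λ z → ad′ i (j ∷ []) * (ad′ j (i ∷ []) * z)) (tr-digon j i) ⟩
    ad′ i (j ∷ []) * (ad′ j (i ∷ []) * natℚ 2)
      ≡⟨ cong₂ (λ s t → s * (t * natℚ 2)) (value i j) (trans (value j i) (cong (λ e → 𝟙ℚ (does (e ∈ᴱ? edges H))) (swap i j))) ⟩
    𝟙ℚ b * (𝟙ℚ b * natℚ 2)
      ≡⟨ idem b ⟩
    𝟙ℚ b * natℚ 2 ∎
    where
    open ≡-Reasoning
    n = order H
    b = does (vertexSet (i ∷ j ∷ []) ∈ᴱ? edges H)

    ad′ : Fin n → Vec (Fin n) 1 → ℚ
    ad′ = ad H uniform I

    summand : Vec (Fin n) 1 → Vec (Fin n) 1 → ℚ
    summand γ δ = ad′ i γ * (ad′ j δ * D₂ 2 i j γ δ)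

    one-out : ∀ {u v} → u ≢ v → 1 ℕ.* 𝟙 (does (v Fin.≟ v)) ℕ.+ 1 ℕ.* 𝟙 (does (u Fin.≟ v)) ≡ 1
    one-out {u} {v} u≢v = cong₂ (λ s t → 1 ℕ.* s ℕ.+ 1 ℕ.* t) (𝟙-yes (v Fin.≟ v) refl) (𝟙-no (u Fin.≟ v) u≢v)

    missing : ∀ {u v} → u ≢ v → occurrences v (u ∷ []) ≡ 0
    missing {u} {v} u≢v = cong (ℕ._+ 0) (𝟙-no (u Fin.≟ v) u≢v)

    off-γ : ∀ γ δ → γ ≢ j ∷ [] → summand γ δ ≡ 0ℚ
    off-γ (p ∷ []) δ γ≢ = ad-zero H uniform I i (p ∷ []) _ λ _ _ → ad-zero H uniform I j δ _ λ j∉δ _ →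
      D₂-vanish 2 j i j (p ∷ []) δ λ eq → ℕ.1+n≢0 (trans (sym (one-out i≢j)) (trans eq
        (cong₂ ℕ._+_ j∉δ (missing (γ≢ ∘ cong (_∷ []))))))

    off-δ : ∀ δ → δ ≢ i ∷ [] → summand (j ∷ []) δ ≡ 0ℚ
    off-δ (p ∷ []) δ≢ = trans (cong (λ z → ad′ i (j ∷ []) * (ad′ j (p ∷ []) * z)) (D₂-vanish 2 i i j (j ∷ []) (p ∷ []) λ eq →
        ℕ.1+n≢0 (trans (sym (trans (ℕ.+-comm (1 ℕ.* 𝟙 (does (j Fin.≟ i))) _) (one-out (i≢j ∘ sym)))) (trans eq
          (cong₂ ℕ._+_ (missing (δ≢ ∘ cong (_∷ []))) (missing (i≢j ∘ sym)))))))
      (trans (cong (ad′ i (j ∷ []) *_) (ℚ.*-zeroʳ (ad′ j (p ∷ [])))) (ℚ.*-zeroʳ (ad′ i (j ∷ []))))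

    value : ∀ u v → ad′ u (v ∷ []) ≡ 𝟙ℚ (does (vertexSet (u ∷ v ∷ []) ∈ᴱ? edges H))
    value u v with does (vertexSet (u ∷ v ∷ []) ∈ᴱ? edges H)
    ... | true  = ⟪ι⟫ _
    ... | false = ⟪0⟫

    swap : ∀ u v → vertexSet (v ∷ u ∷ []) ≡ vertexSet (u ∷ v ∷ [])
    swap u v = trans (sym (Subset.∪-assoc ⁅ v ⁆ ⁅ u ⁆ ∅)) (trans (cong (_∪ ∅) (Subset.∪-comm ⁅ v ⁆ ⁅ u ⁆)) (Subset.∪-assoc ⁅ u ⁆ ⁅ v ⁆ ∅))

    idem : ∀ b → 𝟙ℚ b * (𝟙ℚ b * natℚ 2) ≡ 𝟙ℚ b * natℚ 2
    idem true  = refl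
    idem false = refl

  edge-pairs : ∀ H {m} → Uniform 2 H → EdgeIndexing H m →
               ∑-pairs (order H) (λ i j → 𝟙ℚ (does (vertexSet (i ∷ j ∷ []) ∈ᴱ? edges H))) ≡ natℚ m
  edge-pairs H {m} uniform I = begin
    ∑-pairs (order H) (λ i j → 𝟙ℚ (does (vertexSet (i ∷ j ∷ []) ∈ᴱ? edges H)))
      ≡⟨ ∑-pairs-cong (order H) (λ {i} {j} _ → member (vertexSet (i ∷ j ∷ []))) ⟩
    ∑-pairs (order H) (λ i j → Σℚ.sum (λ s → 𝟙ℚ (does (vertexSet (i ∷ j ∷ []) ≟ˢ edge s))))
      ≡⟨ ∑-pairs-sum (order H) (λ s i j → 𝟙ℚ (does (vertexSet (i ∷ j ∷ []) ≟ˢ edge s))) ⟩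
    Σℚ.sum (λ s → ∑-pairs (order H) (λ i j → 𝟙ℚ (does (vertexSet (i ∷ j ∷ []) ≟ˢ edge s))))
      ≡⟨ Σℚ.sum-cong-≗ (λ s → pair-count (edge s) (All.lookup uniform (edge∈ s))) ⟩
    Σℚ.sum {m} (λ _ → 1ℚ)
      ≡⟨ ones m ⟩
    natℚ m ∎
    where
    open ≡-Reasoning
    open EdgeIndexing I

    ones : ∀ m → Σℚ.sum {m} (λ _ → 1ℚ) ≡ natℚ m
    ones zero    = refl
    ones (suc m) = cong (1ℚ +_) (ones m)

    member : ∀ e → 𝟙ℚ (does (e ∈ᴱ? edges H)) ≡ Σℚ.sum (λ s → 𝟙ℚ (does (e ≟ˢ edge s)))
    member e with e ∈ᴱ? edges H
    ... | no e∉  = sym (Single-ℚ.sum-zero _ λ s → 𝟙ℚ-no (e ≟ˢ edge s) λ { refl → e∉ (edge∈ s) })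
    ... | yes e∈ = let (s , eq) = ∈⇒edge e∈ in sym (trans
      (Single-ℚ.sum-single _ s λ s′ s′≢s → 𝟙ℚ-no (e ≟ˢ edge s′) λ eq′ → s′≢s (distinct (trans (sym eq′) eq)))
      (𝟙ℚ-yes (e ≟ˢ edge s) eq))

  -- The adjacency contribution depends on the hypergraph only through its number of edges, so it
  -- cancels in the comparison with the hyperstar.
  adjacentPairs-value : ∀ H {q m} (uniform : Uniform (suc (suc q)) H) (I : EdgeIndexing H m) →
                        adjacentPairs H uniform I ≡ pairTerm (suc q) m
  adjacentPairs-value H {zero} {m} uniform I = begin
    ∑-pairs n (λ i j → c * (y * y * adjacent₂ H uniform I i j))
      ≡⟨ ∑-pairs-cong n (λ {i} {j} i<j → trans (cong (λ z → c * (y * y * z)) (adjacent₂-graph H uniform I i j (Fin.<⇒≢ i<j)))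
                                               (regroup c y (indicator i j) (natℚ 2))) ⟩
    ∑-pairs n (λ i j → indicator i j * (c * (y * y * natℚ 2)))
      ≡⟨ ∑-pairs-*ʳ n indicator (c * (y * y * natℚ 2)) ⟩
    ∑-pairs n indicator * (c * (y * y * natℚ 2))
      ≡⟨ cong (_* (c * (y * y * natℚ 2))) (edge-pairs H uniform I) ⟩
    natℚ m * (c * (y * y * natℚ 2)) ∎
    where
    open ≡-Reasoning
    n = order H
    c = invFact 1 1 * invFact 1 1

    indicator : Fin n → Fin n → ℚ
    indicator i j = 𝟙ℚ (does (vertexSet (i ∷ j ∷ []) ∈ᴱ? edges H))

    regroup : ∀ c y b z → c * (y * y * (b * z)) ≡ b * (c * (y * y * z))
    regroup = solve 4 (λ c y b z → c :* (y :* y :* (b :* z)) := b :* (c :* (y :* y :* z))) refl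
      where open ℚ-Solver
  adjacentPairs-value H {suc q} uniform I = trans
    (∑-pairs-cong n λ {i} {j} i<j → trans (cong (λ z → c * (y * y * z)) (adjacent₂-hyper H uniform I i j (Fin.<⇒≢ i<j)))
      (trans (cong (c *_) (ℚ.*-zeroʳ (y * y))) (ℚ.*-zeroʳ c)))
    (∑-pairs-zero n)
    where
    n = order H
    c = invFact (2 ℕ.+ q) 1 * invFact (2 ℕ.+ q) 1

  ⟪Tr₂⟫ : ∀ H {q m} (uniform : Uniform (suc (suc q)) H) (I : EdgeIndexing H m) →
          Evaluation.⟪_⟫ E (Tensors.Tr R ι {suc (suc q)} (Tensors.A[_] R ι α (suc (suc q)) H) 2) ≡
          natℚ (suc q ^ (order H ∸ 1)) *
          (natℚ (Σℕ.sum (λ v → degree H v ℕ.* degree H v)) * (invFact (suc q) 2 * natℚ ((2 ℕ.* suc q) !) * (x * x)) + pairTerm (suc q) m)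
  ⟪Tr₂⟫ H {q} uniform I = trans (⟪Tr₂⟫-pairs H uniform I)
    (cong (λ z → natℚ (suc q ^ (order H ∸ 1)) * (natℚ (Σℕ.sum (λ v → degree H v ℕ.* degree H v)) * (invFact (suc q) 2 * natℚ ((2 ℕ.* suc q) !) * (x * x)) + z))
          (adjacentPairs-value H uniform I))

-- With the degree d a variable, Tr is stuck and both sides agree without
-- unfolding it.
Sα-entry : ∀ α k d H t →
           seq (Sα α k d H) t ≡ Evaluation.⟪_⟫ (entry t) (Tensors.Tr ℝ-rawRing fromℚ {k} (Tensors.A[_] ℝ-rawRing fromℚ α k H) d)
Sα-entry α k d H t = refl

-- Comparison of the traces with those of the hyperstar

≗⇒≈ℝ : ∀ u v → (∀ t → seq u t ≡ seq v t) → u ≈ℝ v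
≗⇒≈ℝ u v eq ε 0<ε = 0 , λ t _ →
  subst (λ z → ℚ.∣ z ∣ ℚ.< ε) (sym (trans (cong (_- seq v t) (eq t)) (ℚ.+-inverseʳ (seq v t)))) 0<ε

-- Pairs of edges can be searched exhaustively, so an actual disjoint pair is found; if there were
-- none, `H` would be the hyperstar.
disjoint-pair : ∀ {q m H} (2≤k : 2 ≤ suc (suc q)) → IsUniformHypertree (suc (suc q)) (suc m) H → (I : EdgeIndexing H (suc m)) →
                ¬ (H ≅ hyperstar (suc (suc q)) (suc m) 2≤k) →
                ∃[ i ] ∃[ j ] (i ≢ j × ¬ Meet (EdgeIndexing.edge I i) (EdgeIndexing.edge I j))
disjoint-pair 2≤k T I H≇S
  with Fin.any? (λ i → Fin.any? (λ j → ¬? (i Fin.≟ j) ×-dec ¬? (meet? (EdgeIndexing.edge I i) (EdgeIndexing.edge I j))))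
... | yes p = p
... | no ¬p = contradiction (meeting⇒hyperstar 2≤k T I λ i j i≢j →
                decidable-stable (meet? _ _) λ ¬meet → ¬p (i , j , i≢j , ¬meet)) H≇S

hyperstar-meet : ∀ {r m} (2≤k : 2 ≤ suc r) (I : EdgeIndexing (hyperstar (suc r) m 2≤k) m) →
                 ∀ i j → i ≢ j → Meet (EdgeIndexing.edge I i) (EdgeIndexing.edge I j)
hyperstar-meet {r} {m} 2≤k I i j _ = fzero , centre i , centre j
  where
  open EdgeIndexing I
  centre : ∀ i → Vec._[_]=_ (edge i) fzero _
  centre i with ∈-map⁻ (starEdge (suc r) m) (edge∈ i)
  ... | _ , _ , eq = subst (λ e → Vec._[_]=_ e fzero _) (sym eq) Vec.here

0<natℚ : ∀ {n} → 0 < n → 0ℚ ℚ.< natℚ n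
0<natℚ {suc n} _ = 0<natℚ-suc n

-- The sums of squares are integers, so they differ by at least 1 and the traces by at least P K x².
-- Replacing x by the smaller ε gives a gap that no longer depends on the entry x.
gap : ∀ {P K ε x} s u Y → ℚ.Positive P → ℚ.Positive K → 0ℚ ℚ.< ε → ε ℚ.< x →
      P * (natℚ s * (K * (x * x)) + Y) + P * (K * (ε * ε)) ℚ.< P * (natℚ (suc s ℕ.+ u) * (K * (x * x)) + Y)
gap {P} {K} {ε} {x} s u Y P>0 K>0 0<ε ε<x = begin-strict
  P * (natℚ s * Kx² + Y) + P * (K * (ε * ε))
    <⟨ ℚ.+-monoʳ-< (P * (natℚ s * Kx² + Y)) (ℚ.*-monoʳ-<-pos P {{P>0}} (ℚ.*-monoʳ-<-pos K {{K>0}} ε²<x²)) ⟩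
  P * (natℚ s * Kx² + Y) + P * Kx²
    ≤⟨ ℚ.+-monoʳ-≤ (P * (natℚ s * Kx² + Y)) (ℚ.*-monoˡ-≤-nonNeg P {{ℚ.pos⇒nonNeg P {{P>0}}}}
         (subst (ℚ._≤ (1ℚ + natℚ u) * Kx²) (ℚ.*-identityˡ Kx²) (ℚ.*-monoʳ-≤-nonNeg Kx² {{Kx²≥0}} 1≤1+u))) ⟩
  P * (natℚ s * Kx² + Y) + P * ((1ℚ + natℚ u) * Kx²)
    ≡⟨ regroup P (natℚ s) (natℚ u) Kx² Y ⟩
  P * ((1ℚ + (natℚ s + natℚ u)) * Kx² + Y)
    ≡⟨ cong (λ z → P * ((1ℚ + z) * Kx² + Y)) (natℚ-+ s u) ⟨
  P * (natℚ (suc s ℕ.+ u) * Kx² + Y) ∎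
  where
  open ℚ.≤-Reasoning
  Kx² = K * (x * x)

  0<x : 0ℚ ℚ.< x
  0<x = ℚ.<-trans 0<ε ε<x

  ε²<x² : ε * ε ℚ.< x * x
  ε²<x² = ℚ.<-trans (ℚ.*-monoʳ-<-pos ε {{ℚ.positive 0<ε}} ε<x) (ℚ.*-monoˡ-<-pos x {{ℚ.positive 0<x}} ε<x)

  Kx²≥0 : ℚ.NonNegative Kx²
  Kx²≥0 = ℚ.pos⇒nonNeg Kx² {{ℚ.pos*pos⇒pos K {{K>0}} (x * x) {{ℚ.pos*pos⇒pos x {{ℚ.positive 0<x}} x {{ℚ.positive 0<x}}}}}}

  1≤1+u : 1ℚ ℚ.≤ 1ℚ + natℚ u
  1≤1+u = subst (ℚ._≤ 1ℚ + natℚ u) (ℚ.+-identityʳ 1ℚ) (ℚ.+-monoʳ-≤ 1ℚ (0≤natℚ u))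

  regroup : ∀ P s u k Y → P * (s * k + Y) + P * ((1ℚ + u) * k) ≡ P * ((1ℚ + (s + u)) * k + Y)
  regroup = solve 5 (λ P s u k Y → P :* (s :* k :+ Y) :+ P :* ((con 1ℚ :+ u) :* k) := P :* ((con 1ℚ :+ (s :+ u)) :* k :+ Y)) refl
    where open ℚ-Solver

-- Two different edges rule out size 1. From size 2 on there are at least 3 vertices, and the bound
-- is attained for k = 2 with two edges.
two-in-range : ∀ q m {i j : Fin (suc m)} → i ≢ j →
               2 ≤ suc (suc m ℕ.* suc q) ℕ.* suc q ^ (suc m ℕ.* suc q) ∸ 1
two-in-range q zero    {fzero} {fzero} i≢j = contradiction refl i≢j
two-in-range q (suc m) _ = ℕ.∸-monoˡ-≤ 1
  (ℕ.*-mono-≤ {3} {suc (suc (suc m) ℕ.* suc q)} {1} (s≤s (ℕ.*-mono-≤ {2} {suc (suc m)} {1} {suc q} (s≤s (s≤s z≤n)) (s≤s z≤n)))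
              (ℕ.m^n>0 (suc q) (suc (suc m) ℕ.* suc q)))

module Comparison {q m H} (2≤k : 2 ≤ suc (suc q)) (α : ℝ) (T : IsUniformHypertree (suc (suc q)) (suc m) H)
                  (H≇S : ¬ (H ≅ hyperstar (suc (suc q)) (suc m) 2≤k)) where
  private
    r : ℕ
    r = suc q

    S : Hypergraph
    S = hyperstar (suc (suc q)) (suc m) 2≤k

    U : IsUniformHypertree (suc (suc q)) (suc m) S
    U = hyperstar-isHypertree r (suc m) 2≤k

    module T = IsUniformHypertree T
    module U = IsUniformHypertree U

    I : EdgeIndexing H (suc m)
    I = edgeIndexing H T.size

    J : EdgeIndexing S (suc m)
    J = edgeIndexing S U.size

    disjoint = disjoint-pair 2≤k T I H≇S

    degree² : Hypergraph → ℕ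
    degree² G = Σℕ.sum (λ v → degree G v ℕ.* degree G v)

    degree²-< : degree² H < degree² S
    degree²-< = let (_ , _ , i≢j , ¬meet) = disjoint in sum-degree²-< T I U J (hyperstar-meet 2≤k J) i≢j ¬meet

  same-order : order H ≡ order S
  same-order = hypertree-order T

  in-range : 2 ≤ order H ℕ.* r ^ (order H ∸ 1) ∸ 1
  in-range = subst (λ n → 2 ≤ n ℕ.* r ^ (n ∸ 1) ∸ 1) (sym same-order) (two-in-range q m (proj₁ (proj₂ (proj₂ disjoint))))

  same-Tr₀ : ∀ t → seq (Sα α (suc (suc q)) 0 H) t ≡ seq (Sα α (suc (suc q)) 0 S) t
  same-Tr₀ t = trans (Sα-entry α (suc (suc q)) 0 H t) (trans (⟪nat⟫ (order H ℕ.* r ^ (order H ∸ 1)))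
    (trans (cong (λ n → natℚ (n ℕ.* r ^ (n ∸ 1))) same-order)
      (trans (sym (⟪nat⟫ (order S ℕ.* r ^ (order S ∸ 1)))) (sym (Sα-entry α (suc (suc q)) 0 S t)))))
    where open Derivatives (entry t)

  same-Tr₁ : ∀ t → seq (Sα α (suc (suc q)) 1 H) t ≡ seq (Sα α (suc (suc q)) 1 S) t
  same-Tr₁ t = trans (Sα-entry α (suc (suc q)) 1 H t) (trans (⟪Tr₁⟫ H T.uniform I) (trans
    (cong₂ (λ n s → natℚ (r ^ (n ∸ 1)) * (natℚ s * (invFact r 1 * seq α t * natℚ ((1 ℕ.* r) !)))) same-order
       (trans (sum-degree I T.uniform) (sym (sum-degree J U.uniform))))
    (trans (sym (⟪Tr₁⟫ S U.uniform J)) (sym (Sα-entry α (suc (suc q)) 1 S t)))))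
    where
    open TracesOfHypergraph (entry t) α
    open Traces (entry t) using (invFact)

  less-Tr₂ : 0ℝ <ℝ α → Sα α (suc (suc q)) 2 H <ℝ Sα α (suc (suc q)) 2 S
  less-Tr₂ (ε , 0<ε , N , ε<α) =
    -- `ε` lies below every entry of α from index `N` on, so this rational separates the two traces
    -- at all those indices simultaneously.
    P * (K * (ε * ε)) , P*Kε²>0 , N , λ t N≤t →
      subst₂ (λ v w → v + P * (K * (ε * ε)) ℚ.< w) (sym (value-H t)) (sym (value-S t))
        (gap {P} {K} (degree² H) u (Y t) P>0 K>0 0<ε (subst (ℚ._< seq α t) (ℚ.+-identityˡ ε) (ε<α t N≤t)))
    where
    -- The sum of squares for the star exceeds that for `H` by `suc u`.
    u = proj₁ (ℕ.m≤n⇒∃[o]m+o≡n degree²-<)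

    P K : ℚ
    P = natℚ (r ^ (order S ∸ 1))
    -- Inverse factorials are constant sequences, so entry 0 represents every entry. The product is
    -- (2r)!/(2r)!, and its positivity is what the estimate uses.
    K = Traces.invFact (entry 0) r 2 * natℚ ((2 ℕ.* r) !)

    Y : ℕ → ℚ
    Y t = TracesOfHypergraph.pairTerm (entry t) α r (suc m)

    P>0 : ℚ.Positive P
    P>0 = ℚ.positive (0<natℚ (ℕ.m^n>0 r (order S ∸ 1)))

    K>0 : ℚ.Positive K
    K>0 = ℚ.pos*pos⇒pos (Traces.invFact (entry 0) r 2) {{ℚ.normalize-pos 1 ((2 ℕ.* r) !) {{(2 ℕ.* r) ℕ.!≢0}}}} (natℚ ((2 ℕ.* r) !)) {{ℚ.positive (0<natℚ (ℕ.1≤n! (2 ℕ.* r)))}}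

    P*Kε²>0 : 0ℚ ℚ.< P * (K * (ε * ε))
    P*Kε²>0 = ℚ.positive⁻¹ (P * (K * (ε * ε))) {{ℚ.pos*pos⇒pos P {{P>0}} (K * (ε * ε)) {{ℚ.pos*pos⇒pos K {{K>0}} (ε * ε)
      {{ℚ.pos*pos⇒pos ε {{ℚ.positive 0<ε}} ε {{ℚ.positive 0<ε}}}}}}}}

    value-H : ∀ t → seq (Sα α (suc (suc q)) 2 H) t ≡ P * (natℚ (degree² H) * (K * (seq α t * seq α t)) + Y t)
    value-H t = trans (Sα-entry α (suc (suc q)) 2 H t) (trans (TracesOfHypergraph.⟪Tr₂⟫ (entry t) α H T.uniform I)
      (cong (λ n → natℚ (r ^ (n ∸ 1)) * (natℚ (degree² H) * (K * (seq α t * seq α t)) + Y t)) same-order))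

    value-S : ∀ t → seq (Sα α (suc (suc q)) 2 S) t ≡ P * (natℚ (suc (degree² H) ℕ.+ u) * (K * (seq α t * seq α t)) + Y t)
    value-S t = trans (Sα-entry α (suc (suc q)) 2 S t) (trans (TracesOfHypergraph.⟪Tr₂⟫ (entry t) α S U.uniform J)
      (cong (λ s → P * (natℚ s * (K * (seq α t * seq α t)) + Y t)) (sym (proj₂ (ℕ.m≤n⇒∃[o]m+o≡n degree²-<)))))

theorem6p4 : ∀ (k m : ℕ) (2≤k : 2 ≤ k) → 1 ≤ m →
    (α : ℝ) → 0ℝ <ℝ α → α <ℝ 1ℝ →
    IsLast α k (IsUniformHypertree k m) (hyperstar k m 2≤k)
theorem6p4 (suc zero)      m       (s≤s ())
theorem6p4 k@(suc (suc q)) (suc m) 2≤k _ α 0<α _ =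
  hyperstar-isHypertree (suc q) (suc m) 2≤k , λ H T H≇S →
    let open Comparison 2≤k α T H≇S
        agree : ∀ t → t < 2 → Sα α k t H ≈ℝ Sα α k t (hyperstar k (suc m) 2≤k)
        agree = λ { zero           _              → ≗⇒≈ℝ (Sα α k 0 H) (Sα α k 0 (hyperstar k (suc m) 2≤k)) same-Tr₀
                  ; (suc zero)     _              → ≗⇒≈ℝ (Sα α k 1 H) (Sα α k 1 (hyperstar k (suc m) 2≤k)) same-Tr₁
                  ; (suc (suc _)) (s≤s (s≤s ())) }
    in same-order , 2 , s≤s z≤n , in-range , agree , less-Tr₂ 0<α
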